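{- Let $\Gamma$ be an environment and $M$ a term such that $\Gamma\vdash M$ is well formed. If $[\mathcal{Q},\mathcal{QV},M]\to^*[\mathcal{Q}',\mathcal{QV}',M']$, then $\Gamma,(\mathcal{QV}'-\mathcal{QV})\vdash M'$ is well formed.
   Context: The Q-calculus. Fix an effective enumeration $(\mathbf{U}_i)_{i<\omega}$ of computable unitary operators $\mathbf{U}_i:\mathbb{C}^{2^{n_i}}\to\mathbb{C}^{2^{n_i}}$, and associate to each a constant symbol $U_i$. Terms are given by: classical variables $x$; quantum variables $r$; patterns $\pi::=x\mid\langle x_1,\dots,x_n\rangle$; constants $C::=0\mid 1\mid U_i$; terms $M::=x\mid r\mid\ !M\mid C\mid \mathtt{new}(M)\mid (M_1)M_2\mid\langle M_1,\dots,M_n\rangle\ (n\ge2)\mid \lambda!x.M\mid\lambda\pi.M$, taken modulo $\alpha$-conversion; $M\{N/x\}$ is capture-avoiding substitution. $\mathrm{Q}(M)$ denotes the set of quantum variables occurring in $M$. An environment is a multiset consisting of patterns, items $!x$ ($x$ classical) and quantum variables, in which each variable name occurs at most once; $!\Gamma$ denotes $!x_1,\dots,!x_n$ when $\Gamma=x_1,\dots,x_n$. A judgement $\Gamma\vdash M$ is well formed if derivable by the rules: $\vdash C$; $r\vdash r$; $x\vdash x$; from $\Gamma\vdash M$ infer $\Gamma,!x\vdash M$; from $\Gamma,!x,!y\vdash M$ infer $\Gamma,!z\vdash M\{z/x,z/y\}$; from $!\Gamma\vdash M$ infer $!\Gamma\vdash !M$; from $\Gamma,x\vdash M$ infer $\Gamma,!x\vdash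 M$; from $\Gamma,x_1,\dots,x_k\vdash M$ infer $\Gamma,\langle x_1,\dots,x_k\rangle\vdash M$; from $\Gamma_1\vdash M_1,\dots,\Gamma_k\vdash M_k$ infer $\Gamma_1,\dots,\Gamma_k\vdash\langle M_1,\dots,M_k\rangle$; from $\Gamma\vdash M$ infer $\Gamma\vdash\mathtt{new}(M)$; from $\Gamma,\pi\vdash M$ infer $\Gamma\vdash\lambda\pi.M$; from $\Gamma,!x\vdash M$ infer $\Gamma\vdash\lambda!x.M$; from $\Gamma_1\vdash M_1$ and $\Gamma_2\vdash M_2$ infer $\Gamma_1,\Gamma_2\vdash(M_1)M_2$. Quantum registers: for a finite set $V$ of quantum variables, $\mathcal{H}(V)$ is the Hilbert space of functions $\{0,1\}^V\to\mathbb{C}$ with standard orthonormal basis $\{|f\rangle\}$; for disjoint $V,V'$ one identifies $\mathcal{H}(V)\otimes\mathcal{H}(V')$ with $\mathcal{H}(V\cup V')$. For $\mathbf{U}:\mathbb{C}^{2^n}\to\mathbb{C}^{2^n}$ and distinct $r_1,\dots,r_n\in V$, $\mathbf{U}_{\langle\langle r_1,\dots,r_n\rangle\rangle}$ acts as $\mathbf{U}$ on qubits $r_1,\dots,r_n$ (in order) and as identity elsewhere. A preconfiguration is a triple $[\mathcal{Q},\mathcal{QV},M]$ with $\mathcal{QV}$ a finite set of quantum variables, $\mathcal{Q}\in\mathcal{H}(\mathcal{QV})$ and $\mathrm{Q}(M)\subseteq\mathcal{QV}$; a configuration is an equivalence class of preconfigurations modulo bijective renaming of quantum variables. A configuration is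 well formed if $\Gamma\vdash M$ is well formed for some $\Gamma$. Reduction $\xrightarrow{\alpha}$ is defined on well-formed configurations by the axioms: ($\mathsf{Uq}$) $[\mathcal{Q},\mathcal{QV},U\langle r_1,\dots,r_n\rangle]\to[\mathbf{U}_{\langle\langle r_1,\dots,r_n\rangle\rangle}\mathcal{Q},\mathcal{QV},\langle r_1,\dots,r_n\rangle]$; ($\mathsf{new}$) $[\mathcal{Q},\mathcal{QV},\mathtt{new}(c)]\to[\mathcal{Q}\otimes|r\mapsto c\rangle,\mathcal{QV}\cup\{r\},r]$ for $c\in\{0,1\}$, $r$ fresh; ($\mathsf{l.\beta}$) $(\lambda x.M)N\to M\{N/x\}$; ($\mathsf{q.\beta}$) $(\lambda\langle x_1,\dots,x_n\rangle.M)\langle r_1,\dots,r_n\rangle\to M\{r_1/x_1,\dots,r_n/x_n\}$; ($\mathsf{c.\beta}$) $(\lambda!x.M)!N\to M\{N/x\}$; ($\mathsf{l.cm}$) $L((\lambda\pi.M)N)\to(\lambda\pi.LM)N$; ($\mathsf{r.cm}$) $((\lambda\pi.M)N)L\to(\lambda\pi.ML)N$ (the last five leave $\mathcal{Q},\mathcal{QV}$ unchanged); closed under the contexts: a tuple component, either side of an application, the body of $\lambda\pi.(\cdot)$ (no reduction inside $!M$). $\to$ is the union of all $\xrightarrow{\alpha}$ and $\to^*$ its reflexive–transitive closure. -}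

module Defs where

-- Representation choices:
--  * Terms modulo alpha-conversion are represented in the locally-nameless
--    style: free classical variables are names (ℕ), bound classical variables
--    are de Bruijn pairs  bvar i j  (i = binder depth, j = component of the
--    binder's pattern).  Quantum variables are names (ℕ), a separate sort.
--  * Environments are lists of items, treated as multisets via an explicit
--    exchange (permutation) rule.

open import Level using (0ℓ)
open import Algebra.Bundles using (CommutativeRing)
open import Data.Bool using (Bool; true; false; if_then_else_; _∨_)
open import Data.Nat using (ℕ; zero; suc; _+_; _∸_; _<ᵇ_; _≡ᵇ_; NonZero)
open import Data.List using (List; []; _∷_; _++_; map; concat; length; foldr)
open import Data.List.Membership.Propositional using (_∈_; _∉_)
open import Data.List.Relation.Unary.All using (All)
open import Data.List.Relation.Unary.Unique.Propositional using (Unique)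
open import Data.List.Relation.Binary.Pointwise using (Pointwise)
open import Data.List.Relation.Binary.Permutation.Propositional using (_↭_)
open import Data.Vec using (Vec) renaming ([] to []ᵥ; _∷_ to _∷ᵥ_)
import Data.Vec as Vec
open import Data.Product using (∃; _×_; _,_)
open import Relation.Binary.PropositionalEquality using (_≡_)

-- binders of the form  λπ  (π a pattern):
--   pv      : π = x                 (linear variable)
--   ptup n  : π = ⟨x₁,…,x_{n+2}⟩    (tuple pattern, at least 2 components)
data PBinder : Set where
  pv   : PBinder
  ptup : ℕ → PBinder

data Term : Set where
  fvar    : ℕ → Term
  bvar    : ℕ → ℕ → Term          -- bound classical variable (depth, component)
  qvar    : ℕ → Term
  bang    : Term → Term
  czero   : Term
  cone    : Term
  cU      : ℕ → Term
  new     : Term → Term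
  app     : Term → Term → Term
  tup     : Term → Term → List Term → Term
  lamBang : Term → Term           -- λ!x.M   (binds component 0)
  lamPat  : PBinder → Term → Term

mutual
  fv : Term → List ℕ
  fv (fvar x) = x ∷ []
  fv (bvar _ _) = []
  fv (qvar _) = []
  fv (bang M) = fv M
  fv czero = []
  fv cone = []
  fv (cU _) = []
  fv (new M) = fv M
  fv (app M N) = fv M ++ fv N
  fv (tup M N Ms) = fv M ++ fv N ++ fvs Ms
  fv (lamBang M) = fv M
  fv (lamPat _ M) = fv M

  fvs : List Term → List ℕ
  fvs [] = []
  fvs (M ∷ Ms) = fv M ++ fvs Ms

mutual
  qvs : Term → List ℕ
  qvs (fvar _) = []
  qvs (bvar _ _) = []
  qvs (qvar r) = r ∷ []
  qvs (bang M) = qvs M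
  qvs czero = []
  qvs cone = []
  qvs (cU _) = []
  qvs (new M) = qvs M
  qvs (app M N) = qvs M ++ qvs N
  qvs (tup M N Ms) = qvs M ++ qvs N ++ qvss Ms
  qvs (lamBang M) = qvs M
  qvs (lamPat _ M) = qvs M

  qvss : List Term → List ℕ
  qvss [] = []
  qvss (M ∷ Ms) = qvs M ++ qvss Ms

mutual
  shift : ℕ → ℕ → Term → Term
  shift c d (fvar x) = fvar x
  shift c d (bvar i j) = if i <ᵇ c then bvar i j else bvar (i + d) j
  shift c d (qvar r) = qvar r
  shift c d (bang M) = bang (shift c d M)
  shift c d czero = czero
  shift c d cone = cone
  shift c d (cU i) = cU i
  shift c d (new M) = new (shift c d M)
  shift c d (app M N) = app (shift c d M) (shift c d N)
  shift c d (tup M N Ms) = tup (shift c d M) (shift c d N) (shifts c d Ms)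
  shift c d (lamBang M) = lamBang (shift (suc c) d M)
  shift c d (lamPat p M) = lamPat p (shift (suc c) d M)

  shifts : ℕ → ℕ → List Term → List Term
  shifts c d [] = []
  shifts c d (M ∷ Ms) = shift c d M ∷ shifts c d Ms

lookupT : List Term → ℕ → Term → Term
lookupT [] j dflt = dflt
lookupT (N ∷ Ns) zero dflt = N
lookupT (N ∷ Ns) (suc j) dflt = lookupT Ns j dflt

mutual
  substB : ℕ → List Term → Term → Term
  substB k Ns (fvar x) = fvar x
  substB k Ns (bvar i j) =
    if i <ᵇ k then bvar i j
    else (if i ≡ᵇ k then shift 0 k (lookupT Ns j (bvar i j))
          else bvar (i ∸ 1) j)
  substB k Ns (qvar r) = qvar r
  substB k Ns (bang M) = bang (substB k Ns M)
  substB k Ns czero = czero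
  substB k Ns cone = cone
  substB k Ns (cU i) = cU i
  substB k Ns (new M) = new (substB k Ns M)
  substB k Ns (app M N) = app (substB k Ns M) (substB k Ns N)
  substB k Ns (tup M N Ms) = tup (substB k Ns M) (substB k Ns N) (substBs k Ns Ms)
  substB k Ns (lamBang M) = lamBang (substB (suc k) Ns M)
  substB k Ns (lamPat p M) = lamPat p (substB (suc k) Ns M)

  substBs : ℕ → List Term → List Term → List Term
  substBs k Ns [] = []
  substBs k Ns (M ∷ Ms) = substB k Ns M ∷ substBs k Ns Ms

-- opening the body of a binder:  M{N₁/x₁,…,N_k/x_k}
open0 : List Term → Term → Term
open0 Ns M = substB 0 Ns M

mutual
  renameF : (ℕ → ℕ) → Term → Term
  renameF ρ (fvar x) = fvar (ρ x)
  renameF ρ (bvar i j) = bvar i j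
  renameF ρ (qvar r) = qvar r
  renameF ρ (bang M) = bang (renameF ρ M)
  renameF ρ czero = czero
  renameF ρ cone = cone
  renameF ρ (cU i) = cU i
  renameF ρ (new M) = new (renameF ρ M)
  renameF ρ (app M N) = app (renameF ρ M) (renameF ρ N)
  renameF ρ (tup M N Ms) = tup (renameF ρ M) (renameF ρ N) (renameFs ρ Ms)
  renameF ρ (lamBang M) = lamBang (renameF ρ M)
  renameF ρ (lamPat p M) = lamPat p (renameF ρ M)

  renameFs : (ℕ → ℕ) → List Term → List Term
  renameFs ρ [] = []
  renameFs ρ (M ∷ Ms) = renameF ρ M ∷ renameFs ρ Ms

contrRen : ℕ → ℕ → ℕ → ℕ → ℕ
contrRen x y z v = if (v ≡ᵇ x) ∨ (v ≡ᵇ y) then z else v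

data Item : Set where
  lin   : ℕ → Item
  tupP  : ℕ → ℕ → List ℕ → Item
  bangI : ℕ → Item
  qv    : ℕ → Item

Env : Set
Env = List Item

cnames : Item → List ℕ
cnames (lin x) = x ∷ []
cnames (tupP x y xs) = x ∷ y ∷ xs
cnames (bangI x) = x ∷ []
cnames (qv r) = []

qnames : Item → List ℕ
qnames (qv r) = r ∷ []
qnames _ = []

IsEnv : Env → Set
IsEnv Γ = Unique (concat (map cnames Γ)) × Unique (concat (map qnames Γ))

IsBang : Item → Set
IsBang it = ∃ λ x → it ≡ bangI x

infix 4 _⊢_
data _⊢_ : Env → Term → Set where
  ax-0    : [] ⊢ czero
  ax-1    : [] ⊢ cone
  ax-U    : ∀ i → [] ⊢ cU i
  ax-q    : ∀ r → (qv r ∷ []) ⊢ qvar r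
  ax-c    : ∀ x → (lin x ∷ []) ⊢ fvar x
  -- environments are multisets
  exch    : ∀ {Γ Δ M} → Γ ⊢ M → Γ ↭ Δ → Δ ⊢ M
  weak    : ∀ {Γ M x} → Γ ⊢ M → IsEnv (bangI x ∷ Γ) → (bangI x ∷ Γ) ⊢ M
  contr   : ∀ {Γ M x y z} → (bangI x ∷ bangI y ∷ Γ) ⊢ M → IsEnv (bangI z ∷ Γ) →
            (bangI z ∷ Γ) ⊢ renameF (contrRen x y z) M
  prom    : ∀ {Γ M} → All IsBang Γ → Γ ⊢ M → Γ ⊢ bang M
  der     : ∀ {Γ M x} → (lin x ∷ Γ) ⊢ M → (bangI x ∷ Γ) ⊢ M
  pat     : ∀ {Γ M x y xs} → (map lin (x ∷ y ∷ xs) ++ Γ) ⊢ M → (tupP x y xs ∷ Γ) ⊢ M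
  tupR    : ∀ {Γ₁ Γ₂ Γs M₁ M₂ Ms} → Γ₁ ⊢ M₁ → Γ₂ ⊢ M₂ → Pointwise _⊢_ Γs Ms →
            IsEnv (Γ₁ ++ Γ₂ ++ concat Γs) → (Γ₁ ++ Γ₂ ++ concat Γs) ⊢ tup M₁ M₂ Ms
  newR    : ∀ {Γ M} → Γ ⊢ M → Γ ⊢ new M
  lam-x   : ∀ {Γ M x} → x ∉ fv M → (lin x ∷ Γ) ⊢ open0 (fvar x ∷ []) M → Γ ⊢ lamPat pv M
  lam-tup : ∀ {Γ M x y xs} → All (λ v → v ∉ fv M) (x ∷ y ∷ xs) →
            (tupP x y xs ∷ Γ) ⊢ open0 (map fvar (x ∷ y ∷ xs)) M →
            Γ ⊢ lamPat (ptup (length xs)) M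
  lam-!   : ∀ {Γ M x} → x ∉ fv M → (bangI x ∷ Γ) ⊢ open0 (fvar x ∷ []) M → Γ ⊢ lamBang M
  appR    : ∀ {Γ₁ Γ₂ M₁ M₂} → Γ₁ ⊢ M₁ → Γ₂ ⊢ M₂ → IsEnv (Γ₁ ++ Γ₂) → (Γ₁ ++ Γ₂) ⊢ app M₁ M₂

record QData : Set₁ where
  field
    R     : CommutativeRing 0ℓ 0ℓ          -- the amplitudes (ℂ in the paper)
    arity : ℕ → ℕ
    mat   : (i : ℕ) → Vec Bool (arity i) → Vec Bool (arity i) → CommutativeRing.Carrier R
    -- matrix of U_i, rows/columns indexed by the standard basis of (ℂ²)^{⊗ n_i}

module _ (D : QData) where
  open QData D
  open CommutativeRing R using (Carrier; 0#; 1#) renaming (_+_ to _+R_; _*_ to _*R_)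

  -- a quantum register: a function from assignments {0,1}^V → amplitudes
  -- (assignments are given on all quantum variable names; an element of
  -- H(QV) is one that only depends on the values at QV)
  State : Set
  State = (ℕ → Bool) → Carrier

  allBits : (n : ℕ) → List (Vec Bool n)
  allBits zero = []ᵥ ∷ []
  allBits (suc n) = map (true ∷ᵥ_) (allBits n) ++ map (false ∷ᵥ_) (allBits n)

  override : ∀ {n} → Vec ℕ n → Vec Bool n → (ℕ → Bool) → (ℕ → Bool)
  override []ᵥ []ᵥ f = f
  override (r ∷ᵥ rs) (b ∷ᵥ bs) f v = if v ≡ᵇ r then b else override rs bs f v

  -- U_i acting on qubits r₁,…,r_n (in order), identity elsewhere
  applyU : (i : ℕ) → Vec ℕ (arity i) → State → State
  applyU i rs Q f =
    foldr (λ b acc → (mat i (Vec.map f rs) b *R Q (override rs b f)) +R acc) 0#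
          (allBits (arity i))

  -- Q ⊗ |r ↦ c⟩
  tensorNew : State → ℕ → Bool → State
  tensorNew Q r c f = Q f *R (if f r ≡ᵇB c then 1# else 0#)
    where
    _≡ᵇB_ : Bool → Bool → Bool
    true ≡ᵇB true = true
    false ≡ᵇB false = true
    _ ≡ᵇB _ = false

  record Config : Set where
    constructor ⟦_,_,_⟧
    field
      st : State
      qV : List ℕ
      tm : Term

  qtuple : List ℕ → Term
  qtuple [] = czero
  qtuple (r ∷ []) = qvar r
  qtuple (r₁ ∷ r₂ ∷ rs) = tup (qvar r₁) (qvar r₂) (map qvar rs)

  constBit : Bool → Term
  constBit false = czero
  constBit true = cone

  data Step : Config → Config → Set where
    Uq    : ∀ {Q V} i (rs : Vec ℕ (arity i)) → NonZero (arity i) → Unique (Vec.toList rs) →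
            Step ⟦ Q , V , app (cU i) (qtuple (Vec.toList rs)) ⟧
                 ⟦ applyU i rs Q , V , qtuple (Vec.toList rs) ⟧
    newS  : ∀ {Q V} c r → r ∉ V →
            Step ⟦ Q , V , new (constBit c) ⟧ ⟦ tensorNew Q r c , r ∷ V , qvar r ⟧
    lβ    : ∀ {Q V M N} → Step ⟦ Q , V , app (lamPat pv M) N ⟧ ⟦ Q , V , open0 (N ∷ []) M ⟧
    qβ    : ∀ {Q V M r₁ r₂ rs} →
            Step ⟦ Q , V , app (lamPat (ptup (length rs)) M) (tup (qvar r₁) (qvar r₂) (map qvar rs)) ⟧
                 ⟦ Q , V , open0 (map qvar (r₁ ∷ r₂ ∷ rs)) M ⟧
    cβ    : ∀ {Q V M N} → Step ⟦ Q , V , app (lamBang M) (bang N) ⟧ ⟦ Q , V , open0 (N ∷ []) M ⟧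
    lcm   : ∀ {Q V p M N L} →
            Step ⟦ Q , V , app L (app (lamPat p M) N) ⟧
                 ⟦ Q , V , app (lamPat p (app (shift 0 1 L) M)) N ⟧
    rcm   : ∀ {Q V p M N L} →
            Step ⟦ Q , V , app (app (lamPat p M) N) L ⟧
                 ⟦ Q , V , app (lamPat p (app M (shift 0 1 L))) N ⟧
    appL  : ∀ {Q V Q' V' M M' N} → Step ⟦ Q , V , M ⟧ ⟦ Q' , V' , M' ⟧ →
            Step ⟦ Q , V , app M N ⟧ ⟦ Q' , V' , app M' N ⟧
    appR' : ∀ {Q V Q' V' M N N'} → Step ⟦ Q , V , N ⟧ ⟦ Q' , V' , N' ⟧ →
            Step ⟦ Q , V , app M N ⟧ ⟦ Q' , V' , app M N' ⟧
    tup₁  : ∀ {Q V Q' V' M M' N Ms} → Step ⟦ Q , V , M ⟧ ⟦ Q' , V' , M' ⟧ →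
            Step ⟦ Q , V , tup M N Ms ⟧ ⟦ Q' , V' , tup M' N Ms ⟧
    tup₂  : ∀ {Q V Q' V' M N N' Ms} → Step ⟦ Q , V , N ⟧ ⟦ Q' , V' , N' ⟧ →
            Step ⟦ Q , V , tup M N Ms ⟧ ⟦ Q' , V' , tup M N' Ms ⟧
    tupₙ  : ∀ {Q V Q' V' M N K K' pre post} → Step ⟦ Q , V , K ⟧ ⟦ Q' , V' , K' ⟧ →
            Step ⟦ Q , V , tup M N (pre ++ K ∷ post) ⟧ ⟦ Q' , V' , tup M N (pre ++ K' ∷ post) ⟧
    lamB  : ∀ {Q V Q' V' p M M'} → Step ⟦ Q , V , M ⟧ ⟦ Q' , V' , M' ⟧ →
            Step ⟦ Q , V , lamPat p M ⟧ ⟦ Q' , V' , lamPat p M' ⟧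

  WellFormedC : Config → Set
  WellFormedC C = ∃ λ Γ → Γ ⊢ Config.tm C

  infix 4 _⟶_
  _⟶_ : Config → Config → Set
  C ⟶ C' = WellFormedC C × Step C C'

-- Well-formed judgements are characterised by counting occurrences. Write #lin t M and
-- #bang t M for the numbers of occurrences of a variable t in M outside of any ! and inside some !.
-- Then Γ ⊢ M holds exactly when Γ ⊨ M: the names declared in Γ are distinct, the free classical
-- and quantum variables of M are declared in Γ, every linear item of Γ (a variable x, each
-- component of a pattern, a quantum variable) has #lin = 1 and #bang = 0 in M, and inside M bound
-- indices are in scope and every λπ-bound variable has #lin = 1 and #bang = 0 in its body.
--
-- Completeness is an induction on the size of M, nested
-- with an induction on a measure μ of the environment items that no syntax-directed rule can
-- consume: patterns are split by the pattern rule, and a !x occurring zero times or at least twice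
-- is removed by weakening or by contraction (after renaming one occurrence of x apart).
--
-- A reduction step preserves #lin and #bang of every variable without banged occurrences, except
-- that new(c) adds one occurrence of its fresh qubit, and it keeps absent variables absent: a
-- linear β-step substitutes for a variable used exactly once, and a !-β-step copies an argument !N
-- in which such variables do not occur at all. So Γ ⊨ M persists along the reduction, with the
-- fresh qubits added to Γ.

module Submission where

open import Defs
open import Data.Nat using (ℕ; _≟_)
open import Data.List using (List; _++_; map; filter)
open import Data.List.Relation.Unary.All using (All)
open import Data.List.Membership.Propositional using (_∈_)
open import Data.List.Membership.DecPropositional _≟_ using (_∉?_)
open import Relation.Binary.Construct.Closure.ReflexiveTransitive using (Star)

open import Data.Bool using (true; false; if_then_else_)
open import Data.Empty using (⊥; ⊥-elim)
open import Data.List using ([]; _∷_; concat; length; fromMaybe)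
import Data.List.Properties as LP
open import Data.List.Properties using (++-assoc; ++-identityʳ)
open import Data.List.Membership.DecPropositional _≟_ using (_∈?_)
open import Data.List.Membership.Propositional using (_∉_)
import Data.List.Membership.Propositional.Properties as MP
open import Data.List.Relation.Binary.Pointwise using (Pointwise; []; _∷_)
import Data.List.Relation.Binary.Permutation.Propositional as Perm
open import Data.List.Relation.Binary.Permutation.Propositional using (_↭_; prep; swap; ↭-sym; ↭-refl)
import Data.List.Relation.Binary.Permutation.Propositional.Properties as PP
import Data.List.Relation.Unary.All as AllM
open AllM using ([]; _∷_)
import Data.List.Relation.Unary.All.Properties as AllP
open import Data.List.Relation.Unary.AllPairs using ([]; _∷_)
open import Data.List.Relation.Unary.Any using (here; there)
open import Data.List.Relation.Unary.Unique.Propositional using (Unique)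
open import Data.List.Relation.Unary.Unique.Propositional.Properties using (Unique[x∷xs]⇒x∉xs)
import Data.List.Relation.Unary.Unique.Propositional.Properties as UniqueP
open import Data.Maybe using (Maybe; just; nothing)
open import Data.Nat using (zero; suc; _+_; _*_; _∸_; _<ᵇ_; _≡ᵇ_; _≤_; _<_; z≤n; s≤s; _⊔_)
open import Data.Nat.Properties
open import Algebra.Properties.CommutativeSemigroup +-commutativeSemigroup using (interchange; x∙yz≈y∙xz; xy∙z≈xz∙y)
open import Data.Nat.Solver using (module +-*-Solver)
open import Data.Product using (∃; Σ; _×_; _,_; proj₁; proj₂)
open import Data.Sum using (_⊎_; inj₁; inj₂; [_,_]′)
open import Data.Unit using (⊤; tt)
open import Function using (_∘_; case_of_)
open import Relation.Binary.Construct.Closure.ReflexiveTransitive using (ε; _◅_)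
open import Relation.Binary.PropositionalEquality using (setoid; _≡_; _≢_; refl; sym; trans; cong; cong₂; subst; module ≡-Reasoning)
open import Relation.Nullary using (¬_; ¬?; Dec; yes; no)
import Data.List.Relation.Binary.Permutation.Setoid.Properties (setoid ℕ) as PermS

-- Occurrence counts

≡ᵇ-view : ∀ m n → (m ≡ n × (m ≡ᵇ n) ≡ true) ⊎ (m ≢ n × (m ≡ᵇ n) ≡ false)
≡ᵇ-view zero zero = inj₁ (refl , refl)
≡ᵇ-view zero (suc n) = inj₂ ((λ ()) , refl)
≡ᵇ-view (suc m) zero = inj₂ ((λ ()) , refl)
≡ᵇ-view (suc m) (suc n) with ≡ᵇ-view m n
... | inj₁ (e , b) = inj₁ (cong suc e , b)
... | inj₂ (e , b) = inj₂ ((λ q → e (suc-injective q)) , b)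

<ᵇ-view : ∀ m n → (m < n × (m <ᵇ n) ≡ true) ⊎ (n ≤ m × (m <ᵇ n) ≡ false)
<ᵇ-view zero zero = inj₂ (z≤n , refl)
<ᵇ-view zero (suc n) = inj₁ (s≤s z≤n , refl)
<ᵇ-view (suc m) zero = inj₂ (z≤n , refl)
<ᵇ-view (suc m) (suc n) with <ᵇ-view m n
... | inj₁ (e , b) = inj₁ (s≤s e , b)
... | inj₂ (e , b) = inj₂ (s≤s e , b)

≡ᵇ-refl : ∀ n → (n ≡ᵇ n) ≡ true
≡ᵇ-refl zero = refl
≡ᵇ-refl (suc n) = ≡ᵇ-refl n

δ : ℕ → ℕ → ℕ
δ m n = if m ≡ᵇ n then 1 else 0

δ-refl : ∀ n → δ n n ≡ 1
δ-refl n rewrite ≡ᵇ-refl n = refl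

δ-≢ : ∀ {m n} → m ≢ n → δ m n ≡ 0
δ-≢ {m} {n} ne with ≡ᵇ-view m n
... | inj₁ (e , _) = ⊥-elim (ne e)
... | inj₂ (_ , b) rewrite b = refl

δ-pos : ∀ {m n} → 0 < δ m n → m ≡ n
δ-pos {m} {n} p with ≡ᵇ-view m n
... | inj₁ (e , _) = e
... | inj₂ (_ , b) rewrite b with p
... | ()

data Var : Set where
  free : ℕ → Var
  qbit : ℕ → Var
  bound : ℕ → ℕ → Var

hitFree : Var → ℕ → ℕ
hitFree (free x) y = δ x y
hitFree (qbit _) _ = 0
hitFree (bound _ _) _ = 0

hitQbit : Var → ℕ → ℕ
hitQbit (free _) _ = 0
hitQbit (qbit r) s = δ r s
hitQbit (bound _ _) _ = 0

hitBound : Var → ℕ → ℕ → ℕ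
hitBound (free _) _ _ = 0
hitBound (qbit _) _ _ = 0
hitBound (bound e j) i k = δ e i * δ j k

↑ : Var → Var
↑ (free x) = free x
↑ (qbit r) = qbit r
↑ (bound e j) = bound (suc e) j

data Mode : Set where
  linear banged total : Mode

leafCount : Mode → ℕ → ℕ
leafCount linear n = n
leafCount banged n = 0
leafCount total n = n

leafCount-zero : ∀ m → leafCount m 0 ≡ 0
leafCount-zero linear = refl
leafCount-zero banged = refl
leafCount-zero total = refl

mutual
  occ : Mode → Var → Term → ℕ
  occ m t (fvar x) = leafCount m (hitFree t x)
  occ m t (bvar i j) = leafCount m (hitBound t i j)
  occ m t (qvar r) = leafCount m (hitQbit t r)
  occ m t (bang M) = occ! m t M
  occ m t czero = 0
  occ m t cone = 0
  occ m t (cU _) = 0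
  occ m t (new M) = occ m t M
  occ m t (app M N) = occ m t M + occ m t N
  occ m t (tup M N Ms) = occ m t M + (occ m t N + occs m t Ms)
  occ m t (lamBang M) = occ m (↑ t) M
  occ m t (lamPat _ M) = occ m (↑ t) M

  occ! : Mode → Var → Term → ℕ
  occ! linear t M = 0
  occ! banged t M = occ linear t M + occ banged t M
  occ! total t M = occ total t M

  occs : Mode → Var → List Term → ℕ
  occs m t [] = 0
  occs m t (M ∷ Ms) = occ m t M + occs m t Ms

#lin #bang #all : Var → Term → ℕ
#lin = occ linear
#bang = occ banged
#all = occ total

#lins #bangs #alls : Var → List Term → ℕ
#lins = occs linear
#bangs = occs banged
#alls = occs total

mutual
  #lin+#bang≡#all : ∀ t M → #lin t M + #bang t M ≡ #all t M
  #lin+#bang≡#all t (fvar x) = +-identityʳ _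
  #lin+#bang≡#all t (bvar i j) = +-identityʳ _
  #lin+#bang≡#all t (qvar r) = +-identityʳ _
  #lin+#bang≡#all t (bang M) = #lin+#bang≡#all t M
  #lin+#bang≡#all t czero = refl
  #lin+#bang≡#all t cone = refl
  #lin+#bang≡#all t (cU _) = refl
  #lin+#bang≡#all t (new M) = #lin+#bang≡#all t M
  #lin+#bang≡#all t (app M N) = trans (interchange (#lin t M) (#lin t N) (#bang t M) (#bang t N)) (cong₂ _+_ (#lin+#bang≡#all t M) (#lin+#bang≡#all t N))
  #lin+#bang≡#all t (tup M N Ms) = trans (interchange (#lin t M) _ (#bang t M) _) (cong₂ _+_ (#lin+#bang≡#all t M)
                          (trans (interchange (#lin t N) (#lins t Ms) (#bang t N) (#bangs t Ms)) (cong₂ _+_ (#lin+#bang≡#all t N) (#lins+#bangs≡#alls t Ms))))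
  #lin+#bang≡#all t (lamBang M) = #lin+#bang≡#all (↑ t) M
  #lin+#bang≡#all t (lamPat _ M) = #lin+#bang≡#all (↑ t) M

  #lins+#bangs≡#alls : ∀ t Ms → #lins t Ms + #bangs t Ms ≡ #alls t Ms
  #lins+#bangs≡#alls t [] = refl
  #lins+#bangs≡#alls t (M ∷ Ms) = trans (interchange (#lin t M) (#lins t Ms) (#bang t M) (#bangs t Ms)) (cong₂ _+_ (#lin+#bang≡#all t M) (#lins+#bangs≡#alls t Ms))

mutual
  size : Term → ℕ
  size (fvar x) = 1
  size (bvar i j) = 1
  size (qvar r) = 1
  size (bang M) = suc (size M)
  size czero = 1
  size cone = 1
  size (cU _) = 1
  size (new M) = suc (size M)
  size (app M N) = suc (size M + size N)
  size (tup M N Ms) = suc (size M + (size N + sizes Ms))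
  size (lamBang M) = suc (size M)
  size (lamPat _ M) = suc (size M)

  sizes : List Term → ℕ
  sizes [] = 0
  sizes (M ∷ Ms) = size M + sizes Ms

InScope : List ℕ → ℕ → ℕ → Set
InScope [] i j = ⊥
InScope (a ∷ c) zero j = j < a
InScope (a ∷ c) (suc i) j = InScope c i j

width : PBinder → ℕ
width pv = 1
width (ptup n) = suc (suc n)

LinearBinder : ℕ → Term → Set
LinearBinder a M = ∀ j → j < a → #lin (bound 0 j) M ≡ 1 × #bang (bound 0 j) M ≡ 0

mutual
  WellBound : List ℕ → Term → Set
  WellBound c (fvar _) = ⊤
  WellBound c (bvar i j) = InScope c i j
  WellBound c (qvar _) = ⊤
  WellBound c (bang M) = WellBound c M
  WellBound c czero = ⊤
  WellBound c cone = ⊤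
  WellBound c (cU _) = ⊤
  WellBound c (new M) = WellBound c M
  WellBound c (app M N) = WellBound c M × WellBound c N
  WellBound c (tup M N Ms) = WellBound c M × (WellBound c N × WellBounds c Ms)
  WellBound c (lamBang M) = WellBound (1 ∷ c) M
  WellBound c (lamPat p M) = WellBound (width p ∷ c) M × LinearBinder (width p) M

  WellBounds : List ℕ → List Term → Set
  WellBounds c [] = ⊤
  WellBounds c (M ∷ Ms) = WellBound c M × WellBounds c Ms


+-posˡ : ∀ {a} b → 0 < a → 0 < a + b
+-posˡ {suc a} b p = s≤s z≤n

+-posʳ : ∀ a {b} → 0 < b → 0 < a + b
+-posʳ a {b} p = ≤-trans p (m≤n+m b a)

+-pos⁻ : ∀ a b → 0 < a + b → 0 < a ⊎ 0 < b
+-pos⁻ zero b p = inj₂ p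
+-pos⁻ (suc a) b p = inj₁ (s≤s z≤n)

mutual
  fv⇒occurs : ∀ {x} M → x ∈ fv M → 0 < #all (free x) M
  fv⇒occurs {x} (fvar y) (here refl) rewrite δ-refl x = s≤s z≤n
  fv⇒occurs (bang M) p = fv⇒occurs M p
  fv⇒occurs (new M) p = fv⇒occurs M p
  fv⇒occurs (app M N) p with MP.∈-++⁻ (fv M) p
  ... | inj₁ q = +-posˡ _ (fv⇒occurs M q)
  ... | inj₂ q = +-posʳ _ (fv⇒occurs N q)
  fv⇒occurs (tup M N Ms) p with MP.∈-++⁻ (fv M) p
  ... | inj₁ q = +-posˡ _ (fv⇒occurs M q)
  ... | inj₂ q with MP.∈-++⁻ (fv N) q
  ... | inj₁ r = +-posʳ (#all _ M) (+-posˡ _ (fv⇒occurs N r))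
  ... | inj₂ r = +-posʳ (#all _ M) (+-posʳ (#all _ N) (fvs⇒occurs Ms r))
  fv⇒occurs (lamBang M) p = fv⇒occurs M p
  fv⇒occurs (lamPat _ M) p = fv⇒occurs M p

  fvs⇒occurs : ∀ {x} Ms → x ∈ fvs Ms → 0 < #alls (free x) Ms
  fvs⇒occurs (M ∷ Ms) p with MP.∈-++⁻ (fv M) p
  ... | inj₁ q = +-posˡ _ (fv⇒occurs M q)
  ... | inj₂ q = +-posʳ _ (fvs⇒occurs Ms q)

mutual
  occurs⇒fv : ∀ {x} M → 0 < #all (free x) M → x ∈ fv M
  occurs⇒fv (fvar y) p = here (δ-pos p)
  occurs⇒fv (bvar i j) ()
  occurs⇒fv (qvar r) ()
  occurs⇒fv (bang M) p = occurs⇒fv M p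
  occurs⇒fv czero ()
  occurs⇒fv cone ()
  occurs⇒fv (cU _) ()
  occurs⇒fv (new M) p = occurs⇒fv M p
  occurs⇒fv {x} (app M N) p with +-pos⁻ (#all (free x) M) _ p
  ... | inj₁ q = MP.∈-++⁺ˡ (occurs⇒fv M q)
  ... | inj₂ q = MP.∈-++⁺ʳ (fv M) (occurs⇒fv N q)
  occurs⇒fv {x} (tup M N Ms) p with +-pos⁻ (#all (free x) M) _ p
  ... | inj₁ q = MP.∈-++⁺ˡ (occurs⇒fv M q)
  ... | inj₂ q with +-pos⁻ (#all (free x) N) _ q
  ... | inj₁ r = MP.∈-++⁺ʳ (fv M) (MP.∈-++⁺ˡ (occurs⇒fv N r))
  ... | inj₂ r = MP.∈-++⁺ʳ (fv M) (MP.∈-++⁺ʳ (fv N) (occurs⇒fvs Ms r))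
  occurs⇒fv (lamBang M) p = occurs⇒fv M p
  occurs⇒fv (lamPat _ M) p = occurs⇒fv M p

  occurs⇒fvs : ∀ {x} Ms → 0 < #alls (free x) Ms → x ∈ fvs Ms
  occurs⇒fvs [] ()
  occurs⇒fvs {x} (M ∷ Ms) p with +-pos⁻ (#all (free x) M) _ p
  ... | inj₁ q = MP.∈-++⁺ˡ (occurs⇒fv M q)
  ... | inj₂ q = MP.∈-++⁺ʳ (fv M) (occurs⇒fvs Ms q)

mutual
  qvs⇒occurs : ∀ {x} M → x ∈ qvs M → 0 < #all (qbit x) M
  qvs⇒occurs {x} (qvar y) (here refl) rewrite δ-refl x = s≤s z≤n
  qvs⇒occurs (bang M) p = qvs⇒occurs M p
  qvs⇒occurs (new M) p = qvs⇒occurs M p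
  qvs⇒occurs (app M N) p with MP.∈-++⁻ (qvs M) p
  ... | inj₁ q = +-posˡ _ (qvs⇒occurs M q)
  ... | inj₂ q = +-posʳ _ (qvs⇒occurs N q)
  qvs⇒occurs (tup M N Ms) p with MP.∈-++⁻ (qvs M) p
  ... | inj₁ q = +-posˡ _ (qvs⇒occurs M q)
  ... | inj₂ q with MP.∈-++⁻ (qvs N) q
  ... | inj₁ r = +-posʳ (#all _ M) (+-posˡ _ (qvs⇒occurs N r))
  ... | inj₂ r = +-posʳ (#all _ M) (+-posʳ (#all _ N) (qvss⇒occurs Ms r))
  qvs⇒occurs (lamBang M) p = qvs⇒occurs M p
  qvs⇒occurs (lamPat _ M) p = qvs⇒occurs M p

  qvss⇒occurs : ∀ {x} Ms → x ∈ qvss Ms → 0 < #alls (qbit x) Ms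
  qvss⇒occurs (M ∷ Ms) p with MP.∈-++⁻ (qvs M) p
  ... | inj₁ q = +-posˡ _ (qvs⇒occurs M q)
  ... | inj₂ q = +-posʳ _ (qvss⇒occurs Ms q)

mutual
  occurs⇒qvs : ∀ {x} M → 0 < #all (qbit x) M → x ∈ qvs M
  occurs⇒qvs (fvar y) ()
  occurs⇒qvs (qvar y) p = here (δ-pos p)
  occurs⇒qvs (bvar i j) ()
  occurs⇒qvs (bang M) p = occurs⇒qvs M p
  occurs⇒qvs czero ()
  occurs⇒qvs cone ()
  occurs⇒qvs (cU _) ()
  occurs⇒qvs (new M) p = occurs⇒qvs M p
  occurs⇒qvs {x} (app M N) p with +-pos⁻ (#all (qbit x) M) _ p
  ... | inj₁ q = MP.∈-++⁺ˡ (occurs⇒qvs M q)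
  ... | inj₂ q = MP.∈-++⁺ʳ (qvs M) (occurs⇒qvs N q)
  occurs⇒qvs {x} (tup M N Ms) p with +-pos⁻ (#all (qbit x) M) _ p
  ... | inj₁ q = MP.∈-++⁺ˡ (occurs⇒qvs M q)
  ... | inj₂ q with +-pos⁻ (#all (qbit x) N) _ q
  ... | inj₁ r = MP.∈-++⁺ʳ (qvs M) (MP.∈-++⁺ˡ (occurs⇒qvs N r))
  ... | inj₂ r = MP.∈-++⁺ʳ (qvs M) (MP.∈-++⁺ʳ (qvs N) (occurs⇒qvss Ms r))
  occurs⇒qvs (lamBang M) p = occurs⇒qvs M p
  occurs⇒qvs (lamPat _ M) p = occurs⇒qvs M p

  occurs⇒qvss : ∀ {x} Ms → 0 < #alls (qbit x) Ms → x ∈ qvss Ms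
  occurs⇒qvss [] ()
  occurs⇒qvss {x} (M ∷ Ms) p with +-pos⁻ (#all (qbit x) M) _ p
  ... | inj₁ q = MP.∈-++⁺ˡ (occurs⇒qvs M q)
  ... | inj₂ q = MP.∈-++⁺ʳ (qvs M) (occurs⇒qvss Ms q)

∉fv⇒#all≡0 : ∀ {x} M → ¬ (x ∈ fv M) → #all (free x) M ≡ 0
∉fv⇒#all≡0 M h = n≤0⇒n≡0 (≮⇒≥ (λ p → h (occurs⇒fv M p)))

∉qvs⇒#all≡0 : ∀ {x} M → ¬ (x ∈ qvs M) → #all (qbit x) M ≡ 0
∉qvs⇒#all≡0 M h = n≤0⇒n≡0 (≮⇒≥ (λ p → h (occurs⇒qvs M p)))

#all≡0⇒#lin≡0 : ∀ t M → #all t M ≡ 0 → #lin t M ≡ 0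
#all≡0⇒#lin≡0 t M e = m+n≡0⇒m≡0 (#lin t M) (trans (#lin+#bang≡#all t M) e)

#all≡0⇒#bang≡0 : ∀ t M → #all t M ≡ 0 → #bang t M ≡ 0
#all≡0⇒#bang≡0 t M e = m+n≡0⇒n≡0 (#lin t M) (trans (#lin+#bang≡#all t M) e)

shiftVar : ℕ → ℕ → Var → Var
shiftVar c n (free x) = free x
shiftVar c n (qbit r) = qbit r
shiftVar c n (bound e j) = if e <ᵇ c then bound e j else bound (e + n) j

liftVar : ℕ → Var → Var
liftVar c (free x) = free x
liftVar c (qbit r) = qbit r
liftVar c (bound e j) = if e <ᵇ c then bound e j else bound (suc e) j

↑-shiftVar : ∀ c n t → ↑ (shiftVar c n t) ≡ shiftVar (suc c) n (↑ t)
↑-shiftVar c n (free x) = refl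
↑-shiftVar c n (qbit x) = refl
↑-shiftVar c n (bound e j) with <ᵇ-view e c
... | inj₁ (_ , b) rewrite b = refl
... | inj₂ (_ , b) rewrite b = refl

↑-liftVar : ∀ c t → ↑ (liftVar c t) ≡ liftVar (suc c) (↑ t)
↑-liftVar c (free x) = refl
↑-liftVar c (qbit x) = refl
↑-liftVar c (bound e j) with <ᵇ-view e c
... | inj₁ (_ , b) rewrite b = refl
... | inj₂ (_ , b) rewrite b = refl

occ-shift-bvar : ∀ m c n t i j → occ m (shiftVar c n t) (shift c n (bvar i j)) ≡ occ m t (bvar i j)
occ-shift-bvar m c n (free x) i j with <ᵇ-view i c
... | inj₁ (_ , b) rewrite b = refl
... | inj₂ (_ , b) rewrite b = refl
occ-shift-bvar m c n (qbit x) i j with <ᵇ-view i c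
... | inj₁ (_ , b) rewrite b = refl
... | inj₂ (_ , b) rewrite b = refl
occ-shift-bvar m c n (bound e k) i j with <ᵇ-view i c | <ᵇ-view e c
... | inj₁ (_ , b) | inj₁ (_ , b2) rewrite b | b2 = refl
... | inj₁ (p , b) | inj₂ (q , b2) rewrite b | b2
      | δ-≢ {e + n} {i} (λ z → <⇒≢ (<-≤-trans p (≤-trans q (m≤m+n e n))) (sym z))
      | δ-≢ {e} {i} (λ z → <⇒≢ (<-≤-trans p q) (sym z)) = refl
... | inj₂ (p , b) | inj₁ (q , b2) rewrite b | b2
      | δ-≢ {e} {i + n} (λ z → <⇒≢ (<-≤-trans q (≤-trans p (m≤m+n i n))) z)
      | δ-≢ {e} {i} (λ z → <⇒≢ (<-≤-trans q p) z) = refl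
... | inj₂ (_ , b) | inj₂ (_ , b2) rewrite b | b2 with ≡ᵇ-view e i
... | inj₁ (refl , _) rewrite δ-refl e | δ-refl (e + n) = refl
... | inj₂ (ne , _) rewrite δ-≢ ne | δ-≢ {e + n} {i + n} (λ z → ne (+-cancelʳ-≡ n e i z)) = refl

hitFree-shiftVar : ∀ c n t x → hitFree (shiftVar c n t) x ≡ hitFree t x
hitFree-shiftVar c n (free y) x = refl
hitFree-shiftVar c n (qbit y) x = refl
hitFree-shiftVar c n (bound e j) x with e <ᵇ c
... | true = refl
... | false = refl

hitQbit-shiftVar : ∀ c n t x → hitQbit (shiftVar c n t) x ≡ hitQbit t x
hitQbit-shiftVar c n (free y) x = refl
hitQbit-shiftVar c n (qbit y) x = refl
hitQbit-shiftVar c n (bound e j) x with e <ᵇ c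
... | true = refl
... | false = refl

hitFree-liftVar : ∀ c t x → hitFree (liftVar c t) x ≡ hitFree t x
hitFree-liftVar c (free y) x = refl
hitFree-liftVar c (qbit y) x = refl
hitFree-liftVar c (bound e j) x with e <ᵇ c
... | true = refl
... | false = refl

hitQbit-liftVar : ∀ c t x → hitQbit (liftVar c t) x ≡ hitQbit t x
hitQbit-liftVar c (free y) x = refl
hitQbit-liftVar c (qbit y) x = refl
hitQbit-liftVar c (bound e j) x with e <ᵇ c
... | true = refl
... | false = refl

mutual
  occ-shift : ∀ m c n t N → occ m (shiftVar c n t) (shift c n N) ≡ occ m t N
  occ-shift m c n t (fvar x) = cong (leafCount m) (hitFree-shiftVar c n t x)
  occ-shift m c n t (bvar i j) = occ-shift-bvar m c n t i j
  occ-shift m c n t (qvar x) = cong (leafCount m) (hitQbit-shiftVar c n t x)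
  occ-shift linear c n t (bang N) = refl
  occ-shift banged c n t (bang N) = cong₂ _+_ (occ-shift linear c n t N) (occ-shift banged c n t N)
  occ-shift total c n t (bang N) = occ-shift total c n t N
  occ-shift m c n t czero = refl
  occ-shift m c n t cone = refl
  occ-shift m c n t (cU x) = refl
  occ-shift m c n t (new N) = occ-shift m c n t N
  occ-shift m c n t (app M N) = cong₂ _+_ (occ-shift m c n t M) (occ-shift m c n t N)
  occ-shift m c n t (tup M N Ms) = cong₂ _+_ (occ-shift m c n t M) (cong₂ _+_ (occ-shift m c n t N) (occs-shift m c n t Ms))
  occ-shift m c n t (lamBang N) rewrite ↑-shiftVar c n t = occ-shift m (suc c) n (↑ t) N
  occ-shift m c n t (lamPat p N) rewrite ↑-shiftVar c n t = occ-shift m (suc c) n (↑ t) N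

  occs-shift : ∀ m c n t Ns → occs m (shiftVar c n t) (shifts c n Ns) ≡ occs m t Ns
  occs-shift m c n t [] = refl
  occs-shift m c n t (N ∷ Ns) = cong₂ _+_ (occ-shift m c n t N) (occs-shift m c n t Ns)

shiftVar-0-1 : ∀ t → shiftVar 0 1 t ≡ ↑ t
shiftVar-0-1 (free x) = refl
shiftVar-0-1 (qbit x) = refl
shiftVar-0-1 (bound e j) = cong (λ z → bound z j) (+-comm e 1)

occ-↑-shift : ∀ m t N → occ m (↑ t) (shift 0 1 N) ≡ occ m t N
occ-↑-shift m t N = trans (cong (λ z → occ m z (shift 0 1 N)) (sym (shiftVar-0-1 t))) (occ-shift m 0 1 t N)

occ-shift-gap-bvar : ∀ m c n e k i j → c ≤ e → e < c + n → occ m (bound e k) (shift c n (bvar i j)) ≡ 0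
occ-shift-gap-bvar m c n e k i j p q with <ᵇ-view i c
... | inj₁ (r , b) rewrite b | δ-≢ {e} {i} (λ z → <⇒≢ (<-≤-trans r p) (sym z)) = leafCount-zero m
... | inj₂ (r , b) rewrite b | δ-≢ {e} {i + n} (λ z → <⇒≢ (<-≤-trans q (+-monoˡ-≤ n r)) z) = leafCount-zero m

mutual
  occ-shift-gap : ∀ m c n e k N → c ≤ e → e < c + n → occ m (bound e k) (shift c n N) ≡ 0
  occ-shift-gap m c n e k (fvar x) p q = leafCount-zero m
  occ-shift-gap m c n e k (bvar i j) p q = occ-shift-gap-bvar m c n e k i j p q
  occ-shift-gap m c n e k (qvar x) p q = leafCount-zero m
  occ-shift-gap linear c n e k (bang N) p q = refl
  occ-shift-gap banged c n e k (bang N) p q = cong₂ _+_ (occ-shift-gap linear c n e k N p q) (occ-shift-gap banged c n e k N p q)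
  occ-shift-gap total c n e k (bang N) p q = occ-shift-gap total c n e k N p q
  occ-shift-gap m c n e k czero p q = refl
  occ-shift-gap m c n e k cone p q = refl
  occ-shift-gap m c n e k (cU x) p q = refl
  occ-shift-gap m c n e k (new N) p q = occ-shift-gap m c n e k N p q
  occ-shift-gap m c n e k (app M N) p q = cong₂ _+_ (occ-shift-gap m c n e k M p q) (occ-shift-gap m c n e k N p q)
  occ-shift-gap m c n e k (tup M N Ms) p q = cong₂ _+_ (occ-shift-gap m c n e k M p q) (cong₂ _+_ (occ-shift-gap m c n e k N p q) (occs-shift-gap m c n e k Ms p q))
  occ-shift-gap m c n e k (lamBang N) p q = occ-shift-gap m (suc c) n (suc e) k N (s≤s p) (s≤s q)
  occ-shift-gap m c n e k (lamPat _ N) p q = occ-shift-gap m (suc c) n (suc e) k N (s≤s p) (s≤s q)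

  occs-shift-gap : ∀ m c n e k Ns → c ≤ e → e < c + n → occs m (bound e k) (shifts c n Ns) ≡ 0
  occs-shift-gap m c n e k [] p q = refl
  occs-shift-gap m c n e k (N ∷ Ns) p q = cong₂ _+_ (occ-shift-gap m c n e k N p q) (occs-shift-gap m c n e k Ns p q)

occ-liftVar-shift-bvar : ∀ m c d t i j → occ m (liftVar c t) (shift c (suc d) (bvar i j)) ≡ occ m t (shift c d (bvar i j))
occ-liftVar-shift-bvar m c d (free x) i j with <ᵇ-view i c
... | inj₁ (_ , b) rewrite b = refl
... | inj₂ (_ , b) rewrite b = refl
occ-liftVar-shift-bvar m c d (qbit x) i j with <ᵇ-view i c
... | inj₁ (_ , b) rewrite b = refl
... | inj₂ (_ , b) rewrite b = refl
occ-liftVar-shift-bvar m c d (bound e k) i j with <ᵇ-view i c | <ᵇ-view e c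
... | inj₁ (_ , b) | inj₁ (_ , b2) rewrite b | b2 = refl
... | inj₁ (p , b) | inj₂ (q , b2) rewrite b | b2
      | δ-≢ {suc e} {i} (λ z → <⇒≢ (<-≤-trans p (≤-trans q (n≤1+n e))) (sym z))
      | δ-≢ {e} {i} (λ z → <⇒≢ (<-≤-trans p q) (sym z)) = refl
... | inj₂ (p , b) | inj₁ (q , b2) rewrite b | b2
      | δ-≢ {e} {i + suc d} (λ z → <⇒≢ (<-≤-trans q (≤-trans p (m≤m+n i (suc d)))) z)
      | δ-≢ {e} {i + d} (λ z → <⇒≢ (<-≤-trans q (≤-trans p (m≤m+n i d))) z) = refl
... | inj₂ (_ , b) | inj₂ (_ , b2) rewrite b | b2 | +-suc i d = refl

mutual
  occ-liftVar-shift : ∀ m c d t N → occ m (liftVar c t) (shift c (suc d) N) ≡ occ m t (shift c d N)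
  occ-liftVar-shift m c d t (fvar x) = cong (leafCount m) (hitFree-liftVar c t x)
  occ-liftVar-shift m c d t (bvar i j) = occ-liftVar-shift-bvar m c d t i j
  occ-liftVar-shift m c d t (qvar x) = cong (leafCount m) (hitQbit-liftVar c t x)
  occ-liftVar-shift linear c d t (bang N) = refl
  occ-liftVar-shift banged c d t (bang N) = cong₂ _+_ (occ-liftVar-shift linear c d t N) (occ-liftVar-shift banged c d t N)
  occ-liftVar-shift total c d t (bang N) = occ-liftVar-shift total c d t N
  occ-liftVar-shift m c d t czero = refl
  occ-liftVar-shift m c d t cone = refl
  occ-liftVar-shift m c d t (cU x) = refl
  occ-liftVar-shift m c d t (new N) = occ-liftVar-shift m c d t N
  occ-liftVar-shift m c d t (app M N) = cong₂ _+_ (occ-liftVar-shift m c d t M) (occ-liftVar-shift m c d t N)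
  occ-liftVar-shift m c d t (tup M N Ms) = cong₂ _+_ (occ-liftVar-shift m c d t M) (cong₂ _+_ (occ-liftVar-shift m c d t N) (occs-liftVar-shift m c d t Ms))
  occ-liftVar-shift m c d t (lamBang N) rewrite ↑-liftVar c t = occ-liftVar-shift m (suc c) d (↑ t) N
  occ-liftVar-shift m c d t (lamPat p N) rewrite ↑-liftVar c t = occ-liftVar-shift m (suc c) d (↑ t) N

  occs-liftVar-shift : ∀ m c d t Ns → occs m (liftVar c t) (shifts c (suc d) Ns) ≡ occs m t (shifts c d Ns)
  occs-liftVar-shift m c d t [] = refl
  occs-liftVar-shift m c d t (N ∷ Ns) = cong₂ _+_ (occ-liftVar-shift m c d t N) (occs-liftVar-shift m c d t Ns)

mutual
  shift-zero : ∀ c N → shift c 0 N ≡ N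
  shift-zero c (fvar x) = refl
  shift-zero c (bvar i j) with <ᵇ-view i c
  ... | inj₁ (_ , b) rewrite b = refl
  ... | inj₂ (_ , b) rewrite b | +-identityʳ i = refl
  shift-zero c (qvar x) = refl
  shift-zero c (bang N) = cong bang (shift-zero c N)
  shift-zero c czero = refl
  shift-zero c cone = refl
  shift-zero c (cU x) = refl
  shift-zero c (new N) = cong new (shift-zero c N)
  shift-zero c (app M N) = cong₂ app (shift-zero c M) (shift-zero c N)
  shift-zero c (tup M N Ms) rewrite shift-zero c M | shift-zero c N | shifts-zero c Ms = refl
  shift-zero c (lamBang N) = cong lamBang (shift-zero (suc c) N)
  shift-zero c (lamPat p N) = cong (lamPat p) (shift-zero (suc c) N)

  shifts-zero : ∀ c Ns → shifts c 0 Ns ≡ Ns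
  shifts-zero c [] = refl
  shifts-zero c (N ∷ Ns) = cong₂ _∷_ (shift-zero c N) (shifts-zero c Ns)

InScope-inner : ∀ c₂ X Y i j → i < length c₂ → InScope (c₂ ++ X) i j → InScope (c₂ ++ Y) i j
InScope-inner (a ∷ c₂) X Y zero j p q = q
InScope-inner (a ∷ c₂) X Y (suc i) j (s≤s p) q = InScope-inner c₂ X Y i j p q

InScope-weaken : ∀ c₁ c i j → InScope c i j → InScope (c₁ ++ c) (i + length c₁) j
InScope-weaken [] c i j q rewrite +-identityʳ i = q
InScope-weaken (a ∷ c₁) c i j q rewrite +-suc i (length c₁) = InScope-weaken c₁ c i j q

InScope-outer : ∀ c₂ c₁ c i j → length c₂ ≤ i → InScope (c₂ ++ c) i j → InScope (c₂ ++ c₁ ++ c) (i + length c₁) j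
InScope-outer [] c₁ c i j p q = InScope-weaken c₁ c i j q
InScope-outer (a ∷ c₂) c₁ c (suc i) j (s≤s p) q = InScope-outer c₂ c₁ c i j p q

LinearBinder-shift : ∀ a k n M → LinearBinder a M → LinearBinder a (shift (suc k) n M)
LinearBinder-shift a k n M l j p = trans (occ-shift linear (suc k) n (bound 0 j) M) (proj₁ (l j p)) , trans (occ-shift banged (suc k) n (bound 0 j) M) (proj₂ (l j p))

mutual
  WellBound-shift : ∀ c₂ c₁ c N → WellBound (c₂ ++ c) N → WellBound (c₂ ++ c₁ ++ c) (shift (length c₂) (length c₁) N)
  WellBound-shift c₂ c₁ c (fvar x) w = tt
  WellBound-shift c₂ c₁ c (bvar i j) w with <ᵇ-view i (length c₂)
  ... | inj₁ (p , b) rewrite b = InScope-inner c₂ c (c₁ ++ c) i j p w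
  ... | inj₂ (p , b) rewrite b = InScope-outer c₂ c₁ c i j p w
  WellBound-shift c₂ c₁ c (qvar x) w = tt
  WellBound-shift c₂ c₁ c (bang N) w = WellBound-shift c₂ c₁ c N w
  WellBound-shift c₂ c₁ c czero w = tt
  WellBound-shift c₂ c₁ c cone w = tt
  WellBound-shift c₂ c₁ c (cU x) w = tt
  WellBound-shift c₂ c₁ c (new N) w = WellBound-shift c₂ c₁ c N w
  WellBound-shift c₂ c₁ c (app M N) (w1 , w2) = WellBound-shift c₂ c₁ c M w1 , WellBound-shift c₂ c₁ c N w2
  WellBound-shift c₂ c₁ c (tup M N Ms) (w1 , w2 , w3) = WellBound-shift c₂ c₁ c M w1 , WellBound-shift c₂ c₁ c N w2 , WellBounds-shift c₂ c₁ c Ms w3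
  WellBound-shift c₂ c₁ c (lamBang N) w = WellBound-shift (1 ∷ c₂) c₁ c N w
  WellBound-shift c₂ c₁ c (lamPat p N) (w , l) = WellBound-shift (width p ∷ c₂) c₁ c N w , LinearBinder-shift (width p) (length c₂) (length c₁) N l

  WellBounds-shift : ∀ c₂ c₁ c Ns → WellBounds (c₂ ++ c) Ns → WellBounds (c₂ ++ c₁ ++ c) (shifts (length c₂) (length c₁) Ns)
  WellBounds-shift c₂ c₁ c [] w = tt
  WellBounds-shift c₂ c₁ c (N ∷ Ns) (w , ws) = WellBound-shift c₂ c₁ c N w , WellBounds-shift c₂ c₁ c Ns ws

indexedSum : (ℕ → Term → ℕ) → List Term → ℕ
indexedSum f [] = 0
indexedSum f (N ∷ Ns) = f 0 N + indexedSum (λ j → f (suc j)) Ns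

indexedSum-cong : ∀ {f g : ℕ → Term → ℕ} Ns → (∀ j N → f j N ≡ g j N) → indexedSum f Ns ≡ indexedSum g Ns
indexedSum-cong [] h = refl
indexedSum-cong (N ∷ Ns) h = cong₂ _+_ (h 0 N) (indexedSum-cong Ns (λ j → h (suc j)))

indexedSum-+ : ∀ f g Ns → indexedSum (λ j N → f j N + g j N) Ns ≡ indexedSum f Ns + indexedSum g Ns
indexedSum-+ f g [] = refl
indexedSum-+ f g (N ∷ Ns) = trans (cong (f 0 N + g 0 N +_) (indexedSum-+ (λ j → f (suc j)) (λ j → g (suc j)) Ns))
                       (interchange (f 0 N) (g 0 N) _ _)

indexedSum-zero : ∀ {f : ℕ → Term → ℕ} Ns → (∀ j N → f j N ≡ 0) → indexedSum f Ns ≡ 0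
indexedSum-zero [] h = refl
indexedSum-zero (N ∷ Ns) h = cong₂ _+_ (h 0 N) (indexedSum-zero Ns (λ j → h (suc j)))

indexedSum-δ : ∀ {f : ℕ → Term → ℕ} (g : Term → ℕ) Ns j (dflt : Term) → j < length Ns → (∀ j' N → f j' N ≡ δ j' j * g N) →
          indexedSum f Ns ≡ g (lookupT Ns j dflt)
indexedSum-δ {f} g (N ∷ Ns) zero dflt p h rewrite h 0 N | indexedSum-zero {λ j' → f (suc j')} Ns (λ j' N' → h (suc j') N') = trans (+-identityʳ _) (+-identityʳ _)
indexedSum-δ g (N ∷ Ns) (suc j) dflt (s≤s p) h rewrite h 0 N = indexedSum-δ g Ns j dflt p (λ j' → h (suc j'))

-- Occurrences of t created by substituting N for a variable with a m occurrences of each mode,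
-- t having x m occurrences in N: a copy of N at a banged site makes all of its occurrences banged.
substOcc : Mode → (Mode → ℕ) → (Mode → ℕ) → ℕ
substOcc linear a x = a linear * x linear
substOcc banged a x = a banged * x total + a linear * x banged
substOcc total a x = a total * x total

substOcc-cong : ∀ m {a a' x x'} → (∀ m' → a m' ≡ a' m') → (∀ m' → x m' ≡ x' m') → substOcc m a x ≡ substOcc m a' x'
substOcc-cong linear ha hx = cong₂ _*_ (ha linear) (hx linear)
substOcc-cong banged ha hx = cong₂ _+_ (cong₂ _*_ (ha banged) (hx total)) (cong₂ _*_ (ha linear) (hx banged))
substOcc-cong total ha hx = cong₂ _*_ (ha total) (hx total)

substOcc-zeroˡ : ∀ m a x → (∀ m' → a m' ≡ 0) → substOcc m a x ≡ 0
substOcc-zeroˡ linear a x h rewrite h linear = refl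
substOcc-zeroˡ banged a x h rewrite h banged | h linear = refl
substOcc-zeroˡ total a x h rewrite h total = refl

substOcc-+ : ∀ m a b x → substOcc m (λ m' → a m' + b m') x ≡ substOcc m a x + substOcc m b x
substOcc-+ linear a b x = *-distribʳ-+ (x linear) (a linear) (b linear)
substOcc-+ banged a b x = begin
  (a banged + b banged) * x total + (a linear + b linear) * x banged
    ≡⟨ cong₂ _+_ (*-distribʳ-+ (x total) (a banged) (b banged)) (*-distribʳ-+ (x banged) (a linear) (b linear)) ⟩
  (a banged * x total + b banged * x total) + (a linear * x banged + b linear * x banged)
    ≡⟨ interchange (a banged * x total) _ _ _ ⟩
  (a banged * x total + a linear * x banged) + (b banged * x total + b linear * x banged) ∎
  where open ≡-Reasoning
substOcc-+ total a b x = *-distribʳ-+ (x total) (a total) (b total)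

Confined : ℕ → ℕ → Term → Set
Confined d n A = ∀ j → n ≤ j → #all (bound d j) A ≡ 0

Confineds : ℕ → ℕ → List Term → Set
Confineds d n As = ∀ j → n ≤ j → #alls (bound d j) As ≡ 0

predictedOcc : Mode → Var → ℕ → List Term → (Mode → ℕ → ℕ) → ℕ → ℕ
predictedOcc m t d Ns a base = base + indexedSum (λ j N → substOcc m (λ m' → a m' j) (λ m' → occ m' t (shift 0 d N))) Ns

predictedOcc-+ : ∀ m t d Ns a b {X Y x y} → X ≡ predictedOcc m t d Ns a x → Y ≡ predictedOcc m t d Ns b y →
         X + Y ≡ predictedOcc m t d Ns (λ m' j → a m' j + b m' j) (x + y)
predictedOcc-+ m t d Ns a b {x = x} {y = y} e1 e2 rewrite e1 | e2 =
  trans (interchange x _ y _) (cong ((x + y) +_) (sym (trans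
    (indexedSum-cong Ns (λ j N → substOcc-+ m (λ m' → a m' j) (λ m' → b m' j) (λ m' → occ m' t (shift 0 d N))))
    (indexedSum-+ _ _ Ns))))

predictedOcc-zero : ∀ m t d Ns (a : Mode → ℕ → ℕ) base → (∀ m' j → a m' j ≡ 0) → predictedOcc m t d Ns a base ≡ base
predictedOcc-zero m t d Ns a base h = trans (cong (base +_) (indexedSum-zero Ns (λ j N → substOcc-zeroˡ m (λ m' → a m' j) _ (λ m' → h m' j)))) (+-identityʳ base)

liftVar-0 : ∀ t → liftVar 0 t ≡ ↑ t
liftVar-0 (free x) = refl
liftVar-0 (qbit x) = refl
liftVar-0 (bound e j) = refl

occ-liftVar-below : ∀ m d t i j → i < d → occ m (liftVar d t) (bvar i j) ≡ occ m t (bvar i j)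
occ-liftVar-below m d (free x) i j p = refl
occ-liftVar-below m d (qbit x) i j p = refl
occ-liftVar-below m d (bound e k) i j p with <ᵇ-view e d
... | inj₁ (_ , b) rewrite b = refl
... | inj₂ (q , b) rewrite b | δ-≢ {suc e} {i} (λ z → <⇒≢ (<-≤-trans p (≤-trans q (n≤1+n e))) (sym z))
                              | δ-≢ {e} {i} (λ z → <⇒≢ (<-≤-trans p q) (sym z)) = refl

occ-liftVar-at : ∀ m d t j → occ m (liftVar d t) (bvar d j) ≡ 0
occ-liftVar-at m d (free x) j = leafCount-zero m
occ-liftVar-at m d (qbit x) j = leafCount-zero m
occ-liftVar-at m d (bound e k) j with <ᵇ-view e d
... | inj₁ (q , b) rewrite b | δ-≢ (<⇒≢ q) = leafCount-zero m
... | inj₂ (q , b) rewrite b | δ-≢ {suc e} {d} (λ z → <⇒≢ (s≤s q) (sym z)) = leafCount-zero m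

occ-liftVar-above : ∀ m d t i j → d < i → occ m (liftVar d t) (bvar i j) ≡ occ m t (bvar (i ∸ 1) j)
occ-liftVar-above m d (free x) i j p = refl
occ-liftVar-above m d (qbit x) i j p = refl
occ-liftVar-above m d (bound e k) (suc i) j (s≤s p) with <ᵇ-view e d
... | inj₁ (q , b) rewrite b | δ-≢ {e} {suc i} (λ z → <⇒≢ (<-≤-trans q (≤-trans p (n≤1+n i))) z)
                             | δ-≢ {e} {i} (λ z → <⇒≢ (<-≤-trans q p) z) = refl
... | inj₂ (q , b) rewrite b = refl

Confined-bvar⇒< : ∀ {d n j} → Confined d n (bvar d j) → j < n
Confined-bvar⇒< {d} {n} {j} v with <ᵇ-view j n
... | inj₁ (j<n , _) = j<n
... | inj₂ (n≤j , _) with () ← trans (sym (cong₂ _*_ (δ-refl d) (δ-refl j))) (v j n≤j)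

occ-bound-bvar-≢ : ∀ m d i j' j → d ≢ i → occ m (bound d j') (bvar i j) ≡ 0
occ-bound-bvar-≢ m d i j' j d≢i rewrite δ-≢ d≢i = leafCount-zero m

substOcc-leafCount : ∀ m k x → substOcc m (λ m' → leafCount m' k) x ≡ k * x m
substOcc-leafCount linear k x = refl
substOcc-leafCount banged k x = refl
substOcc-leafCount total k x = refl

occ-substB-bvar : ∀ m t d Ns i j → Confined d (length Ns) (bvar i j) →
  occ m t (substB d Ns (bvar i j)) ≡ predictedOcc m t d Ns (λ m' j' → occ m' (bound d j') (bvar i j)) (occ m (liftVar d t) (bvar i j))
occ-substB-bvar m t d Ns i j v with <ᵇ-view i d
... | inj₁ (i<d , b) rewrite b =
  sym (trans (predictedOcc-zero m t d Ns _ _ (λ m' j' → occ-bound-bvar-≢ m' d i j' j (<⇒≢ i<d ∘ sym)))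
             (occ-liftVar-below m d t i j i<d))
... | inj₂ (d≤i , b) rewrite b with ≡ᵇ-view i d
... | inj₂ (i≢d , b') rewrite b' =
  sym (trans (predictedOcc-zero m t d Ns _ _ (λ m' j' → occ-bound-bvar-≢ m' d i j' j (i≢d ∘ sym)))
             (occ-liftVar-above m d t i j (≤∧≢⇒< d≤i (i≢d ∘ sym))))
... | inj₁ (refl , b') with Confined-bvar⇒< {d} v
... | j<n rewrite b' =
  sym (trans (cong₂ _+_ (occ-liftVar-at m d t j) refl)
             (indexedSum-δ (λ N → occ m t (shift 0 d N)) Ns j (bvar d j) j<n
               (λ j' N → trans (substOcc-leafCount m (1 * δ j' j) (λ m' → occ m' t (shift 0 d N)))
                               (cong (_* occ m t (shift 0 d N)) (*-identityˡ (δ j' j))))))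

occ-↑-shift-suc : ∀ m t d N → occ m (↑ t) (shift 0 (suc d) N) ≡ occ m t (shift 0 d N)
occ-↑-shift-suc m t d N = trans (cong (λ z → occ m z (shift 0 (suc d) N)) (sym (liftVar-0 t))) (occ-liftVar-shift m 0 d t N)

predictedOcc-↑ : ∀ m t d Ns A {X} → X ≡ predictedOcc m (↑ t) (suc d) Ns (λ m' j → occ m' (bound (suc d) j) A) (occ m (liftVar (suc d) (↑ t)) A) →
         X ≡ predictedOcc m t d Ns (λ m' j → occ m' (bound (suc d) j) A) (occ m (↑ (liftVar d t)) A)
predictedOcc-↑ m t d Ns A e = trans e (cong₂ _+_ (cong (λ z → occ m z A) (sym (↑-liftVar d t)))
  (indexedSum-cong Ns (λ j N → substOcc-cong m (λ m' → refl) (λ m' → occ-↑-shift-suc m' t d N))))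

bang-substOcc : ∀ a b xN xB xA → xN + xB ≡ xA → a * xN + (b * xA + a * xB) ≡ (a + b) * xA + 0 * xB
bang-substOcc a b xN xB xA e rewrite sym e = solve 4 (λ a b xN xB → a :* xN :+ (b :* (xN :+ xB) :+ a :* xB) := (a :+ b) :* (xN :+ xB) :+ con 0 :* xB) refl a b xN xB
  where open +-*-Solver

Confined-app₁ : ∀ {d n} A B → Confined d n (app A B) → Confined d n A
Confined-app₁ {d} A B v j p = m+n≡0⇒m≡0 (#all (bound d j) A) (v j p)
Confined-app₂ : ∀ {d n} A B → Confined d n (app A B) → Confined d n B
Confined-app₂ {d} A B v j p = m+n≡0⇒n≡0 (#all (bound d j) A) (v j p)
Confined-tup₁ : ∀ {d n} A B As → Confined d n (tup A B As) → Confined d n A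
Confined-tup₁ {d} A B As v j p = m+n≡0⇒m≡0 (#all (bound d j) A) (v j p)
Confined-tup₂ : ∀ {d n} A B As → Confined d n (tup A B As) → Confined d n B
Confined-tup₂ {d} A B As v j p = m+n≡0⇒m≡0 (#all (bound d j) B) (m+n≡0⇒n≡0 (#all (bound d j) A) (v j p))
Confined-tup₃ : ∀ {d n} A B As → Confined d n (tup A B As) → Confineds d n As
Confined-tup₃ {d} A B As v j p = m+n≡0⇒n≡0 (#all (bound d j) B) (m+n≡0⇒n≡0 (#all (bound d j) A) (v j p))
Confineds-head : ∀ {d n} A As → Confineds d n (A ∷ As) → Confined d n A
Confineds-head {d} A As v j p = m+n≡0⇒m≡0 (#all (bound d j) A) (v j p)
Confineds-tail : ∀ {d n} A As → Confineds d n (A ∷ As) → Confineds d n As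
Confineds-tail {d} A As v j p = m+n≡0⇒n≡0 (#all (bound d j) A) (v j p)

mutual
  occ-substB : ∀ m t d Ns A → Confined d (length Ns) A →
    occ m t (substB d Ns A) ≡ predictedOcc m t d Ns (λ m' j → occ m' (bound d j) A) (occ m (liftVar d t) A)
  occ-substB m t d Ns (fvar x) v = sym (trans (predictedOcc-zero m t d Ns _ _ (λ m' j → leafCount-zero m')) (cong (leafCount m) (hitFree-liftVar d t x)))
  occ-substB m t d Ns (bvar i j) v = occ-substB-bvar m t d Ns i j v
  occ-substB m t d Ns (qvar x) v = sym (trans (predictedOcc-zero m t d Ns _ _ (λ m' j → leafCount-zero m')) (cong (leafCount m) (hitQbit-liftVar d t x)))
  occ-substB linear t d Ns (bang A) v = sym (indexedSum-zero Ns (λ j N → refl))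
  occ-substB total t d Ns (bang A) v = occ-substB total t d Ns A v
  occ-substB banged t d Ns (bang A) v rewrite occ-substB linear t d Ns A v | occ-substB banged t d Ns A v =
    trans (interchange (occ linear (liftVar d t) A) _ (occ banged (liftVar d t) A) _)
      (cong ((occ linear (liftVar d t) A + occ banged (liftVar d t) A) +_)
        (trans (sym (indexedSum-+ _ _ Ns)) (indexedSum-cong Ns (λ j N →
          bang-substOcc (occ linear (bound d j) A) (occ banged (bound d j) A)
                        (occ linear t (shift 0 d N)) (occ banged t (shift 0 d N)) (occ total t (shift 0 d N))
                        (#lin+#bang≡#all t (shift 0 d N))))))
  occ-substB m t d Ns czero v = sym (predictedOcc-zero m t d Ns _ _ (λ m' j → refl))
  occ-substB m t d Ns cone v = sym (predictedOcc-zero m t d Ns _ _ (λ m' j → refl))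
  occ-substB m t d Ns (cU x) v = sym (predictedOcc-zero m t d Ns _ _ (λ m' j → refl))
  occ-substB m t d Ns (new A) v = occ-substB m t d Ns A v
  occ-substB m t d Ns (app A B) v =
    predictedOcc-+ m t d Ns (λ m' j → occ m' (bound d j) A) (λ m' j → occ m' (bound d j) B)
      (occ-substB m t d Ns A (Confined-app₁ A B v)) (occ-substB m t d Ns B (Confined-app₂ A B v))
  occ-substB m t d Ns (tup A B As) v =
    predictedOcc-+ m t d Ns (λ m' j → occ m' (bound d j) A) (λ m' j → occ m' (bound d j) B + occs m' (bound d j) As)
      (occ-substB m t d Ns A (Confined-tup₁ A B As v))
      (predictedOcc-+ m t d Ns (λ m' j → occ m' (bound d j) B) (λ m' j → occs m' (bound d j) As)
        (occ-substB m t d Ns B (Confined-tup₂ A B As v)) (occs-substBs m t d Ns As (Confined-tup₃ A B As v)))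
  occ-substB m t d Ns (lamBang A) v = predictedOcc-↑ m t d Ns A (occ-substB m (↑ t) (suc d) Ns A v)
  occ-substB m t d Ns (lamPat p A) v = predictedOcc-↑ m t d Ns A (occ-substB m (↑ t) (suc d) Ns A v)

  occs-substBs : ∀ m t d Ns As → Confineds d (length Ns) As →
    occs m t (substBs d Ns As) ≡ predictedOcc m t d Ns (λ m' j → occs m' (bound d j) As) (occs m (liftVar d t) As)
  occs-substBs m t d Ns [] v = sym (predictedOcc-zero m t d Ns _ _ (λ m' j → refl))
  occs-substBs m t d Ns (A ∷ As) v =
    predictedOcc-+ m t d Ns (λ m' j → occ m' (bound d j) A) (λ m' j → occs m' (bound d j) As)
      (occ-substB m t d Ns A (Confineds-head A As v)) (occs-substBs m t d Ns As (Confineds-tail A As v))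

InScope⇒< : ∀ c₁ a c j → InScope (c₁ ++ a ∷ c) (length c₁) j → j < a
InScope⇒< [] a c j p = p
InScope⇒< (x ∷ c₁) a c j p = InScope⇒< c₁ a c j p

<⇒InScope : ∀ c₁ a c j → j < a → InScope (c₁ ++ a ∷ c) (length c₁) j
<⇒InScope [] a c j p = p
<⇒InScope (x ∷ c₁) a c j p = <⇒InScope c₁ a c j p

InScope-drop : ∀ c₁ a c i j → length c₁ < i → InScope (c₁ ++ a ∷ c) i j → InScope (c₁ ++ c) (i ∸ 1) j
InScope-drop [] a c (suc i) j p q = q
InScope-drop (x ∷ c₁) a c (suc (suc i)) j (s≤s p) q = InScope-drop c₁ a c (suc i) j p q

InScope-++ : ∀ c X i j → InScope c i j → InScope (c ++ X) i j
InScope-++ (a ∷ c) X zero j p = p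
InScope-++ (a ∷ c) X (suc i) j p = InScope-++ c X i j p

InScope⇒depth< : ∀ c i j → InScope c i j → i < length c
InScope⇒depth< (a ∷ c) zero j p = s≤s z≤n
InScope⇒depth< (a ∷ c) (suc i) j p = s≤s (InScope⇒depth< c i j p)

mutual
  WellBound⇒Confined : ∀ c₁ a c A → WellBound (c₁ ++ a ∷ c) A → Confined (length c₁) a A
  WellBound⇒Confined c₁ a c (fvar x) w j p = refl
  WellBound⇒Confined c₁ a c (bvar i k) w j p with ≡ᵇ-view (length c₁) i
  ... | inj₂ (ne , b) rewrite b = refl
  ... | inj₁ (refl , b) rewrite b | δ-≢ {j} {k} (λ z → <⇒≢ (<-≤-trans (InScope⇒< c₁ a c k w) p) (sym z)) = refl
  WellBound⇒Confined c₁ a c (qvar x) w j p = refl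
  WellBound⇒Confined c₁ a c (bang A) w j p = WellBound⇒Confined c₁ a c A w j p
  WellBound⇒Confined c₁ a c czero w j p = refl
  WellBound⇒Confined c₁ a c cone w j p = refl
  WellBound⇒Confined c₁ a c (cU x) w j p = refl
  WellBound⇒Confined c₁ a c (new A) w j p = WellBound⇒Confined c₁ a c A w j p
  WellBound⇒Confined c₁ a c (app A B) (w1 , w2) j p = cong₂ _+_ (WellBound⇒Confined c₁ a c A w1 j p) (WellBound⇒Confined c₁ a c B w2 j p)
  WellBound⇒Confined c₁ a c (tup A B As) (w1 , w2 , w3) j p =
    cong₂ _+_ (WellBound⇒Confined c₁ a c A w1 j p) (cong₂ _+_ (WellBound⇒Confined c₁ a c B w2 j p) (WellBounds⇒Confineds c₁ a c As w3 j p))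
  WellBound⇒Confined c₁ a c (lamBang A) w j p = WellBound⇒Confined (1 ∷ c₁) a c A w j p
  WellBound⇒Confined c₁ a c (lamPat q A) (w , _) j p = WellBound⇒Confined (width q ∷ c₁) a c A w j p

  WellBounds⇒Confineds : ∀ c₁ a c As → WellBounds (c₁ ++ a ∷ c) As → Confineds (length c₁) a As
  WellBounds⇒Confineds c₁ a c [] w j p = refl
  WellBounds⇒Confineds c₁ a c (A ∷ As) (w , ws) j p = cong₂ _+_ (WellBound⇒Confined c₁ a c A w j p) (WellBounds⇒Confineds c₁ a c As ws j p)

substOcc-zeroʳ : ∀ m a x → (∀ m' → x m' ≡ 0) → substOcc m a x ≡ 0
substOcc-zeroʳ linear a x h rewrite h linear = *-zeroʳ (a linear)
substOcc-zeroʳ banged a x h rewrite h banged | h total = cong₂ _+_ (*-zeroʳ (a banged)) (*-zeroʳ (a linear))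
substOcc-zeroʳ total a x h rewrite h total = *-zeroʳ (a total)

occ-bound0-substB : ∀ m d Ns A j → Confined (suc d) (length Ns) A → occ m (bound 0 j) (substB (suc d) Ns A) ≡ occ m (bound 0 j) A
occ-bound0-substB m d Ns A j v = trans (occ-substB m (bound 0 j) (suc d) Ns A v)
  (trans (cong (occ m (bound 0 j) A +_) (indexedSum-zero Ns (λ j' N → substOcc-zeroʳ m _ _ (λ m' → occ-shift-gap m' 0 (suc d) 0 j N z≤n (s≤s z≤n)))))
         (+-identityʳ _))

All-lookupT : ∀ {P : Term → Set} Ns j (dflt : Term) → All P Ns → j < length Ns → P (lookupT Ns j dflt)
All-lookupT (N ∷ Ns) zero dflt (p ∷ ps) q = p
All-lookupT (N ∷ Ns) (suc j) dflt (p ∷ ps) (s≤s q) = All-lookupT Ns j dflt ps q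

mutual
  WellBound-substB : ∀ c₁ c Ns A → WellBound (c₁ ++ length Ns ∷ c) A → All (WellBound c) Ns → WellBound (c₁ ++ c) (substB (length c₁) Ns A)
  WellBound-substB c₁ c Ns (fvar x) w h = tt
  WellBound-substB c₁ c Ns (bvar i j) w h with <ᵇ-view i (length c₁)
  ... | inj₁ (p , b) rewrite b = InScope-inner c₁ (length Ns ∷ c) c i j p w
  ... | inj₂ (p , b) rewrite b with ≡ᵇ-view i (length c₁)
  ... | inj₁ (refl , b2) rewrite b2 = WellBound-shift [] c₁ c (lookupT Ns j (bvar i j)) (All-lookupT Ns j (bvar i j) h (InScope⇒< c₁ (length Ns) c j w))
  ... | inj₂ (ne , b2) rewrite b2 = InScope-drop c₁ (length Ns) c i j (≤∧≢⇒< p (λ z → ne (sym z))) w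
  WellBound-substB c₁ c Ns (qvar x) w h = tt
  WellBound-substB c₁ c Ns (bang A) w h = WellBound-substB c₁ c Ns A w h
  WellBound-substB c₁ c Ns czero w h = tt
  WellBound-substB c₁ c Ns cone w h = tt
  WellBound-substB c₁ c Ns (cU x) w h = tt
  WellBound-substB c₁ c Ns (new A) w h = WellBound-substB c₁ c Ns A w h
  WellBound-substB c₁ c Ns (app A B) (w1 , w2) h = WellBound-substB c₁ c Ns A w1 h , WellBound-substB c₁ c Ns B w2 h
  WellBound-substB c₁ c Ns (tup A B As) (w1 , w2 , w3) h = WellBound-substB c₁ c Ns A w1 h , WellBound-substB c₁ c Ns B w2 h , WellBounds-substBs c₁ c Ns As w3 h
  WellBound-substB c₁ c Ns (lamBang A) w h = WellBound-substB (1 ∷ c₁) c Ns A w h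
  WellBound-substB c₁ c Ns (lamPat p A) (w , l) h = WellBound-substB (width p ∷ c₁) c Ns A w h ,
    (λ j q → trans (occ-bound0-substB linear (length c₁) Ns A j (WellBound⇒Confined (width p ∷ c₁) (length Ns) c A w)) (proj₁ (l j q)) ,
             trans (occ-bound0-substB banged (length c₁) Ns A j (WellBound⇒Confined (width p ∷ c₁) (length Ns) c A w)) (proj₂ (l j q)))

  WellBounds-substBs : ∀ c₁ c Ns As → WellBounds (c₁ ++ length Ns ∷ c) As → All (WellBound c) Ns → WellBounds (c₁ ++ c) (substBs (length c₁) Ns As)
  WellBounds-substBs c₁ c Ns [] w h = tt
  WellBounds-substBs c₁ c Ns (A ∷ As) (w , ws) h = WellBound-substB c₁ c Ns A w h , WellBounds-substBs c₁ c Ns As ws h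

lookupT-default : ∀ (Ns : List Term) j (dflt : Term) → length Ns ≤ j → lookupT Ns j dflt ≡ dflt
lookupT-default [] j dflt p = refl
lookupT-default (N ∷ Ns) (suc j) dflt (s≤s p) = lookupT-default Ns j dflt p

<∧pred<⇒⊥ : ∀ d i → d < i → i ∸ 1 < d → ⊥
<∧pred<⇒⊥ d (suc i) (s≤s p) q = <-irrefl refl (<-≤-trans q p)

mutual
  WellBound-open⁻ : ∀ c₁ xs A → WellBound c₁ (substB (length c₁) (map fvar xs) A) → WellBound (c₁ ++ length xs ∷ []) A
  WellBound-open⁻ c₁ xs (fvar x) w = tt
  WellBound-open⁻ c₁ xs (bvar i j) w with <ᵇ-view i (length c₁)
  ... | inj₁ (p , b) rewrite b = InScope-++ c₁ _ i j w
  ... | inj₂ (p , b) rewrite b with ≡ᵇ-view i (length c₁)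
  ... | inj₂ (ne , b2) rewrite b2 = ⊥-elim (<∧pred<⇒⊥ (length c₁) i (≤∧≢⇒< p (λ z → ne (sym z))) (InScope⇒depth< c₁ (i ∸ 1) j w))
  ... | inj₁ (refl , b2) rewrite b2 with <ᵇ-view j (length xs)
  ... | inj₁ (q , _) = <⇒InScope c₁ (length xs) [] j q
  ... | inj₂ (q , _) rewrite lookupT-default (map fvar xs) j (bvar i j) (subst (_≤ j) (sym (LP.length-map fvar xs)) q) =
        ⊥-elim (<-irrefl refl (≤-trans (InScope⇒depth< c₁ (i + i) j w) (m≤n+m i i)))
  WellBound-open⁻ c₁ xs (qvar x) w = tt
  WellBound-open⁻ c₁ xs (bang A) w = WellBound-open⁻ c₁ xs A w
  WellBound-open⁻ c₁ xs czero w = tt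
  WellBound-open⁻ c₁ xs cone w = tt
  WellBound-open⁻ c₁ xs (cU x) w = tt
  WellBound-open⁻ c₁ xs (new A) w = WellBound-open⁻ c₁ xs A w
  WellBound-open⁻ c₁ xs (app A B) (w1 , w2) = WellBound-open⁻ c₁ xs A w1 , WellBound-open⁻ c₁ xs B w2
  WellBound-open⁻ c₁ xs (tup A B As) (w1 , w2 , w3) = WellBound-open⁻ c₁ xs A w1 , WellBound-open⁻ c₁ xs B w2 , WellBounds-open⁻ c₁ xs As w3
  WellBound-open⁻ c₁ xs (lamBang A) w = WellBound-open⁻ (1 ∷ c₁) xs A w
  WellBound-open⁻ c₁ xs (lamPat p A) (w , l) = ih ,
    (λ j q → trans (sym (occ-bound0-substB linear (length c₁) (map fvar xs) A j v)) (proj₁ (l j q)) ,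
             trans (sym (occ-bound0-substB banged (length c₁) (map fvar xs) A j v)) (proj₂ (l j q)))
    where
    ih : WellBound (width p ∷ c₁ ++ length xs ∷ []) A
    ih = WellBound-open⁻ (width p ∷ c₁) xs A w
    v : Confined (suc (length c₁)) (length (map fvar xs)) A
    v rewrite LP.length-map fvar xs = WellBound⇒Confined (width p ∷ c₁) (length xs) [] A ih

  WellBounds-open⁻ : ∀ c₁ xs As → WellBounds c₁ (substBs (length c₁) (map fvar xs) As) → WellBounds (c₁ ++ length xs ∷ []) As
  WellBounds-open⁻ c₁ xs [] w = tt
  WellBounds-open⁻ c₁ xs (A ∷ As) (w , ws) = WellBound-open⁻ c₁ xs A w , WellBounds-open⁻ c₁ xs As ws

-- Terms equal up to free classical variables

mutual
  data SameShape : Term → Term → Set where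
    ~fvar : ∀ x y → SameShape (fvar x) (fvar y)
    ~bvar : ∀ i j → SameShape (bvar i j) (bvar i j)
    ~qvar : ∀ r → SameShape (qvar r) (qvar r)
    ~bang : ∀ {M N} → SameShape M N → SameShape (bang M) (bang N)
    ~czero : SameShape czero czero
    ~cone : SameShape cone cone
    ~cU : ∀ i → SameShape (cU i) (cU i)
    ~new : ∀ {M N} → SameShape M N → SameShape (new M) (new N)
    ~app : ∀ {M N M' N'} → SameShape M M' → SameShape N N' → SameShape (app M N) (app M' N')
    ~tup : ∀ {M N Ms M' N' Ms'} → SameShape M M' → SameShape N N' → SameShapes Ms Ms' → SameShape (tup M N Ms) (tup M' N' Ms')
    ~lamBang : ∀ {M N} → SameShape M N → SameShape (lamBang M) (lamBang N)
    ~lamPat : ∀ {M N} p → SameShape M N → SameShape (lamPat p M) (lamPat p N)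

  data SameShapes : List Term → List Term → Set where
    [] : SameShapes [] []
    _∷_ : ∀ {M N Ms Ns} → SameShape M N → SameShapes Ms Ns → SameShapes (M ∷ Ms) (N ∷ Ns)

NotFree : Var → Set
NotFree (free _) = ⊥
NotFree (qbit _) = ⊤
NotFree (bound _ _) = ⊤

NotFree-↑ : ∀ t → NotFree t → NotFree (↑ t)
NotFree-↑ (qbit x) n = tt
NotFree-↑ (bound x x₁) n = tt

hitFree-NotFree : ∀ t x y → NotFree t → hitFree t x ≡ hitFree t y
hitFree-NotFree (qbit _) x y n = refl
hitFree-NotFree (bound _ _) x y n = refl

mutual
  SameShape-occ : ∀ {M N} → SameShape M N → ∀ m t → NotFree t → occ m t M ≡ occ m t N
  SameShape-occ (~fvar x y) m t n = cong (leafCount m) (hitFree-NotFree t x y n)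
  SameShape-occ (~bvar i j) m t n = refl
  SameShape-occ (~qvar r) m t n = refl
  SameShape-occ (~bang s) linear t n = refl
  SameShape-occ (~bang s) banged t n = cong₂ _+_ (SameShape-occ s linear t n) (SameShape-occ s banged t n)
  SameShape-occ (~bang s) total t n = SameShape-occ s total t n
  SameShape-occ ~czero m t n = refl
  SameShape-occ ~cone m t n = refl
  SameShape-occ (~cU i) m t n = refl
  SameShape-occ (~new s) m t n = SameShape-occ s m t n
  SameShape-occ (~app s s') m t n = cong₂ _+_ (SameShape-occ s m t n) (SameShape-occ s' m t n)
  SameShape-occ (~tup s s' ss) m t n = cong₂ _+_ (SameShape-occ s m t n) (cong₂ _+_ (SameShape-occ s' m t n) (SameShapes-occs ss m t n))
  SameShape-occ (~lamBang s) m t n = SameShape-occ s m (↑ t) (NotFree-↑ t n)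
  SameShape-occ (~lamPat p s) m t n = SameShape-occ s m (↑ t) (NotFree-↑ t n)

  SameShapes-occs : ∀ {Ms Ns} → SameShapes Ms Ns → ∀ m t → NotFree t → occs m t Ms ≡ occs m t Ns
  SameShapes-occs [] m t n = refl
  SameShapes-occs (s ∷ ss) m t n = cong₂ _+_ (SameShape-occ s m t n) (SameShapes-occs ss m t n)

mutual
  SameShape-WellBound : ∀ {M N} → SameShape M N → ∀ c → WellBound c M → WellBound c N
  SameShape-WellBound (~fvar x y) c w = tt
  SameShape-WellBound (~bvar i j) c w = w
  SameShape-WellBound (~qvar r) c w = tt
  SameShape-WellBound (~bang s) c w = SameShape-WellBound s c w
  SameShape-WellBound ~czero c w = tt
  SameShape-WellBound ~cone c w = tt
  SameShape-WellBound (~cU i) c w = tt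
  SameShape-WellBound (~new s) c w = SameShape-WellBound s c w
  SameShape-WellBound (~app s s') c (w , w') = SameShape-WellBound s c w , SameShape-WellBound s' c w'
  SameShape-WellBound (~tup s s' ss) c (w , w' , ws) = SameShape-WellBound s c w , SameShape-WellBound s' c w' , SameShapes-WellBounds ss c ws
  SameShape-WellBound (~lamBang s) c w = SameShape-WellBound s (1 ∷ c) w
  SameShape-WellBound (~lamPat p s) c (w , l) = SameShape-WellBound s (width p ∷ c) w ,
    (λ j q → trans (sym (SameShape-occ s linear (bound 0 j) tt)) (proj₁ (l j q)) , trans (sym (SameShape-occ s banged (bound 0 j) tt)) (proj₂ (l j q)))

  SameShapes-WellBounds : ∀ {Ms Ns} → SameShapes Ms Ns → ∀ c → WellBounds c Ms → WellBounds c Ns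
  SameShapes-WellBounds [] c w = tt
  SameShapes-WellBounds (s ∷ ss) c (w , ws) = SameShape-WellBound s c w , SameShapes-WellBounds ss c ws

mutual
  SameShape-qvs : ∀ {M N} → SameShape M N → qvs M ≡ qvs N
  SameShape-qvs (~fvar x y) = refl
  SameShape-qvs (~bvar i j) = refl
  SameShape-qvs (~qvar r) = refl
  SameShape-qvs (~bang s) = SameShape-qvs s
  SameShape-qvs ~czero = refl
  SameShape-qvs ~cone = refl
  SameShape-qvs (~cU i) = refl
  SameShape-qvs (~new s) = SameShape-qvs s
  SameShape-qvs (~app s s') = cong₂ _++_ (SameShape-qvs s) (SameShape-qvs s')
  SameShape-qvs (~tup s s' ss) = cong₂ _++_ (SameShape-qvs s) (cong₂ _++_ (SameShape-qvs s') (SameShapes-qvss ss))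
  SameShape-qvs (~lamBang s) = SameShape-qvs s
  SameShape-qvs (~lamPat p s) = SameShape-qvs s

  SameShapes-qvss : ∀ {Ms Ns} → SameShapes Ms Ns → qvss Ms ≡ qvss Ns
  SameShapes-qvss [] = refl
  SameShapes-qvss (s ∷ ss) = cong₂ _++_ (SameShape-qvs s) (SameShapes-qvss ss)

mutual
  SameShape-size : ∀ {M N} → SameShape M N → size M ≡ size N
  SameShape-size (~fvar x y) = refl
  SameShape-size (~bvar i j) = refl
  SameShape-size (~qvar r) = refl
  SameShape-size (~bang s) = cong suc (SameShape-size s)
  SameShape-size ~czero = refl
  SameShape-size ~cone = refl
  SameShape-size (~cU i) = refl
  SameShape-size (~new s) = cong suc (SameShape-size s)
  SameShape-size (~app s s') = cong suc (cong₂ _+_ (SameShape-size s) (SameShape-size s'))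
  SameShape-size (~tup s s' ss) = cong suc (cong₂ _+_ (SameShape-size s) (cong₂ _+_ (SameShape-size s') (SameShapes-sizes ss)))
  SameShape-size (~lamBang s) = cong suc (SameShape-size s)
  SameShape-size (~lamPat p s) = cong suc (SameShape-size s)

  SameShapes-sizes : ∀ {Ms Ns} → SameShapes Ms Ns → sizes Ms ≡ sizes Ns
  SameShapes-sizes [] = refl
  SameShapes-sizes (s ∷ ss) = cong₂ _+_ (SameShape-size s) (SameShapes-sizes ss)

mutual
  SameShape-refl : ∀ M → SameShape M M
  SameShape-refl (fvar x) = ~fvar x x
  SameShape-refl (bvar i j) = ~bvar i j
  SameShape-refl (qvar r) = ~qvar r
  SameShape-refl (bang M) = ~bang (SameShape-refl M)
  SameShape-refl czero = ~czero
  SameShape-refl cone = ~cone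
  SameShape-refl (cU i) = ~cU i
  SameShape-refl (new M) = ~new (SameShape-refl M)
  SameShape-refl (app M N) = ~app (SameShape-refl M) (SameShape-refl N)
  SameShape-refl (tup M N Ms) = ~tup (SameShape-refl M) (SameShape-refl N) (SameShapes-refl Ms)
  SameShape-refl (lamBang M) = ~lamBang (SameShape-refl M)
  SameShape-refl (lamPat p M) = ~lamPat p (SameShape-refl M)

  SameShapes-refl : ∀ Ms → SameShapes Ms Ms
  SameShapes-refl [] = []
  SameShapes-refl (M ∷ Ms) = SameShape-refl M ∷ SameShapes-refl Ms

mutual
  renameF-SameShape : ∀ (ρ : ℕ → ℕ) M → SameShape M (renameF ρ M)
  renameF-SameShape ρ (fvar x) = ~fvar x (ρ x)
  renameF-SameShape ρ (bvar i j) = ~bvar i j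
  renameF-SameShape ρ (qvar r) = ~qvar r
  renameF-SameShape ρ (bang M) = ~bang (renameF-SameShape ρ M)
  renameF-SameShape ρ czero = ~czero
  renameF-SameShape ρ cone = ~cone
  renameF-SameShape ρ (cU i) = ~cU i
  renameF-SameShape ρ (new M) = ~new (renameF-SameShape ρ M)
  renameF-SameShape ρ (app M N) = ~app (renameF-SameShape ρ M) (renameF-SameShape ρ N)
  renameF-SameShape ρ (tup M N Ms) = ~tup (renameF-SameShape ρ M) (renameF-SameShape ρ N) (renameFs-SameShapes ρ Ms)
  renameF-SameShape ρ (lamBang M) = ~lamBang (renameF-SameShape ρ M)
  renameF-SameShape ρ (lamPat p M) = ~lamPat p (renameF-SameShape ρ M)

  renameFs-SameShapes : ∀ (ρ : ℕ → ℕ) Ms → SameShapes Ms (renameFs ρ Ms)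
  renameFs-SameShapes ρ [] = []
  renameFs-SameShapes ρ (M ∷ Ms) = renameF-SameShape ρ M ∷ renameFs-SameShapes ρ Ms

δ-rename : ∀ (ρ : ℕ → ℕ) w x → (∀ u → ρ u ≡ w → u ≡ w) → ρ w ≡ w → δ w (ρ x) ≡ δ w x
δ-rename ρ w x h1 h2 with ≡ᵇ-view w x
... | inj₁ (refl , _) rewrite h2 = refl
... | inj₂ (ne , _) rewrite δ-≢ ne = δ-≢ (λ e → ne (sym (h1 x (sym e))))

mutual
  occ-renameF : ∀ (ρ : ℕ → ℕ) w → (∀ u → ρ u ≡ w → u ≡ w) → ρ w ≡ w → ∀ m M → occ m (free w) (renameF ρ M) ≡ occ m (free w) M
  occ-renameF ρ w h1 h2 m (fvar x) = cong (leafCount m) (δ-rename ρ w x h1 h2)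
  occ-renameF ρ w h1 h2 m (bvar i j) = refl
  occ-renameF ρ w h1 h2 m (qvar r) = refl
  occ-renameF ρ w h1 h2 linear (bang M) = refl
  occ-renameF ρ w h1 h2 banged (bang M) = cong₂ _+_ (occ-renameF ρ w h1 h2 linear M) (occ-renameF ρ w h1 h2 banged M)
  occ-renameF ρ w h1 h2 total (bang M) = occ-renameF ρ w h1 h2 total M
  occ-renameF ρ w h1 h2 m czero = refl
  occ-renameF ρ w h1 h2 m cone = refl
  occ-renameF ρ w h1 h2 m (cU i) = refl
  occ-renameF ρ w h1 h2 m (new M) = occ-renameF ρ w h1 h2 m M
  occ-renameF ρ w h1 h2 m (app M N) = cong₂ _+_ (occ-renameF ρ w h1 h2 m M) (occ-renameF ρ w h1 h2 m N)
  occ-renameF ρ w h1 h2 m (tup M N Ms) = cong₂ _+_ (occ-renameF ρ w h1 h2 m M) (cong₂ _+_ (occ-renameF ρ w h1 h2 m N) (occs-renameFs ρ w h1 h2 m Ms))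
  occ-renameF ρ w h1 h2 m (lamBang M) = occ-renameF ρ w h1 h2 m M
  occ-renameF ρ w h1 h2 m (lamPat p M) = occ-renameF ρ w h1 h2 m M

  occs-renameFs : ∀ (ρ : ℕ → ℕ) w → (∀ u → ρ u ≡ w → u ≡ w) → ρ w ≡ w → ∀ m Ms → occs m (free w) (renameFs ρ Ms) ≡ occs m (free w) Ms
  occs-renameFs ρ w h1 h2 m [] = refl
  occs-renameFs ρ w h1 h2 m (M ∷ Ms) = cong₂ _+_ (occ-renameF ρ w h1 h2 m M) (occs-renameFs ρ w h1 h2 m Ms)

mutual
  fv-renameF : ∀ (ρ : ℕ → ℕ) M {v} → v ∈ fv (renameF ρ M) → ∃ λ u → u ∈ fv M × ρ u ≡ v
  fv-renameF ρ (fvar x) (here refl) = x , here refl , refl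
  fv-renameF ρ (bang M) p = fv-renameF ρ M p
  fv-renameF ρ (new M) p = fv-renameF ρ M p
  fv-renameF ρ (app M N) p with MP.∈-++⁻ (fv (renameF ρ M)) p
  ... | inj₁ q with fv-renameF ρ M q
  ... | u , a , b = u , MP.∈-++⁺ˡ a , b
  fv-renameF ρ (app M N) p | inj₂ q with fv-renameF ρ N q
  ... | u , a , b = u , MP.∈-++⁺ʳ (fv M) a , b
  fv-renameF ρ (tup M N Ms) p with MP.∈-++⁻ (fv (renameF ρ M)) p
  ... | inj₁ q with fv-renameF ρ M q
  ... | u , a , b = u , MP.∈-++⁺ˡ a , b
  fv-renameF ρ (tup M N Ms) p | inj₂ q with MP.∈-++⁻ (fv (renameF ρ N)) q
  ... | inj₁ r with fv-renameF ρ N r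
  ... | u , a , b = u , MP.∈-++⁺ʳ (fv M) (MP.∈-++⁺ˡ a) , b
  fv-renameF ρ (tup M N Ms) p | inj₂ q | inj₂ r with fvs-renameFs ρ Ms r
  ... | u , a , b = u , MP.∈-++⁺ʳ (fv M) (MP.∈-++⁺ʳ (fv N) a) , b
  fv-renameF ρ (lamBang M) p = fv-renameF ρ M p
  fv-renameF ρ (lamPat _ M) p = fv-renameF ρ M p

  fvs-renameFs : ∀ (ρ : ℕ → ℕ) Ms {v} → v ∈ fvs (renameFs ρ Ms) → ∃ λ u → u ∈ fvs Ms × ρ u ≡ v
  fvs-renameFs ρ (M ∷ Ms) p with MP.∈-++⁻ (fv (renameF ρ M)) p
  ... | inj₁ q with fv-renameF ρ M q
  ... | u , a , b = u , MP.∈-++⁺ˡ a , b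
  fvs-renameFs ρ (M ∷ Ms) p | inj₂ q with fvs-renameFs ρ Ms q
  ... | u , a , b = u , MP.∈-++⁺ʳ (fv M) a , b

mutual
  renameF-id : ∀ (ρ : ℕ → ℕ) M → (∀ v → v ∈ fv M → ρ v ≡ v) → renameF ρ M ≡ M
  renameF-id ρ (fvar x) h = cong fvar (h x (here refl))
  renameF-id ρ (bvar i j) h = refl
  renameF-id ρ (qvar r) h = refl
  renameF-id ρ (bang M) h = cong bang (renameF-id ρ M h)
  renameF-id ρ czero h = refl
  renameF-id ρ cone h = refl
  renameF-id ρ (cU i) h = refl
  renameF-id ρ (new M) h = cong new (renameF-id ρ M h)
  renameF-id ρ (app M N) h = cong₂ app (renameF-id ρ M (λ v p → h v (MP.∈-++⁺ˡ p))) (renameF-id ρ N (λ v p → h v (MP.∈-++⁺ʳ (fv M) p)))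
  renameF-id ρ (tup M N Ms) h rewrite renameF-id ρ M (λ v p → h v (MP.∈-++⁺ˡ p))
                               | renameF-id ρ N (λ v p → h v (MP.∈-++⁺ʳ (fv M) (MP.∈-++⁺ˡ p)))
                               | renameFs-id ρ Ms (λ v p → h v (MP.∈-++⁺ʳ (fv M) (MP.∈-++⁺ʳ (fv N) p))) = refl
  renameF-id ρ (lamBang M) h = cong lamBang (renameF-id ρ M h)
  renameF-id ρ (lamPat p M) h = cong (lamPat p) (renameF-id ρ M h)

  renameFs-id : ∀ (ρ : ℕ → ℕ) Ms → (∀ v → v ∈ fvs Ms → ρ v ≡ v) → renameFs ρ Ms ≡ Ms
  renameFs-id ρ [] h = refl
  renameFs-id ρ (M ∷ Ms) h = cong₂ _∷_ (renameF-id ρ M (λ v p → h v (MP.∈-++⁺ˡ p))) (renameFs-id ρ Ms (λ v p → h v (MP.∈-++⁺ʳ (fv M) p)))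

contrRen-merged : ∀ x y z v → (v ≡ x ⊎ v ≡ y) → contrRen x y z v ≡ z
contrRen-merged x y z v (inj₁ refl) rewrite ≡ᵇ-refl v = refl
contrRen-merged x y z v (inj₂ refl) with v ≡ᵇ x
... | true = refl
... | false rewrite ≡ᵇ-refl v = refl

contrRen-other : ∀ x y z v → v ≢ x → v ≢ y → contrRen x y z v ≡ v
contrRen-other x y z v n1 n2 with ≡ᵇ-view v x | ≡ᵇ-view v y
... | inj₁ (e , _) | _ = ⊥-elim (n1 e)
... | inj₂ _ | inj₁ (e , _) = ⊥-elim (n2 e)
... | inj₂ (_ , b1) | inj₂ (_ , b2) rewrite b1 | b2 = refl

-- Environments and the characterisation

cvars : Env → List ℕ
cvars Γ = concat (map cnames Γ)

qvars : Env → List ℕ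
qvars Γ = concat (map qnames Γ)

cvars-++ : ∀ Γ Δ → cvars (Γ ++ Δ) ≡ cvars Γ ++ cvars Δ
cvars-++ [] Δ = refl
cvars-++ (it ∷ Γ) Δ rewrite cvars-++ Γ Δ = sym (++-assoc (cnames it) (cvars Γ) (cvars Δ))

qvars-++ : ∀ Γ Δ → qvars (Γ ++ Δ) ≡ qvars Γ ++ qvars Δ
qvars-++ [] Δ = refl
qvars-++ (it ∷ Γ) Δ rewrite qvars-++ Γ Δ = sym (++-assoc (qnames it) (qvars Γ) (qvars Δ))

∈cvars-++ˡ : ∀ Γ Δ {x} → x ∈ cvars Γ → x ∈ cvars (Γ ++ Δ)
∈cvars-++ˡ Γ Δ p rewrite cvars-++ Γ Δ = MP.∈-++⁺ˡ p
∈cvars-++ʳ : ∀ Γ Δ {x} → x ∈ cvars Δ → x ∈ cvars (Γ ++ Δ)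
∈cvars-++ʳ Γ Δ p rewrite cvars-++ Γ Δ = MP.∈-++⁺ʳ (cvars Γ) p
∈qvars-++ˡ : ∀ Γ Δ {x} → x ∈ qvars Γ → x ∈ qvars (Γ ++ Δ)
∈qvars-++ˡ Γ Δ p rewrite qvars-++ Γ Δ = MP.∈-++⁺ˡ p
∈qvars-++ʳ : ∀ Γ Δ {x} → x ∈ qvars Δ → x ∈ qvars (Γ ++ Δ)
∈qvars-++ʳ Γ Δ p rewrite qvars-++ Γ Δ = MP.∈-++⁺ʳ (qvars Γ) p
Unique-++⁻ : ∀ (xs : List ℕ) {ys} → Unique (xs ++ ys) → Unique xs × Unique ys × (∀ {a} → a ∈ xs → a ∈ ys → ⊥)
Unique-++⁻ [] u = [] , u , (λ ())
Unique-++⁻ (x ∷ xs) (h ∷ u) with Unique-++⁻ xs u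
... | u1 , u2 , d = (AllP.++⁻ˡ xs h ∷ u1) , u2 , dj
  where
  dj : ∀ {a} → a ∈ x ∷ xs → a ∈ _ → ⊥
  dj (here refl) q = AllM.lookup (AllP.++⁻ʳ xs h) q refl
  dj (there p) q = d p q

concatMap-↭ : ∀ (f : Item → List ℕ) {Γ Δ} → Γ ↭ Δ → concat (map f Γ) ↭ concat (map f Δ)
concatMap-↭ f Perm.refl = Perm.refl
concatMap-↭ f (prep x p) = PP.++⁺ˡ (f x) (concatMap-↭ f p)
concatMap-↭ f (swap x y p) = Perm.trans (PP.shifts (f x) (f y)) (PP.++⁺ˡ (f y) (PP.++⁺ˡ (f x) (concatMap-↭ f p)))
concatMap-↭ f (Perm.trans p q) = Perm.trans (concatMap-↭ f p) (concatMap-↭ f q)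

Unique-resp-↭ : ∀ {xs ys : List ℕ} → xs ↭ ys → Unique xs → Unique ys
Unique-resp-↭ p = PermS.Unique-resp-↭ (Perm.↭⇒↭ₛ p)

IsEnv-↭ : ∀ {Γ Δ} → Γ ↭ Δ → IsEnv Γ → IsEnv Δ
IsEnv-↭ p (u1 , u2) = Unique-resp-↭ (concatMap-↭ cnames p) u1 , Unique-resp-↭ (concatMap-↭ qnames p) u2

IsEnv-++⁻ : ∀ Γ Δ → IsEnv (Γ ++ Δ) → IsEnv Γ × IsEnv Δ
IsEnv-++⁻ Γ Δ (u1 , u2) rewrite cvars-++ Γ Δ | qvars-++ Γ Δ with Unique-++⁻ (cvars Γ) u1 | Unique-++⁻ (qvars Γ) u2
... | a1 , b1 , _ | a2 , b2 , _ = (a1 , a2) , (b1 , b2)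

IsEnv-++⇒disjoint : ∀ Γ Δ → IsEnv (Γ ++ Δ) → (∀ {a} → a ∈ cvars Γ → a ∈ cvars Δ → ⊥) × (∀ {a} → a ∈ qvars Γ → a ∈ qvars Δ → ⊥)
IsEnv-++⇒disjoint Γ Δ (u1 , u2) rewrite cvars-++ Γ Δ | qvars-++ Γ Δ with Unique-++⁻ (cvars Γ) u1 | Unique-++⁻ (qvars Γ) u2
... | _ , _ , d₁ | _ , _ , d₂ = d₁ , d₂

record Profile : Set where
  constructor profile
  field
    pLin pBang : Var → ℕ
    pFree pQbits : List ℕ
open Profile

profileOf : Term → Profile
profileOf M = profile (λ t → #lin t M) (λ t → #bang t M) (fv M) (qvs M)

profilesOf : List Term → Profile
profilesOf Ms = profile (λ t → #lins t Ms) (λ t → #bangs t Ms) (fvs Ms) (qvss Ms)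

_⊕_ : Profile → Profile → Profile
P ⊕ Q = profile (λ t → pLin P t + pLin Q t) (λ t → pBang P t + pBang Q t) (pFree P ++ pFree Q) (pQbits P ++ pQbits Q)

pAll : Profile → Var → ℕ
pAll P t = pLin P t + pBang P t

LinearIn : Profile → ℕ → Set
LinearIn P x = pLin P (free x) ≡ 1 × pBang P (free x) ≡ 0

ItemOK : Profile → Item → Set
ItemOK P (lin x) = LinearIn P x
ItemOK P (tupP x y xs) = All (LinearIn P) (x ∷ y ∷ xs)
ItemOK P (bangI x) = ⊤
ItemOK P (qv r) = pLin P (qbit r) ≡ 1 × pBang P (qbit r) ≡ 0

Fits : Env → Profile → Set
Fits Γ P = IsEnv Γ × (∀ {x} → x ∈ pFree P → x ∈ cvars Γ) × (∀ {r} → r ∈ pQbits P → r ∈ qvars Γ) × All (ItemOK P) Γ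

infix 4 _⊨_
record _⊨_ (Γ : Env) (M : Term) : Set where
  constructor _,_
  field
    fits : Fits Γ (profileOf M)
    wellBound : WellBound [] M

Coherent : Profile → Set
Coherent P = (∀ {x} → x ∈ pFree P → 0 < pAll P (free x)) × (∀ {x} → 0 < pAll P (free x) → x ∈ pFree P) ×
        (∀ {x} → x ∈ pQbits P → 0 < pAll P (qbit x)) × (∀ {x} → 0 < pAll P (qbit x) → x ∈ pQbits P)

profileOf-coherent : ∀ M → Coherent (profileOf M)
profileOf-coherent M = (λ {x} p → subst (0 <_) (sym (#lin+#bang≡#all (free x) M)) (fv⇒occurs M p)) ,
         (λ {x} p → occurs⇒fv M (subst (0 <_) (#lin+#bang≡#all (free x) M) p)) ,
         (λ {x} p → subst (0 <_) (sym (#lin+#bang≡#all (qbit x) M)) (qvs⇒occurs M p)) ,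
         (λ {x} p → occurs⇒qvs M (subst (0 <_) (#lin+#bang≡#all (qbit x) M) p))

profilesOf-coherent : ∀ Ms → Coherent (profilesOf Ms)
profilesOf-coherent Ms = (λ {x} p → subst (0 <_) (sym (#lins+#bangs≡#alls (free x) Ms)) (fvs⇒occurs Ms p)) ,
         (λ {x} p → occurs⇒fvs Ms (subst (0 <_) (#lins+#bangs≡#alls (free x) Ms) p)) ,
         (λ {x} p → subst (0 <_) (sym (#lins+#bangs≡#alls (qbit x) Ms)) (qvss⇒occurs Ms p)) ,
         (λ {x} p → occurs⇒qvss Ms (subst (0 <_) (#lins+#bangs≡#alls (qbit x) Ms) p))

pAll-⊕ : ∀ P Q t → pAll (P ⊕ Q) t ≡ pAll P t + pAll Q t
pAll-⊕ P Q t = interchange (pLin P t) (pLin Q t) (pBang P t) (pBang Q t)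

⊕-coherent : ∀ P Q → Coherent P → Coherent Q → Coherent (P ⊕ Q)
⊕-coherent P Q (a1 , a2 , a3 , a4) (b1 , b2 , b3 , b4) =
  (λ {x} p → subst (0 <_) (sym (pAll-⊕ P Q (free x))) ([ (λ q → +-posˡ (pAll Q (free x)) (a1 q)) , (λ q → +-posʳ (pAll P (free x)) (b1 q)) ]′ (MP.∈-++⁻ (pFree P) p))) ,
  (λ {x} p → [ (λ q → MP.∈-++⁺ˡ (a2 q)) , (λ q → MP.∈-++⁺ʳ (pFree P) (b2 q)) ]′ (+-pos⁻ (pAll P (free x)) _ (subst (0 <_) (pAll-⊕ P Q (free x)) p))) ,
  (λ {x} p → subst (0 <_) (sym (pAll-⊕ P Q (qbit x))) ([ (λ q → +-posˡ (pAll Q (qbit x)) (a3 q)) , (λ q → +-posʳ (pAll P (qbit x)) (b3 q)) ]′ (MP.∈-++⁻ (pQbits P) p))) ,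
  (λ {x} p → [ (λ q → MP.∈-++⁺ˡ (a4 q)) , (λ q → MP.∈-++⁺ʳ (pQbits P) (b4 q)) ]′ (+-pos⁻ (pAll P (qbit x)) _ (subst (0 <_) (pAll-⊕ P Q (qbit x)) p)))

SameAt : Profile → Profile → Var → Set
SameAt P P' t = pLin P' t ≡ pLin P t × pBang P' t ≡ pBang P t

LinearIn-transport : ∀ P P' {x} → LinearIn P x → SameAt P P' (free x) → LinearIn P' x
LinearIn-transport P P' (a , b) (e1 , e2) = trans e1 a , trans e2 b

All-LinearIn-transport : ∀ P P' zs → All (LinearIn P) zs → (∀ {x} → x ∈ zs → SameAt P P' (free x)) → All (LinearIn P') zs
All-LinearIn-transport P P' [] [] h = []
All-LinearIn-transport P P' (z ∷ zs) (l ∷ ls) h = LinearIn-transport P P' l (h (here refl)) ∷ All-LinearIn-transport P P' zs ls (λ p → h (there p))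

linNames : Item → List ℕ
linNames (lin x) = x ∷ []
linNames (tupP x y xs) = x ∷ y ∷ xs
linNames (bangI x) = []
linNames (qv r) = []

linVars : Env → List ℕ
linVars Γ = concat (map linNames Γ)

linNames⊆cnames : ∀ it {x} → x ∈ linNames it → x ∈ cnames it
linNames⊆cnames (lin x) p = p
linNames⊆cnames (tupP x y xs) p = p

linVars⊆cvars : ∀ Γ {x} → x ∈ linVars Γ → x ∈ cvars Γ
linVars⊆cvars (it ∷ Γ) p with MP.∈-++⁻ (linNames it) p
... | inj₁ q = MP.∈-++⁺ˡ (linNames⊆cnames it q)
... | inj₂ q = MP.∈-++⁺ʳ (cnames it) (linVars⊆cvars Γ q)

ItemOK-transport : ∀ P P' it → ItemOK P it → (∀ {x} → x ∈ linNames it → SameAt P P' (free x)) → (∀ {r} → r ∈ qnames it → SameAt P P' (qbit r)) → ItemOK P' it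
ItemOK-transport P P' (lin x) l hf hq = LinearIn-transport P P' l (hf (here refl))
ItemOK-transport P P' (tupP x y xs) l hf hq = All-LinearIn-transport P P' (x ∷ y ∷ xs) l hf
ItemOK-transport P P' (bangI x) l hf hq = tt
ItemOK-transport P P' (qv r) (a , b) hf hq with hq (here refl)
... | e1 , e2 = trans e1 a , trans e2 b

All-ItemOK-transport-lin : ∀ P P' Γ → All (ItemOK P) Γ → (∀ {x} → x ∈ linVars Γ → SameAt P P' (free x)) →
                           (∀ {r} → r ∈ qvars Γ → SameAt P P' (qbit r)) → All (ItemOK P') Γ
All-ItemOK-transport-lin P P' [] [] hf hq = []
All-ItemOK-transport-lin P P' (it ∷ Γ) (l ∷ ls) hf hq = ItemOK-transport P P' it l (λ p → hf (MP.∈-++⁺ˡ p)) (λ p → hq (MP.∈-++⁺ˡ p)) ∷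
  All-ItemOK-transport-lin P P' Γ ls (λ p → hf (MP.∈-++⁺ʳ (linNames it) p)) (λ p → hq (MP.∈-++⁺ʳ (qnames it) p))

All-ItemOK-transport : ∀ P P' Γ → All (ItemOK P) Γ → (∀ {x} → x ∈ cvars Γ → SameAt P P' (free x)) →
                       (∀ {r} → r ∈ qvars Γ → SameAt P P' (qbit r)) → All (ItemOK P') Γ
All-ItemOK-transport P P' Γ ls hf hq = All-ItemOK-transport-lin P P' Γ ls (λ p → hf (linVars⊆cvars Γ p)) hq

absentFree : ∀ P → Coherent P → ∀ {x} → ¬ (x ∈ pFree P) → pLin P (free x) ≡ 0 × pBang P (free x) ≡ 0
absentFree P (_ , c2 , _ , _) {x} n = m+n≡0⇒m≡0 (pLin P (free x)) e , m+n≡0⇒n≡0 (pLin P (free x)) e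
  where
  e : pAll P (free x) ≡ 0
  e = n≤0⇒n≡0 (≮⇒≥ (λ p → n (c2 p)))

absentQbit : ∀ P → Coherent P → ∀ {x} → ¬ (x ∈ pQbits P) → pLin P (qbit x) ≡ 0 × pBang P (qbit x) ≡ 0
absentQbit P (_ , _ , _ , c4) {x} n = m+n≡0⇒m≡0 (pLin P (qbit x)) e , m+n≡0⇒n≡0 (pLin P (qbit x)) e
  where
  e : pAll P (qbit x) ≡ 0
  e = n≤0⇒n≡0 (≮⇒≥ (λ p → n (c4 p)))

Fits-++ : ∀ {Γ₁ Γ₂} P Q → Fits Γ₁ P → Fits Γ₂ Q → Coherent P → Coherent Q → IsEnv (Γ₁ ++ Γ₂) → Fits (Γ₁ ++ Γ₂) (P ⊕ Q)
Fits-++ {Γ₁} {Γ₂} P Q (e1 , f1 , q1 , l1) (e2 , f2 , q2 , l2) cP cQ e =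
  e ,
  (λ p → [ (λ r → ∈cvars-++ˡ Γ₁ Γ₂ (f1 r)) , (λ r → ∈cvars-++ʳ Γ₁ Γ₂ (f2 r)) ]′ (MP.∈-++⁻ (pFree P) p)) ,
  (λ p → [ (λ r → ∈qvars-++ˡ Γ₁ Γ₂ (q1 r)) , (λ r → ∈qvars-++ʳ Γ₁ Γ₂ (q2 r)) ]′ (MP.∈-++⁻ (pQbits P) p)) ,
  AllP.++⁺ (All-ItemOK-transport P (P ⊕ Q) Γ₁ l1 hf1 hq1) (All-ItemOK-transport Q (P ⊕ Q) Γ₂ l2 hf2 hq2)
  where
  dis : (∀ {a} → a ∈ cvars Γ₁ → a ∈ cvars Γ₂ → ⊥) × (∀ {a} → a ∈ qvars Γ₁ → a ∈ qvars Γ₂ → ⊥)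
  dis = IsEnv-++⇒disjoint Γ₁ Γ₂ e
  hf1 : ∀ {x} → x ∈ cvars Γ₁ → SameAt P (P ⊕ Q) (free x)
  hf1 {x} p with absentFree Q cQ (λ r → proj₁ dis p (f2 r))
  ... | z1 , z2 rewrite z1 | z2 = +-identityʳ _ , +-identityʳ _
  hq1 : ∀ {x} → x ∈ qvars Γ₁ → SameAt P (P ⊕ Q) (qbit x)
  hq1 {x} p with absentQbit Q cQ (λ r → proj₂ dis p (q2 r))
  ... | z1 , z2 rewrite z1 | z2 = +-identityʳ _ , +-identityʳ _
  hf2 : ∀ {x} → x ∈ cvars Γ₂ → SameAt Q (P ⊕ Q) (free x)
  hf2 {x} p with absentFree P cP (λ r → proj₁ dis (f1 r) p)
  ... | z1 , z2 rewrite z1 | z2 = refl , refl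
  hq2 : ∀ {x} → x ∈ qvars Γ₂ → SameAt Q (P ⊕ Q) (qbit x)
  hq2 {x} p with absentQbit P cP (λ r → proj₂ dis (q1 r) p)
  ... | z1 , z2 rewrite z1 | z2 = refl , refl

Fits-↭ : ∀ {Γ Δ} P → Γ ↭ Δ → Fits Γ P → Fits Δ P
Fits-↭ P p (e , f , q , l) = IsEnv-↭ p e , (λ r → PP.∈-resp-↭ (concatMap-↭ cnames p) (f r)) ,
  (λ r → PP.∈-resp-↭ (concatMap-↭ qnames p) (q r)) , PP.All-resp-↭ p l

⊨-↭ : ∀ {Γ Δ M} → Γ ↭ Δ → Γ ⊨ M → Δ ⊨ M
⊨-↭ {M = M} p (c , w) = Fits-↭ (profileOf M) p c , w

lookupℕ : List ℕ → ℕ → ℕ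
lookupℕ [] j = 0
lookupℕ (z ∷ zs) zero = z
lookupℕ (z ∷ zs) (suc j) = lookupℕ zs j

lookupℕ-∈ : ∀ zs j → j < length zs → lookupℕ zs j ∈ zs
lookupℕ-∈ (z ∷ zs) zero p = here refl
lookupℕ-∈ (z ∷ zs) (suc j) (s≤s p) = there (lookupℕ-∈ zs j p)

#all≡0⇒occ≡0 : ∀ m t M → #all t M ≡ 0 → occ m t M ≡ 0
#all≡0⇒occ≡0 linear t M e = #all≡0⇒#lin≡0 t M e
#all≡0⇒occ≡0 banged t M e = #all≡0⇒#bang≡0 t M e
#all≡0⇒occ≡0 total t M e = e

substOcc-free : ∀ m a e → substOcc m a (λ m' → leafCount m' e) ≡ a m * e
substOcc-free linear a e = refl
substOcc-free banged a e = trans (cong (a banged * e +_) (*-zeroʳ (a linear))) (+-identityʳ _)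
substOcc-free total a e = refl

indexedSum-fvars-absent : ∀ (f : ℕ → Term → ℕ) (h : ℕ → ℕ) w zs → (∀ j z → f j (fvar z) ≡ h j * δ w z) → ¬ (w ∈ zs) → indexedSum f (map fvar zs) ≡ 0
indexedSum-fvars-absent f h w [] hyp n = refl
indexedSum-fvars-absent f h w (z ∷ zs) hyp n rewrite hyp 0 z | δ-≢ {w} {z} (λ e → n (here e)) | *-zeroʳ (h 0) =
  indexedSum-fvars-absent (λ j → f (suc j)) (λ j → h (suc j)) w zs (λ j → hyp (suc j)) (λ p → n (there p))

indexedSum-fvars-at : ∀ (f : ℕ → Term → ℕ) (h : ℕ → ℕ) w zs → (∀ j z → f j (fvar z) ≡ h j * δ w z) → Unique zs →
       ∀ j → j < length zs → lookupℕ zs j ≡ w → indexedSum f (map fvar zs) ≡ h j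
indexedSum-fvars-at f h w (z ∷ zs) hyp (u ∷ us) zero p refl rewrite hyp 0 z | δ-refl z | *-identityʳ (h 0)
  | indexedSum-fvars-absent (λ j → f (suc j)) (λ j → h (suc j)) z zs (λ j → hyp (suc j)) (λ q → AllM.lookup u q refl) = +-identityʳ _
indexedSum-fvars-at f h w (z ∷ zs) hyp (u ∷ us) (suc j) (s≤s p) refl rewrite hyp 0 z
  | δ-≢ {lookupℕ zs j} {z} (λ e → AllM.lookup u (lookupℕ-∈ zs j p) (sym e)) | *-zeroʳ (h 0) =
  indexedSum-fvars-at (λ j → f (suc j)) (λ j → h (suc j)) _ zs (λ j → hyp (suc j)) us j p refl

Confined-fvars : ∀ zs M → Confined 0 (length zs) M → Confined 0 (length (map fvar zs)) M
Confined-fvars zs M v rewrite LP.length-map fvar zs = v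

openedOcc : Mode → Var → List ℕ → Term → ℕ
openedOcc m t zs M = indexedSum (λ j N → substOcc m (λ m' → occ m' (bound 0 j) M) (λ m' → occ m' t (shift 0 0 N))) (map fvar zs)

occ-open : ∀ m t zs M → Confined 0 (length zs) M → occ m t (substB 0 (map fvar zs) M) ≡ occ m (liftVar 0 t) M + openedOcc m t zs M
occ-open m t zs M v = occ-substB m t 0 (map fvar zs) M (Confined-fvars zs M v)

occ-open-other : ∀ m zs M w → Confined 0 (length zs) M → ¬ (w ∈ zs) → occ m (free w) (substB 0 (map fvar zs) M) ≡ occ m (free w) M
occ-open-other m zs M w v w∉zs = trans (occ-open m (free w) zs M v) (trans (cong (occ m (free w) M +_) none) (+-identityʳ _))
  where
  none : openedOcc m (free w) zs M ≡ 0
  none = indexedSum-fvars-absent _ (λ j → occ m (bound 0 j) M) w zs (λ j z → substOcc-free m (λ m' → occ m' (bound 0 j) M) (δ w z)) w∉zs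

occ-open-fresh : ∀ m zs M j → Confined 0 (length zs) M → Unique zs → All (λ z → ¬ (z ∈ fv M)) zs → j < length zs →
          occ m (free (lookupℕ zs j)) (substB 0 (map fvar zs) M) ≡ occ m (bound 0 j) M
occ-open-fresh m zs M j v u zs∉M j<n = trans (occ-open m (free w) zs M v) (trans (cong (_+ openedOcc m (free w) zs M) absent) only-j)
  where
  w : ℕ
  w = lookupℕ zs j
  absent : occ m (free w) M ≡ 0
  absent = #all≡0⇒occ≡0 m (free w) M (∉fv⇒#all≡0 M (AllM.lookup zs∉M (lookupℕ-∈ zs j j<n)))
  only-j : openedOcc m (free w) zs M ≡ occ m (bound 0 j) M
  only-j = indexedSum-fvars-at _ (λ j → occ m (bound 0 j) M) w zs (λ j z → substOcc-free m (λ m' → occ m' (bound 0 j) M) (δ w z)) u j j<n refl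

indexedSum-fvars-zero : ∀ (f : ℕ → Term → ℕ) zs → (∀ j z → f j (fvar z) ≡ 0) → indexedSum f (map fvar zs) ≡ 0
indexedSum-fvars-zero f [] h = refl
indexedSum-fvars-zero f (z ∷ zs) h rewrite h 0 z = indexedSum-fvars-zero (λ j → f (suc j)) zs (λ j → h (suc j))

occ-open-qbit : ∀ m zs M r → Confined 0 (length zs) M → occ m (qbit r) (substB 0 (map fvar zs) M) ≡ occ m (qbit r) M
occ-open-qbit m zs M r v = trans (occ-open m (qbit r) zs M v) (trans (cong (occ m (qbit r) M +_) none) (+-identityʳ _))
  where
  none : openedOcc m (qbit r) zs M ≡ 0
  none = indexedSum-fvars-zero _ zs (λ j z → substOcc-zeroʳ m _ _ leafCount-zero)

fv-open : ∀ zs M u → Confined 0 (length zs) M → u ∈ fv M → u ∈ fv (substB 0 (map fvar zs) M)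
fv-open zs M u v p = occurs⇒fv (substB 0 (map fvar zs) M) (subst (0 <_) (sym (occ-open total (free u) zs M v)) (+-posˡ _ (fv⇒occurs M p)))

qvs-open : ∀ zs M r → Confined 0 (length zs) M → r ∈ qvs M → r ∈ qvs (substB 0 (map fvar zs) M)
qvs-open zs M r v p = occurs⇒qvs (substB 0 (map fvar zs) M) (subst (0 <_) (sym (occ-open-qbit total zs M r v)) (qvs⇒occurs M p))

Fits-close : ∀ zs Γ M → Unique (zs ++ cvars Γ) → Unique (qvars Γ) → All (λ z → ¬ (z ∈ fv M)) zs →
  let M' = substB 0 (map fvar zs) M in
  WellBound [] M' → (∀ {x} → x ∈ fv M' → x ∈ zs ++ cvars Γ) → (∀ {r} → r ∈ qvs M' → r ∈ qvars Γ) →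
  All (ItemOK (profileOf M')) Γ →
  Fits Γ (profileOf M) × WellBound (length zs ∷ []) M × Confined 0 (length zs) M
Fits-close zs Γ M u1 u2 a w f q ls =
  ((proj₁ (proj₂ sp) , u2) , fM , qM , All-ItemOK-transport (profileOf M') (profileOf M) Γ ls hf hq) , wM , v
  where
  M' : Term
  M' = substB 0 (map fvar zs) M
  sp : Unique zs × Unique (cvars Γ) × (∀ {a} → a ∈ zs → a ∈ cvars Γ → ⊥)
  sp = Unique-++⁻ zs u1
  wM : WellBound (length zs ∷ []) M
  wM = WellBound-open⁻ [] zs M w
  v : Confined 0 (length zs) M
  v = WellBound⇒Confined [] (length zs) [] M wM
  fM : ∀ {x} → x ∈ fv M → x ∈ cvars Γ
  fM {x} p with MP.∈-++⁻ zs (f (fv-open zs M x v p))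
  ... | inj₁ r = ⊥-elim (AllM.lookup a r p)
  ... | inj₂ r = r
  qM : ∀ {r} → r ∈ qvs M → r ∈ qvars Γ
  qM {r} p = q (qvs-open zs M r v p)
  hf : ∀ {x} → x ∈ cvars Γ → SameAt (profileOf M') (profileOf M) (free x)
  hf {x} p = sym (occ-open-other linear zs M x v (λ r → proj₂ (proj₂ sp) r p)) , sym (occ-open-other banged zs M x v (λ r → proj₂ (proj₂ sp) r p))
  hq : ∀ {r} → r ∈ qvars Γ → SameAt (profileOf M') (profileOf M) (qbit r)
  hq {r} p = sym (occ-open-qbit linear zs M r v) , sym (occ-open-qbit banged zs M r v)

cvars-lins : ∀ zs Γ → cvars (map lin zs ++ Γ) ≡ zs ++ cvars Γ
cvars-lins [] Γ = refl
cvars-lins (z ∷ zs) Γ = cong (z ∷_) (cvars-lins zs Γ)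

qvars-lins : ∀ zs Γ → qvars (map lin zs ++ Γ) ≡ qvars Γ
qvars-lins [] Γ = refl
qvars-lins (z ∷ zs) Γ = qvars-lins zs Γ

ItemOK-lins⁻ : ∀ P zs → All (ItemOK P) (map lin zs) → All (LinearIn P) zs
ItemOK-lins⁻ P [] [] = []
ItemOK-lins⁻ P (z ∷ zs) (l ∷ ls) = l ∷ ItemOK-lins⁻ P zs ls

All-lookupℕ : ∀ {P : ℕ → Set} zs j → All P zs → j < length zs → P (lookupℕ zs j)
All-lookupℕ (z ∷ zs) zero (p ∷ ps) q = p
All-lookupℕ (z ∷ zs) (suc j) (p ∷ ps) (s≤s q) = All-lookupℕ zs j ps q

All-IsBang⇒ItemOK : ∀ P Γ → All IsBang Γ → All (ItemOK P) Γ
All-IsBang⇒ItemOK P [] [] = []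
All-IsBang⇒ItemOK P (.(bangI x) ∷ Γ) ((x , refl) ∷ ab) = tt ∷ All-IsBang⇒ItemOK P Γ ab

-- Soundness of the characterisation

Fits-[] : ∀ P → pFree P ≡ [] → pQbits P ≡ [] → Fits [] P
Fits-[] P e₁ e₂ = ([] , []) , (λ p → case subst (_ ∈_) e₁ p of λ ()) , (λ p → case subst (_ ∈_) e₂ p of λ ()) , []

Unique-tail : ∀ {a : ℕ} {l} → Unique (a ∷ l) → Unique l
Unique-tail (_ ∷ u) = u

Fits-lamPat : ∀ Γ p M → Fits Γ (profileOf M) → Fits Γ (profileOf (lamPat p M))
Fits-lamPat Γ p M (e , f , q , l) = e , f , q , All-ItemOK-transport (profileOf M) (profileOf (lamPat p M)) Γ l (λ _ → refl , refl) (λ _ → refl , refl)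

Fits-lamBang : ∀ Γ M → Fits Γ (profileOf M) → Fits Γ (profileOf (lamBang M))
Fits-lamBang Γ M (e , f , q , l) = e , f , q , All-ItemOK-transport (profileOf M) (profileOf (lamBang M)) Γ l (λ _ → refl , refl) (λ _ → refl , refl)

LinearBinder-close : ∀ zs M → Confined 0 (length zs) M → Unique zs → All (λ z → ¬ (z ∈ fv M)) zs →
  All (LinearIn (profileOf (substB 0 (map fvar zs) M))) zs → LinearBinder (length zs) M
LinearBinder-close zs M v u a l j j<n =
  trans (sym (occ-open-fresh linear zs M j v u a j<n)) (proj₁ (All-lookupℕ zs j l j<n)) ,
  trans (sym (occ-open-fresh banged zs M j v u a j<n)) (proj₂ (All-lookupℕ zs j l j<n))

⊨-weak : ∀ {Γ M x} → Γ ⊨ M → IsEnv (bangI x ∷ Γ) → (bangI x ∷ Γ) ⊨ M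
⊨-weak ((_ , f , q , l) , w) e = (e , (λ p → there (f p)) , q , tt ∷ l) , w

contrRen-reflects : ∀ x y z {u w} → w ≢ z → contrRen x y z u ≡ w → u ≡ w
contrRen-reflects x y z {u} w≢z e with u ≟ x | u ≟ y
... | yes u≡x | _ = ⊥-elim (w≢z (trans (sym e) (contrRen-merged x y z u (inj₁ u≡x))))
... | no _ | yes u≡y = ⊥-elim (w≢z (trans (sym e) (contrRen-merged x y z u (inj₂ u≡y))))
... | no u≢x | no u≢y = trans (sym (contrRen-other x y z u u≢x u≢y)) e

⊨-contr : ∀ {Γ M x y z} → (bangI x ∷ bangI y ∷ Γ) ⊨ M → IsEnv (bangI z ∷ Γ) →
          (bangI z ∷ Γ) ⊨ renameF (contrRen x y z) M
⊨-contr {Γ} {M} {x} {y} {z} ((((ux ∷ uy ∷ _) , _) , f , q , _ ∷ _ ∷ ls) , w) e@((uz ∷ _) , _) =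
  (e , fv-renamed , (λ p → q (subst (_ ∈_) (sym (SameShape-qvs same)) p)) , tt ∷ All-ItemOK-transport (profileOf M) (profileOf M') Γ ls hf hq) ,
  SameShape-WellBound same [] w
  where
  ρ : ℕ → ℕ
  ρ = contrRen x y z
  M' : Term
  M' = renameF ρ M
  same : SameShape M M'
  same = renameF-SameShape ρ M
  fv-renamed : ∀ {v} → v ∈ fv M' → v ∈ z ∷ cvars Γ
  fv-renamed p with fv-renameF ρ M p
  ... | u , u∈M , refl with f u∈M
  ... | here refl = here (contrRen-merged x y z u (inj₁ refl))
  ... | there (here refl) = here (contrRen-merged x y z u (inj₂ refl))
  ... | there (there u∈Γ) = there (subst (_∈ cvars Γ) (sym (contrRen-other x y z u
          (λ { refl → AllM.lookup ux (there u∈Γ) refl }) (λ { refl → AllM.lookup uy u∈Γ refl }))) u∈Γ)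
  hf : ∀ {v} → v ∈ cvars Γ → SameAt (profileOf M) (profileOf M') (free v)
  hf {v} p = occ-renameF ρ v reflects fixed linear M , occ-renameF ρ v reflects fixed banged M
    where
    reflects : ∀ u → ρ u ≡ v → u ≡ v
    reflects u = contrRen-reflects x y z (λ { refl → AllM.lookup uz p refl })
    fixed : ρ v ≡ v
    fixed = contrRen-other x y z v (λ { refl → AllM.lookup ux (there p) refl }) (λ { refl → AllM.lookup uy p refl })
  hq : ∀ {r} → r ∈ qvars Γ → SameAt (profileOf M) (profileOf M') (qbit r)
  hq {r} _ = sym (SameShape-occ same linear (qbit r) tt) , sym (SameShape-occ same banged (qbit r) tt)

⊨-prom : ∀ {Γ M} → All IsBang Γ → Γ ⊨ M → Γ ⊨ bang M
⊨-prom {Γ} {M} bangs ((e , f , q , _) , w) = (e , f , q , All-IsBang⇒ItemOK (profileOf (bang M)) Γ bangs) , w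

⊨-der : ∀ {Γ M x} → (lin x ∷ Γ) ⊨ M → (bangI x ∷ Γ) ⊨ M
⊨-der ((e , f , q , _ ∷ ls) , w) = (e , f , q , tt ∷ ls) , w

⊨-pat : ∀ {Γ M x y xs} → (map lin (x ∷ y ∷ xs) ++ Γ) ⊨ M → (tupP x y xs ∷ Γ) ⊨ M
⊨-pat {Γ} {M} {x} {y} {xs} (((u₁ , u₂) , f , q , ls) , w) =
  ((subst Unique (cvars-lins zs Γ) u₁ , subst Unique (qvars-lins zs Γ) u₂) ,
   (λ {v} p → subst (v ∈_) (cvars-lins zs Γ) (f p)) , (λ {v} p → subst (v ∈_) (qvars-lins zs Γ) (q p)) ,
   ItemOK-lins⁻ (profileOf M) zs (AllP.++⁻ˡ (map lin zs) ls) ∷ AllP.++⁻ʳ (map lin zs) ls) , w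
  where
  zs : List ℕ
  zs = x ∷ y ∷ xs

⊨-new : ∀ {Γ M} → Γ ⊨ M → Γ ⊨ new M
⊨-new (c , w) = c , w

⊨-app : ∀ {Γ₁ Γ₂ M₁ M₂} → Γ₁ ⊨ M₁ → Γ₂ ⊨ M₂ → IsEnv (Γ₁ ++ Γ₂) → (Γ₁ ++ Γ₂) ⊨ app M₁ M₂
⊨-app {M₁ = M₁} {M₂} (c₁ , w₁) (c₂ , w₂) e =
  Fits-++ (profileOf M₁) (profileOf M₂) c₁ c₂ (profileOf-coherent M₁) (profileOf-coherent M₂) e , w₁ , w₂

⊨-tup : ∀ {Γ₁ Γ₂ Γ₃ M₁ M₂ Ms} → Γ₁ ⊨ M₁ → Γ₂ ⊨ M₂ → Fits Γ₃ (profilesOf Ms) × WellBounds [] Ms →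
        IsEnv (Γ₁ ++ Γ₂ ++ Γ₃) → (Γ₁ ++ Γ₂ ++ Γ₃) ⊨ tup M₁ M₂ Ms
⊨-tup {Γ₁} {Γ₂} {Γ₃} {M₁} {M₂} {Ms} (c₁ , w₁) (c₂ , w₂) (c₃ , w₃) e =
  Fits-++ (profileOf M₁) (profileOf M₂ ⊕ profilesOf Ms) c₁ c₂₃ (profileOf-coherent M₁) coh₂₃ e , w₁ , w₂ , w₃
  where
  e₂₃ : IsEnv (Γ₂ ++ Γ₃)
  e₂₃ = proj₂ (IsEnv-++⁻ Γ₁ (Γ₂ ++ Γ₃) e)
  coh₂₃ : Coherent (profileOf M₂ ⊕ profilesOf Ms)
  coh₂₃ = ⊕-coherent (profileOf M₂) (profilesOf Ms) (profileOf-coherent M₂) (profilesOf-coherent Ms)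
  c₂₃ : Fits (Γ₂ ++ Γ₃) (profileOf M₂ ⊕ profilesOf Ms)
  c₂₃ = Fits-++ (profileOf M₂) (profilesOf Ms) c₂ c₃ (profileOf-coherent M₂) (profilesOf-coherent Ms) e₂₃

⊨-lam-x : ∀ {Γ M x} → ¬ (x ∈ fv M) → (lin x ∷ Γ) ⊨ open0 (fvar x ∷ []) M → Γ ⊨ lamPat pv M
⊨-lam-x {Γ} {M} {x} x∉M (((u₁ , u₂) , f , q , l ∷ ls) , w) with Fits-close (x ∷ []) Γ M u₁ u₂ (x∉M ∷ []) w f q ls
... | c , wM , v = Fits-lamPat Γ pv M c , wM , LinearBinder-close (x ∷ []) M v ([] ∷ []) (x∉M ∷ []) (l ∷ [])

⊨-lam-tup : ∀ {Γ M x y xs} → All (λ v → ¬ (v ∈ fv M)) (x ∷ y ∷ xs) →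
            (tupP x y xs ∷ Γ) ⊨ open0 (map fvar (x ∷ y ∷ xs)) M → Γ ⊨ lamPat (ptup (length xs)) M
⊨-lam-tup {Γ} {M} {x} {y} {xs} zs∉M (((u₁ , u₂) , f , q , l ∷ ls) , w) with Fits-close (x ∷ y ∷ xs) Γ M u₁ u₂ zs∉M w f q ls
... | c , wM , v = Fits-lamPat Γ (ptup (length xs)) M c , wM ,
                   LinearBinder-close (x ∷ y ∷ xs) M v (proj₁ (Unique-++⁻ (x ∷ y ∷ xs) u₁)) zs∉M l

⊨-lam-! : ∀ {Γ M x} → ¬ (x ∈ fv M) → (bangI x ∷ Γ) ⊨ open0 (fvar x ∷ []) M → Γ ⊨ lamBang M
⊨-lam-! {Γ} {M} {x} x∉M (((u₁ , u₂) , f , q , _ ∷ ls) , w) with Fits-close (x ∷ []) Γ M u₁ u₂ (x∉M ∷ []) w f q ls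
... | c , wM , _ = Fits-lamBang Γ M c , wM

mutual
  ⊢⇒⊨ : ∀ {Γ M} → Γ ⊢ M → Γ ⊨ M
  ⊢⇒⊨ ax-0 = Fits-[] (profileOf czero) refl refl , tt
  ⊢⇒⊨ ax-1 = Fits-[] (profileOf cone) refl refl , tt
  ⊢⇒⊨ (ax-U i) = Fits-[] (profileOf (cU i)) refl refl , tt
  ⊢⇒⊨ (ax-q r) = (([] , [] ∷ []) , (λ ()) , (λ { (here refl) → here refl }) , (δ-refl r , refl) ∷ []) , tt
  ⊢⇒⊨ (ax-c x) = (([] ∷ [] , []) , (λ { (here refl) → here refl }) , (λ ()) , (δ-refl x , refl) ∷ []) , tt
  ⊢⇒⊨ (exch {M = M} d p) = Fits-↭ (profileOf M) p (_⊨_.fits (⊢⇒⊨ d)) , _⊨_.wellBound (⊢⇒⊨ d)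
  ⊢⇒⊨ (weak d e) = ⊨-weak (⊢⇒⊨ d) e
  ⊢⇒⊨ (contr d e) = ⊨-contr (⊢⇒⊨ d) e
  ⊢⇒⊨ (prom bangs d) = ⊨-prom bangs (⊢⇒⊨ d)
  ⊢⇒⊨ (der d) = ⊨-der (⊢⇒⊨ d)
  ⊢⇒⊨ (pat d) = ⊨-pat (⊢⇒⊨ d)
  ⊢⇒⊨ (tupR {Γ₁} {Γ₂} {Γs} d₁ d₂ ds e) =
    ⊨-tup (⊢⇒⊨ d₁) (⊢⇒⊨ d₂) (⊢⇒⊨-pointwise ds (proj₂ (IsEnv-++⁻ Γ₂ (concat Γs) (proj₂ (IsEnv-++⁻ Γ₁ _ e))))) e
  ⊢⇒⊨ (newR d) = ⊨-new (⊢⇒⊨ d)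
  ⊢⇒⊨ (lam-x x∉M d) = ⊨-lam-x x∉M (⊢⇒⊨ d)
  ⊢⇒⊨ (lam-tup zs∉M d) = ⊨-lam-tup zs∉M (⊢⇒⊨ d)
  ⊢⇒⊨ (lam-! x∉M d) = ⊨-lam-! x∉M (⊢⇒⊨ d)
  ⊢⇒⊨ (appR d₁ d₂ e) = ⊨-app (⊢⇒⊨ d₁) (⊢⇒⊨ d₂) e

  ⊢⇒⊨-pointwise : ∀ {Γs Ms} → Pointwise _⊢_ Γs Ms → IsEnv (concat Γs) → Fits (concat Γs) (profilesOf Ms) × WellBounds [] Ms
  ⊢⇒⊨-pointwise [] e = Fits-[] (profilesOf []) refl refl , tt
  ⊢⇒⊨-pointwise {Γ ∷ Γs} {M ∷ Ms} (d ∷ ds) e with ⊢⇒⊨ d | ⊢⇒⊨-pointwise ds (proj₂ (IsEnv-++⁻ Γ (concat Γs) e))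
  ... | c₁ , w₁ | c₂ , w₂ = Fits-++ (profileOf M) (profilesOf Ms) c₁ c₂ (profileOf-coherent M) (profilesOf-coherent Ms) e , w₁ , w₂

-- Reduction preserves the characterisation

-- czero stands for "no new occurrence": only a new-step creates one, of its fresh qubit.
created : Maybe ℕ → Term
created nothing = czero
created (just r) = qvar r

occ-↑-created : ∀ m t e → occ m (↑ t) (created e) ≡ occ m t (created e)
occ-↑-created m t nothing = refl
occ-↑-created m (free x) (just r) = refl
occ-↑-created m (qbit x) (just r) = refl
occ-↑-created m (bound x y) (just r) = refl

occ-bound-created : ∀ m i j e → occ m (bound i j) (created e) ≡ 0
occ-bound-created m i j nothing = refl
occ-bound-created m i j (just r) = leafCount-zero m

#all-free-created : ∀ x e → #all (free x) (created e) ≡ 0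
#all-free-created x nothing = refl
#all-free-created x (just r) = refl

record StepInvariant (c : List ℕ) (M M' : Term) (QV QV' : List ℕ) : Set where
  constructor stepInvariant
  field
    newQbit : Maybe ℕ
    qv-extended : QV' ≡ fromMaybe newQbit ++ QV
    qv-fresh : All (λ r → ¬ r ∈ QV) (fromMaybe newQbit)
    reduct-WellBound : WellBound c M'
    linear-kept : ∀ t → #bang t M ≡ 0 → #lin t M' ≡ #lin t M + #lin t (created newQbit) × #bang t M' ≡ 0
    absent-kept : ∀ t → #all t M ≡ 0 → #all t M' ≡ #all t (created newQbit)

StepInvariant-exact : ∀ {c M M' QV} → (∀ m t → occ m t M' ≡ occ m t M) → WellBound c M' → StepInvariant c M M' QV QV
StepInvariant-exact h w =
  stepInvariant nothing refl [] w (λ t e → trans (h linear t) (sym (+-identityʳ _)) , trans (h banged t) e) (λ t e → trans (h total t) e)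

indexedSum-linear : ∀ m t (a : Mode → ℕ → ℕ) Ns → (∀ j → j < length Ns → a linear j ≡ 1 × a banged j ≡ 0 × a total j ≡ 1) →
        indexedSum (λ j N → substOcc m (λ m' → a m' j) (λ m' → occ m' t (shift 0 0 N))) Ns ≡ occs m t Ns
indexedSum-linear m t a [] h = refl
indexedSum-linear m t a (N ∷ Ns) h =
  cong₂ _+_ (trans (cong (λ z → substOcc m (λ m' → a m' 0) (λ m' → occ m' t z)) (shift-zero 0 N)) (head m (h 0 (s≤s z≤n))))
            (indexedSum-linear m t (λ m' j → a m' (suc j)) Ns (λ j p → h (suc j) (s≤s p)))
  where
  head : ∀ m → a linear 0 ≡ 1 × a banged 0 ≡ 0 × a total 0 ≡ 1 → substOcc m (λ m' → a m' 0) (λ m' → occ m' t N) ≡ occ m t N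
  head linear (e₁ , e₂ , e₃) rewrite e₁ = +-identityʳ _
  head banged (e₁ , e₂ , e₃) rewrite e₁ | e₂ = +-identityʳ _
  head total (e₁ , e₂ , e₃) rewrite e₃ = +-identityʳ _

occ-open-linear : ∀ m t A Ns → Confined 0 (length Ns) A → LinearBinder (length Ns) A →
                  occ m t (substB 0 Ns A) ≡ occ m (↑ t) A + occs m t Ns
occ-open-linear m t A Ns v l = trans (occ-substB m t 0 Ns A v) (cong₂ _+_ (cong (λ z → occ m z A) (liftVar-0 t))
  (indexedSum-linear m t (λ m' j → occ m' (bound 0 j) A) Ns (λ j p → proj₁ (l j p) , proj₂ (l j p) ,
     trans (sym (#lin+#bang≡#all (bound 0 j) A)) (cong₂ _+_ (proj₁ (l j p)) (proj₂ (l j p))))))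

occ-open-absent : ∀ m t A B → Confined 0 1 A → (∀ m' → occ m' t B ≡ 0) → occ m t (substB 0 (B ∷ []) A) ≡ occ m (↑ t) A
occ-open-absent m t A B v h = trans (occ-substB m t 0 (B ∷ []) A v) (trans (cong₂ _+_ (cong (λ z → occ m z A) (liftVar-0 t))
  (cong (_+ 0) (substOcc-zeroʳ m _ _ (λ m' → trans (cong (occ m' t) (shift-zero 0 B)) (h m'))))) (+-identityʳ _))

All-WellBound-qvars : ∀ c rs → All (WellBound c) (map qvar rs)
All-WellBound-qvars c [] = []
All-WellBound-qvars c (r ∷ rs) = tt ∷ All-WellBound-qvars c rs

occs-++ : ∀ m t (pre : List Term) K post → occs m t (pre ++ K ∷ post) ≡ occs m t pre + (occ m t K + occs m t post)
occs-++ m t [] K post = refl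
occs-++ m t (P ∷ pre) K post rewrite occs-++ m t pre K post = sym (+-assoc (occ m t P) (occs m t pre) _)

WellBounds-++⁻ : ∀ c (pre : List Term) K post → WellBounds c (pre ++ K ∷ post) → WellBounds c pre × WellBound c K × WellBounds c post
WellBounds-++⁻ c [] K post (w , ws) = tt , w , ws
WellBounds-++⁻ c (P ∷ pre) K post (w , ws) with WellBounds-++⁻ c pre K post ws
... | a , b , d = (w , a) , b , d

WellBounds-++⁺ : ∀ c (pre : List Term) K post → WellBounds c pre → WellBound c K → WellBounds c post → WellBounds c (pre ++ K ∷ post)
WellBounds-++⁺ c [] K post tt w ws = w , ws
WellBounds-++⁺ c (P ∷ pre) K post (w , a) b d = w , WellBounds-++⁺ c pre K post a b d

occ-constBit : ∀ D m t c → occ m t (constBit D c) ≡ 0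
occ-constBit D m t false = refl
occ-constBit D m t true = refl

StepInvariant-context : ∀ {c A A' M M' QV QV'} (R : Mode → Var → ℕ) → StepInvariant c A A' QV QV' →
  (∀ m t → occ m t M ≡ occ m t A + R m t) → (∀ m t → occ m t M' ≡ occ m t A' + R m t) → WellBound c M' →
  StepInvariant c M M' QV QV'
StepInvariant-context {A = A} {M = M} {M'} R (stepInvariant e ext fresh _ lin-kept abs-kept) h h' w = stepInvariant e ext fresh w linear' absent'
  where
  linear' : ∀ t → #bang t M ≡ 0 → #lin t M' ≡ #lin t M + #lin t (created e) × #bang t M' ≡ 0
  linear' t e₀ with lin-kept t (m+n≡0⇒m≡0 (#bang t A) (trans (sym (h banged t)) e₀))
  ... | e₁ , e₂ =
    trans (h' linear t) (trans (cong (_+ R linear t) e₁) (trans (xy∙z≈xz∙y (#lin t A) _ (R linear t)) (cong (_+ #lin t (created e)) (sym (h linear t))))) ,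
    trans (h' banged t) (trans (cong (_+ R banged t) e₂) (m+n≡0⇒n≡0 (#bang t A) (trans (sym (h banged t)) e₀)))
  absent' : ∀ t → #all t M ≡ 0 → #all t M' ≡ #all t (created e)
  absent' t e₀ = trans (h' total t) (trans (cong₂ _+_ (abs-kept t (m+n≡0⇒m≡0 (#all t A) all≡0)) (m+n≡0⇒n≡0 (#all t A) all≡0)) (+-identityʳ _))
    where
    all≡0 : #all t A + R total t ≡ 0
    all≡0 = trans (sym (h total t)) e₀

StepInvariant-lβ : ∀ {c QV A B} → WellBound c (app (lamPat pv A) B) → StepInvariant c (app (lamPat pv A) B) (open0 (B ∷ []) A) QV QV
StepInvariant-lβ {c} {A = A} {B} ((w , l) , wB) = StepInvariant-exact
  (λ m t → trans (occ-open-linear m t A (B ∷ []) (WellBound⇒Confined [] 1 c A w) l) (cong (occ m (↑ t) A +_) (+-identityʳ _)))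
  (WellBound-substB [] c (B ∷ []) A w (wB ∷ []))

StepInvariant-qβ : ∀ {c QV A r₁ r₂ rs} → let M = app (lamPat (ptup (length rs)) A) (tup (qvar r₁) (qvar r₂) (map qvar rs)) in
  WellBound c M → StepInvariant c M (open0 (map qvar (r₁ ∷ r₂ ∷ rs)) A) QV QV
StepInvariant-qβ {c} {A = A} {r₁} {r₂} {rs} ((w , l) , _) = StepInvariant-exact
  (λ m t → occ-open-linear m t A Ns (WellBound⇒Confined [] (length Ns) c A w') l')
  (WellBound-substB [] c Ns A w' (All-WellBound-qvars c (r₁ ∷ r₂ ∷ rs)))
  where
  Ns : List Term
  Ns = map qvar (r₁ ∷ r₂ ∷ rs)
  width≡ : suc (suc (length rs)) ≡ length Ns
  width≡ = sym (LP.length-map qvar (r₁ ∷ r₂ ∷ rs))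
  w' : WellBound (length Ns ∷ c) A
  w' = subst (λ z → WellBound (z ∷ c) A) width≡ w
  l' : LinearBinder (length Ns) A
  l' = subst (λ z → LinearBinder z A) width≡ l

-- The argument !N is banged in the redex, so a variable with no banged occurrence does not occur in N at all.
StepInvariant-cβ : ∀ {c QV A B} → WellBound c (app (lamBang A) (bang B)) →
                   StepInvariant c (app (lamBang A) (bang B)) (open0 (B ∷ []) A) QV QV
StepInvariant-cβ {c} {A = A} {B} (w , wB) = stepInvariant nothing refl [] (WellBound-substB [] c (B ∷ []) A w (wB ∷ []))
  (λ t e → trans (occ-open-absent linear t A B v (B-absent t e)) (sym (trans (+-identityʳ _) (+-identityʳ _))) ,
           trans (occ-open-absent banged t A B v (B-absent t e)) (m+n≡0⇒m≡0 (#bang (↑ t) A) e))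
  (λ t e → trans (occ-open-absent total t A B v (λ m' → #all≡0⇒occ≡0 m' t B (m+n≡0⇒n≡0 (#all (↑ t) A) e)))
                 (m+n≡0⇒m≡0 (#all (↑ t) A) e))
  where
  v : Confined 0 1 A
  v = WellBound⇒Confined [] 1 c A w
  B-absent : ∀ t → #bang t (app (lamBang A) (bang B)) ≡ 0 → ∀ m' → occ m' t B ≡ 0
  B-absent t e linear = m+n≡0⇒m≡0 (#lin t B) (m+n≡0⇒n≡0 (#bang (↑ t) A) e)
  B-absent t e banged = m+n≡0⇒n≡0 (#lin t B) (m+n≡0⇒n≡0 (#bang (↑ t) A) e)
  B-absent t e total = trans (sym (#lin+#bang≡#all t B)) (cong₂ _+_ (B-absent t e linear) (B-absent t e banged))

LinearBinder-shifted : ∀ a L M → LinearBinder a M →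
  LinearBinder a (app (shift 0 1 L) M) × LinearBinder a (app M (shift 0 1 L))
LinearBinder-shifted a L M l =
  (λ j q → trans (cong (_+ #lin (bound 0 j) M) (gap linear j)) (proj₁ (l j q)) ,
           trans (cong (_+ #bang (bound 0 j) M) (gap banged j)) (proj₂ (l j q))) ,
  (λ j q → trans (cong (#lin (bound 0 j) M +_) (gap linear j)) (trans (+-identityʳ _) (proj₁ (l j q))) ,
           trans (cong (#bang (bound 0 j) M +_) (gap banged j)) (trans (+-identityʳ _) (proj₂ (l j q))))
  where
  gap : ∀ m j → occ m (bound 0 j) (shift 0 1 L) ≡ 0
  gap m j = occ-shift-gap m 0 1 0 j L z≤n (s≤s z≤n)

StepInvariant-lcm : ∀ {c QV p A B L} → WellBound c (app L (app (lamPat p A) B)) →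
  StepInvariant c (app L (app (lamPat p A) B)) (app (lamPat p (app (shift 0 1 L) A)) B) QV QV
StepInvariant-lcm {c} {p = p} {A} {B} {L} (wL , (wA , l) , wB) = StepInvariant-exact
  (λ m t → trans (cong (λ z → (z + occ m (↑ t) A) + occ m t B) (occ-↑-shift m t L)) (+-assoc (occ m t L) _ _))
  (((WellBound-shift [] (width p ∷ []) c L wL , wA) , proj₁ (LinearBinder-shifted (width p) L A l)) , wB)

StepInvariant-rcm : ∀ {c QV p A B L} → WellBound c (app (app (lamPat p A) B) L) →
  StepInvariant c (app (app (lamPat p A) B) L) (app (lamPat p (app A (shift 0 1 L))) B) QV QV
StepInvariant-rcm {c} {p = p} {A} {B} {L} (((wA , l) , wB) , wL) = StepInvariant-exact
  (λ m t → trans (cong (λ z → (occ m (↑ t) A + z) + occ m t B) (occ-↑-shift m t L)) (xy∙z≈xz∙y (occ m (↑ t) A) (occ m t L) (occ m t B)))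
  (((wA , WellBound-shift [] (width p ∷ []) c L wL) , proj₂ (LinearBinder-shifted (width p) L A l)) , wB)

StepInvariant-lamB : ∀ {c QV QV' p A A'} → LinearBinder (width p) A → StepInvariant (width p ∷ c) A A' QV QV' →
  StepInvariant c (lamPat p A) (lamPat p A') QV QV'
StepInvariant-lamB {p = p} {A} {A'} l (stepInvariant e ext fresh w lin-kept abs-kept) = stepInvariant e ext fresh (w , l')
  (λ t b → trans (proj₁ (lin-kept (↑ t) b)) (cong (#lin (↑ t) A +_) (occ-↑-created linear t e)) , proj₂ (lin-kept (↑ t) b))
  (λ t a → trans (abs-kept (↑ t) a) (occ-↑-created total t e))
  where
  l' : LinearBinder (width p) A'
  l' = λ j q → trans (proj₁ (lin-kept (bound 0 j) (proj₂ (l j q)))) (cong₂ _+_ (proj₁ (l j q)) (occ-bound-created linear 0 j e)) ,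
               proj₂ (lin-kept (bound 0 j) (proj₂ (l j q)))

tup-rearrange : ∀ a b p k q → a + (b + (p + (k + q))) ≡ k + (a + (b + (p + q)))
tup-rearrange = solve 5 (λ a b p k q → a :+ (b :+ (p :+ (k :+ q))) := k :+ (a :+ (b :+ (p :+ q)))) refl
  where open +-*-Solver

StepInvariant-tupₙ : ∀ {c QV QV' A B K K' pre post} → WellBound c A → WellBound c B → WellBounds c pre → WellBounds c post →
  StepInvariant c K K' QV QV' → StepInvariant c (tup A B (pre ++ K ∷ post)) (tup A B (pre ++ K' ∷ post)) QV QV'
StepInvariant-tupₙ {c} {A = A} {B} {K} {K'} {pre} {post} wA wB wpre wpost inv =
  StepInvariant-context (λ m t → occ m t A + (occ m t B + (occs m t pre + occs m t post))) inv (rearrange K) (rearrange K')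
    (wA , wB , WellBounds-++⁺ c pre K' post wpre (StepInvariant.reduct-WellBound inv) wpost)
  where
  rearrange : ∀ X m t → occ m t (tup A B (pre ++ X ∷ post)) ≡ occ m t X + (occ m t A + (occ m t B + (occs m t pre + occs m t post)))
  rearrange X m t = trans (cong (λ z → occ m t A + (occ m t B + z)) (occs-++ m t pre X post))
                          (tup-rearrange (occ m t A) (occ m t B) (occs m t pre) (occ m t X) (occs m t post))

step-invariant : ∀ (D : QData) {Q QV Q' QV' M M'} → Step D ⟦ Q , QV , M ⟧ ⟦ Q' , QV' , M' ⟧ → ∀ c → WellBound c M →
                 StepInvariant c M M' QV QV'
step-invariant D (Uq i rs nz u) c (_ , w) = StepInvariant-exact (λ m t → refl) w
step-invariant D (newS b r r∉QV) c w =
  stepInvariant (just r) refl (r∉QV ∷ []) tt (λ t e → sym (cong (_+ hitQbit t r) (occ-constBit D linear t b)) , refl) (λ t e → refl)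
step-invariant D lβ c w = StepInvariant-lβ w
step-invariant D qβ c w = StepInvariant-qβ w
step-invariant D cβ c w = StepInvariant-cβ w
step-invariant D lcm c w = StepInvariant-lcm w
step-invariant D rcm c w = StepInvariant-rcm w
step-invariant D (appL {N = B} s) c (wA , wB) with step-invariant D s c wA
... | inv = StepInvariant-context (λ m t → occ m t B) inv (λ m t → refl) (λ m t → refl) (StepInvariant.reduct-WellBound inv , wB)
step-invariant D (appR' {M = A} s) c (wA , wB) with step-invariant D s c wB
... | inv = StepInvariant-context (λ m t → occ m t A) inv (λ m t → +-comm (occ m t A) _) (λ m t → +-comm (occ m t A) _)
              (wA , StepInvariant.reduct-WellBound inv)
step-invariant D (tup₁ {N = B} {Ms = Ms} s) c (wA , wB , wMs) with step-invariant D s c wA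
... | inv = StepInvariant-context (λ m t → occ m t B + occs m t Ms) inv (λ m t → refl) (λ m t → refl)
              (StepInvariant.reduct-WellBound inv , wB , wMs)
step-invariant D (tup₂ {M = A} {Ms = Ms} s) c (wA , wB , wMs) with step-invariant D s c wB
... | inv = StepInvariant-context (λ m t → occ m t A + occs m t Ms) inv
              (λ m t → x∙yz≈y∙xz (occ m t A) _ (occs m t Ms)) (λ m t → x∙yz≈y∙xz (occ m t A) _ (occs m t Ms))
              (wA , StepInvariant.reduct-WellBound inv , wMs)
step-invariant D (tupₙ {K = K} {pre = pre} {post = post} s) c (wA , wB , wl) with WellBounds-++⁻ c pre K post wl
... | wpre , wK , wpost = StepInvariant-tupₙ wA wB wpre wpost (step-invariant D s c wK)
step-invariant D (lamB {p = p} s) c (wA , l) = StepInvariant-lamB l (step-invariant D s (width p ∷ c) wA)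

ItemOK⇒LinearIn : ∀ P Γ → All (ItemOK P) Γ → ∀ {x} → x ∈ linVars Γ → LinearIn P x
ItemOK⇒LinearIn P (lin y ∷ Γ) (l ∷ ls) (here refl) = l
ItemOK⇒LinearIn P (lin y ∷ Γ) (l ∷ ls) (there p) = ItemOK⇒LinearIn P Γ ls p
ItemOK⇒LinearIn P (tupP a b xs ∷ Γ) (l ∷ ls) p with MP.∈-++⁻ (a ∷ b ∷ xs) p
... | inj₁ q = AllM.lookup l q
... | inj₂ q = ItemOK⇒LinearIn P Γ ls q
ItemOK⇒LinearIn P (bangI y ∷ Γ) (l ∷ ls) p = ItemOK⇒LinearIn P Γ ls p
ItemOK⇒LinearIn P (qv r ∷ Γ) (l ∷ ls) p = ItemOK⇒LinearIn P Γ ls p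

ItemOK⇒qbit-linear : ∀ P Γ → All (ItemOK P) Γ → ∀ {r} → r ∈ qvars Γ → pLin P (qbit r) ≡ 1 × pBang P (qbit r) ≡ 0
ItemOK⇒qbit-linear P (lin y ∷ Γ) (l ∷ ls) p = ItemOK⇒qbit-linear P Γ ls p
ItemOK⇒qbit-linear P (tupP a b xs ∷ Γ) (l ∷ ls) p = ItemOK⇒qbit-linear P Γ ls p
ItemOK⇒qbit-linear P (bangI y ∷ Γ) (l ∷ ls) p = ItemOK⇒qbit-linear P Γ ls p
ItemOK⇒qbit-linear P (qv r ∷ Γ) (l ∷ ls) (here refl) = l
ItemOK⇒qbit-linear P (qv r ∷ Γ) (l ∷ ls) (there p) = ItemOK⇒qbit-linear P Γ ls p

qvars⊆qvs : ∀ {Γ M} → Γ ⊨ M → ∀ {r} → r ∈ qvars Γ → r ∈ qvs M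
qvars⊆qvs {Γ} {M} ((_ , _ , _ , ls) , _) {r} p =
  occurs⇒qvs M (subst (0 <_) (#lin+#bang≡#all (qbit r) M)
    (+-posˡ (#bang (qbit r) M) (subst (0 <_) (sym (proj₁ (ItemOK⇒qbit-linear (profileOf M) Γ ls p))) (s≤s z≤n))))

occurs-step : ∀ {a a'} b → (a ≡ 0 → a' ≡ b) → 0 < a' → 0 < a ⊎ 0 < b
occurs-step {zero} b h p = inj₂ (subst (0 <_) (h refl) p)
occurs-step {suc a} b h p = inj₁ (s≤s z≤n)

occurs-created : ∀ e {s} → 0 < #all (qbit s) (created e) → s ∈ fromMaybe e
occurs-created (just r) q = here (δ-pos q)

module _ {c M M' QV QV'} (inv : StepInvariant c M M' QV QV') where
  open StepInvariant inv

  fv-reduct : ∀ {x} → x ∈ fv M' → x ∈ fv M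
  fv-reduct {x} p with occurs-step _ (absent-kept (free x)) (fv⇒occurs M' p)
  ... | inj₁ q = occurs⇒fv M q
  ... | inj₂ q with () ← subst (0 <_) (#all-free-created x newQbit) q

  qvs-reduct : ∀ {s} → s ∈ qvs M' → s ∈ qvs M ⊎ s ∈ fromMaybe newQbit
  qvs-reduct {s} p with occurs-step _ (absent-kept (qbit s)) (qvs⇒occurs M' p)
  ... | inj₁ q = inj₁ (occurs⇒qvs M q)
  ... | inj₂ q = inj₂ (occurs-created newQbit q)

  ItemOK-reduct : ∀ Γ → All (ItemOK (profileOf M)) Γ → (∀ {s} → s ∈ qvars Γ → #lin (qbit s) (created newQbit) ≡ 0) →
                  All (ItemOK (profileOf M')) Γ
  ItemOK-reduct Γ ls fresh = All-ItemOK-transport-lin (profileOf M) (profileOf M') Γ ls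
    (λ {x} p → kept (free x) (ItemOK⇒LinearIn (profileOf M) Γ ls p) (#all≡0⇒#lin≡0 (free x) (created newQbit) (#all-free-created x newQbit)))
    (λ {s} p → kept (qbit s) (ItemOK⇒qbit-linear (profileOf M) Γ ls p) (fresh p))
    where
    kept : ∀ t → #lin t M ≡ 1 × #bang t M ≡ 0 → #lin t (created newQbit) ≡ 0 → SameAt (profileOf M) (profileOf M') t
    kept t (_ , b) z = trans (proj₁ (linear-kept t b)) (trans (cong (#lin t M +_) z) (+-identityʳ _)) , trans (proj₂ (linear-kept t b)) (sym b)

⊨-step : ∀ (D : QData) {Γ Q QV Q' QV' M M'} → Γ ⊨ M → (∀ {r} → r ∈ qvars Γ → r ∈ QV) →
  Step D ⟦ Q , QV , M ⟧ ⟦ Q' , QV' , M' ⟧ →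
  ∃ λ L → QV' ≡ L ++ QV × All (λ r → ¬ r ∈ QV) L × (map qv L ++ Γ) ⊨ M'
⊨-step D {Γ} {M = M} {M'} ((e , f , q , ls) , w) declared s with step-invariant D s [] w
... | inv@(stepInvariant nothing refl [] w' _ _) =
  [] , refl , [] , (e , (λ p → f (fv-reduct inv p)) , qvs' , ItemOK-reduct inv Γ ls (λ _ → refl)) , w'
  where
  qvs' : ∀ {s} → s ∈ qvs M' → s ∈ qvars Γ
  qvs' p with qvs-reduct inv p
  ... | inj₁ p' = q p'
... | inv@(stepInvariant (just r) refl (r∉QV ∷ []) w' lin-kept _) =
  r ∷ [] , refl , r∉QV ∷ [] ,
  ((proj₁ e , AllM.tabulate r≢ ∷ proj₂ e) , (λ p → f (fv-reduct inv p)) , qvs' ,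
   new-linear ∷ ItemOK-reduct inv Γ ls (λ p → δ-≢ (r≢ p ∘ sym))) , w'
  where
  r≢ : ∀ {s} → s ∈ qvars Γ → r ≢ s
  r≢ p refl = r∉QV (declared p)
  qvs' : ∀ {s} → s ∈ qvs M' → s ∈ r ∷ qvars Γ
  qvs' p with qvs-reduct inv p
  ... | inj₁ p' = there (q p')
  ... | inj₂ (here refl) = here refl
  r-absent : #all (qbit r) M ≡ 0
  r-absent = ∉qvs⇒#all≡0 M (λ p → r∉QV (declared (q p)))
  new-linear : ItemOK (profileOf M') (qv r)
  new-linear = trans (proj₁ (lin-kept (qbit r) (#all≡0⇒#bang≡0 (qbit r) M r-absent)))
                     (cong₂ _+_ (#all≡0⇒#lin≡0 (qbit r) M r-absent) (δ-refl r)) ,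
               proj₂ (lin-kept (qbit r) (#all≡0⇒#bang≡0 (qbit r) M r-absent))

qvars-map-qv : ∀ L Γ → qvars (map qv L ++ Γ) ≡ L ++ qvars Γ
qvars-map-qv [] Γ = refl
qvars-map-qv (r ∷ L) Γ = cong (r ∷_) (qvars-map-qv L Γ)

declared-++ : ∀ {Γ QV} L → (∀ {r} → r ∈ qvars Γ → r ∈ QV) → ∀ {r} → r ∈ qvars (map qv L ++ Γ) → r ∈ L ++ QV
declared-++ {Γ} L declared p with MP.∈-++⁻ L (subst (_ ∈_) (qvars-map-qv L Γ) p)
... | inj₁ p' = MP.∈-++⁺ˡ p'
... | inj₂ p' = MP.∈-++⁺ʳ L (declared p')

⊨-steps : ∀ (D : QData) {Γ Q QV M Q' QV' M'} → Star (_⟶_ D) ⟦ Q , QV , M ⟧ ⟦ Q' , QV' , M' ⟧ → Γ ⊨ M →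
  (∀ {r} → r ∈ qvars Γ → r ∈ QV) →
  ∃ λ L → QV' ≡ L ++ QV × All (λ r → ¬ r ∈ QV) L × (map qv L ++ Γ) ⊨ M'
⊨-steps D ε ⊨M declared = [] , refl , [] , ⊨M
⊨-steps D {Γ} {QV = QV} {M' = M'} ((_ , s) ◅ rest) ⊨M declared
  with L₁ , refl , fresh₁ , ⊨M₁ ← ⊨-step D ⊨M declared s
  with L₂ , refl , fresh₂ , ⊨M' ← ⊨-steps D rest ⊨M₁ (declared-++ L₁ declared)
  = L₂ ++ L₁ , sym (++-assoc L₂ L₁ QV) ,
    AllP.++⁺ (AllM.map (λ r∉ r∈ → r∉ (MP.∈-++⁺ʳ L₁ r∈)) fresh₂) fresh₁ ,
    subst (_⊨ M') (sym (trans (cong (_++ Γ) (LP.map-++ qv L₂ L₁)) (++-assoc (map qv L₂) (map qv L₁) Γ))) ⊨M'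

-- Completeness of the characterisation

-- For fresh x', M is the contraction of M₁ at x and x'; this takes apart a !x used several times.
mutual
  data RenameOne (x x' : ℕ) : Term → Term → Set where
    rename-fvar : RenameOne x x' (fvar x) (fvar x')
    rename-bang : ∀ {M M₁} → RenameOne x x' M M₁ → RenameOne x x' (bang M) (bang M₁)
    rename-new : ∀ {M M₁} → RenameOne x x' M M₁ → RenameOne x x' (new M) (new M₁)
    rename-appˡ : ∀ {M M₁ N} → RenameOne x x' M M₁ → RenameOne x x' (app M N) (app M₁ N)
    rename-appʳ : ∀ {M N N₁} → RenameOne x x' N N₁ → RenameOne x x' (app M N) (app M N₁)
    rename-tup₁ : ∀ {M M₁ N Ms} → RenameOne x x' M M₁ → RenameOne x x' (tup M N Ms) (tup M₁ N Ms)
    rename-tup₂ : ∀ {M N N₁ Ms} → RenameOne x x' N N₁ → RenameOne x x' (tup M N Ms) (tup M N₁ Ms)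
    rename-tupₙ : ∀ {M N Ms Ms₁} → RenameOnes x x' Ms Ms₁ → RenameOne x x' (tup M N Ms) (tup M N Ms₁)
    rename-lamBang : ∀ {M M₁} → RenameOne x x' M M₁ → RenameOne x x' (lamBang M) (lamBang M₁)
    rename-lamPat : ∀ {M M₁} p → RenameOne x x' M M₁ → RenameOne x x' (lamPat p M) (lamPat p M₁)

  data RenameOnes (x x' : ℕ) : List Term → List Term → Set where
    rename-head : ∀ {M M₁ Ms} → RenameOne x x' M M₁ → RenameOnes x x' (M ∷ Ms) (M₁ ∷ Ms)
    rename-tail : ∀ {M Ms Ms₁} → RenameOnes x x' Ms Ms₁ → RenameOnes x x' (M ∷ Ms) (M ∷ Ms₁)

mutual
  RenameOne-exists : ∀ x x' M → 0 < #all (free x) M → ∃ λ M₁ → RenameOne x x' M M₁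
  RenameOne-exists x x' (fvar y) p with δ-pos {x} {y} p
  ... | refl = fvar x' , rename-fvar
  RenameOne-exists x x' (bvar i j) ()
  RenameOne-exists x x' (qvar r) ()
  RenameOne-exists x x' (bang M) p with RenameOne-exists x x' M p
  ... | M₁ , r = bang M₁ , rename-bang r
  RenameOne-exists x x' czero ()
  RenameOne-exists x x' cone ()
  RenameOne-exists x x' (cU i) ()
  RenameOne-exists x x' (new M) p with RenameOne-exists x x' M p
  ... | M₁ , r = new M₁ , rename-new r
  RenameOne-exists x x' (app M N) p with +-pos⁻ (#all (free x) M) _ p
  ... | inj₁ q with RenameOne-exists x x' M q
  ... | M₁ , r = app M₁ N , rename-appˡ r
  RenameOne-exists x x' (app M N) p | inj₂ q with RenameOne-exists x x' N q
  ... | N₁ , r = app M N₁ , rename-appʳ r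
  RenameOne-exists x x' (tup M N Ms) p with +-pos⁻ (#all (free x) M) _ p
  ... | inj₁ q with RenameOne-exists x x' M q
  ... | M₁ , r = tup M₁ N Ms , rename-tup₁ r
  RenameOne-exists x x' (tup M N Ms) p | inj₂ q with +-pos⁻ (#all (free x) N) _ q
  ... | inj₁ q' with RenameOne-exists x x' N q'
  ... | N₁ , r = tup M N₁ Ms , rename-tup₂ r
  RenameOne-exists x x' (tup M N Ms) p | inj₂ q | inj₂ q' with RenameOnes-exists x x' Ms q'
  ... | Ms₁ , r = tup M N Ms₁ , rename-tupₙ r
  RenameOne-exists x x' (lamBang M) p with RenameOne-exists x x' M p
  ... | M₁ , r = lamBang M₁ , rename-lamBang r
  RenameOne-exists x x' (lamPat q M) p with RenameOne-exists x x' M p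
  ... | M₁ , r = lamPat q M₁ , rename-lamPat q r

  RenameOnes-exists : ∀ x x' Ms → 0 < #alls (free x) Ms → ∃ λ Ms₁ → RenameOnes x x' Ms Ms₁
  RenameOnes-exists x x' [] ()
  RenameOnes-exists x x' (M ∷ Ms) p with +-pos⁻ (#all (free x) M) _ p
  ... | inj₁ q with RenameOne-exists x x' M q
  ... | M₁ , r = M₁ ∷ Ms , rename-head r
  RenameOnes-exists x x' (M ∷ Ms) p | inj₂ q with RenameOnes-exists x x' Ms q
  ... | Ms₁ , r = M ∷ Ms₁ , rename-tail r

mutual
  RenameOne⇒SameShape : ∀ {x x' M M₁} → RenameOne x x' M M₁ → SameShape M M₁
  RenameOne⇒SameShape rename-fvar = ~fvar _ _
  RenameOne⇒SameShape (rename-bang r) = ~bang (RenameOne⇒SameShape r)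
  RenameOne⇒SameShape (rename-new r) = ~new (RenameOne⇒SameShape r)
  RenameOne⇒SameShape (rename-appˡ {N = N} r) = ~app (RenameOne⇒SameShape r) (SameShape-refl N)
  RenameOne⇒SameShape (rename-appʳ {M = M} r) = ~app (SameShape-refl M) (RenameOne⇒SameShape r)
  RenameOne⇒SameShape (rename-tup₁ {N = N} {Ms} r) = ~tup (RenameOne⇒SameShape r) (SameShape-refl N) (SameShapes-refl Ms)
  RenameOne⇒SameShape (rename-tup₂ {M = M} {Ms = Ms} r) = ~tup (SameShape-refl M) (RenameOne⇒SameShape r) (SameShapes-refl Ms)
  RenameOne⇒SameShape (rename-tupₙ {M = M} {N} r) = ~tup (SameShape-refl M) (SameShape-refl N) (RenameOnes⇒SameShapes r)
  RenameOne⇒SameShape (rename-lamBang r) = ~lamBang (RenameOne⇒SameShape r)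
  RenameOne⇒SameShape (rename-lamPat p r) = ~lamPat p (RenameOne⇒SameShape r)

  RenameOnes⇒SameShapes : ∀ {x x' Ms Ms₁} → RenameOnes x x' Ms Ms₁ → SameShapes Ms Ms₁
  RenameOnes⇒SameShapes (rename-head {Ms = Ms} r) = RenameOne⇒SameShape r ∷ SameShapes-refl Ms
  RenameOnes⇒SameShapes (rename-tail {M = M} r) = SameShape-refl M ∷ RenameOnes⇒SameShapes r

mutual
  RenameOne-occ-other : ∀ {x x' M M₁} → RenameOne x x' M M₁ → ∀ m w → w ≢ x → w ≢ x' → occ m (free w) M₁ ≡ occ m (free w) M
  RenameOne-occ-other rename-fvar m w n1 n2 rewrite δ-≢ n1 | δ-≢ n2 = refl
  RenameOne-occ-other (rename-bang r) linear w n1 n2 = refl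
  RenameOne-occ-other (rename-bang r) banged w n1 n2 = cong₂ _+_ (RenameOne-occ-other r linear w n1 n2) (RenameOne-occ-other r banged w n1 n2)
  RenameOne-occ-other (rename-bang r) total w n1 n2 = RenameOne-occ-other r total w n1 n2
  RenameOne-occ-other (rename-new r) m w n1 n2 = RenameOne-occ-other r m w n1 n2
  RenameOne-occ-other (rename-appˡ r) m w n1 n2 = cong (_+ _) (RenameOne-occ-other r m w n1 n2)
  RenameOne-occ-other (rename-appʳ {M = M} r) m w n1 n2 = cong (occ m (free w) M +_) (RenameOne-occ-other r m w n1 n2)
  RenameOne-occ-other (rename-tup₁ r) m w n1 n2 = cong (_+ _) (RenameOne-occ-other r m w n1 n2)
  RenameOne-occ-other (rename-tup₂ {M = M} {Ms = Ms} r) m w n1 n2 = cong (λ z → occ m (free w) M + (z + occs m (free w) Ms)) (RenameOne-occ-other r m w n1 n2)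
  RenameOne-occ-other (rename-tupₙ {M = M} {N} r) m w n1 n2 = cong (λ z → occ m (free w) M + (occ m (free w) N + z)) (RenameOnes-occs-other r m w n1 n2)
  RenameOne-occ-other (rename-lamBang r) m w n1 n2 = RenameOne-occ-other r m w n1 n2
  RenameOne-occ-other (rename-lamPat p r) m w n1 n2 = RenameOne-occ-other r m w n1 n2

  RenameOnes-occs-other : ∀ {x x' Ms Ms₁} → RenameOnes x x' Ms Ms₁ → ∀ m w → w ≢ x → w ≢ x' → occs m (free w) Ms₁ ≡ occs m (free w) Ms
  RenameOnes-occs-other (rename-head r) m w n1 n2 = cong (_+ _) (RenameOne-occ-other r m w n1 n2)
  RenameOnes-occs-other (rename-tail {M = M} r) m w n1 n2 = cong (occ m (free w) M +_) (RenameOnes-occs-other r m w n1 n2)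

mutual
  RenameOne-#all-old : ∀ {x x' M M₁} → x ≢ x' → RenameOne x x' M M₁ → #all (free x) M ≡ suc (#all (free x) M₁)
  RenameOne-#all-old {x} n rename-fvar rewrite δ-refl x | δ-≢ n = refl
  RenameOne-#all-old n (rename-bang r) = RenameOne-#all-old n r
  RenameOne-#all-old n (rename-new r) = RenameOne-#all-old n r
  RenameOne-#all-old n (rename-appˡ r) = cong (_+ _) (RenameOne-#all-old n r)
  RenameOne-#all-old {x} n (rename-appʳ {M = M} {N₁ = N₁} r) = trans (cong (#all (free x) M +_) (RenameOne-#all-old n r)) (+-suc _ (#all (free x) N₁))
  RenameOne-#all-old n (rename-tup₁ r) = cong (_+ _) (RenameOne-#all-old n r)
  RenameOne-#all-old {x} n (rename-tup₂ {M = M} {N₁ = N₁} {Ms} r) = trans (cong (λ z → #all (free x) M + (z + #alls (free x) Ms)) (RenameOne-#all-old n r)) (+-suc _ _)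
  RenameOne-#all-old {x} n (rename-tupₙ {M = M} {N} {Ms₁ = Ms₁} r) = trans (cong (λ z → #all (free x) M + (#all (free x) N + z)) (RenameOnes-#alls-old n r))
    (trans (cong (#all (free x) M +_) (+-suc _ _)) (+-suc _ _))
  RenameOne-#all-old n (rename-lamBang r) = RenameOne-#all-old n r
  RenameOne-#all-old n (rename-lamPat p r) = RenameOne-#all-old n r

  RenameOnes-#alls-old : ∀ {x x' Ms Ms₁} → x ≢ x' → RenameOnes x x' Ms Ms₁ → #alls (free x) Ms ≡ suc (#alls (free x) Ms₁)
  RenameOnes-#alls-old n (rename-head r) = cong (_+ _) (RenameOne-#all-old n r)
  RenameOnes-#alls-old {x} n (rename-tail {M = M} r) = trans (cong (#all (free x) M +_) (RenameOnes-#alls-old n r)) (+-suc _ _)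

mutual
  RenameOne-#all-new : ∀ {x x' M M₁} → x ≢ x' → RenameOne x x' M M₁ → #all (free x') M₁ ≡ suc (#all (free x') M)
  RenameOne-#all-new {x} {x'} n rename-fvar rewrite δ-refl x' | δ-≢ {x'} {x} (λ e → n (sym e)) = refl
  RenameOne-#all-new n (rename-bang r) = RenameOne-#all-new n r
  RenameOne-#all-new n (rename-new r) = RenameOne-#all-new n r
  RenameOne-#all-new n (rename-appˡ r) = cong (_+ _) (RenameOne-#all-new n r)
  RenameOne-#all-new {x' = x'} n (rename-appʳ {M = M} {N = N} r) = trans (cong (#all (free x') M +_) (RenameOne-#all-new n r)) (+-suc _ (#all (free x') N))
  RenameOne-#all-new n (rename-tup₁ r) = cong (_+ _) (RenameOne-#all-new n r)
  RenameOne-#all-new {x' = x'} n (rename-tup₂ {M = M} {Ms = Ms} r) = trans (cong (λ z → #all (free x') M + (z + #alls (free x') Ms)) (RenameOne-#all-new n r)) (+-suc _ _)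
  RenameOne-#all-new {x' = x'} n (rename-tupₙ {M = M} {N} r) = trans (cong (λ z → #all (free x') M + (#all (free x') N + z)) (RenameOnes-#alls-new n r))
    (trans (cong (#all (free x') M +_) (+-suc _ _)) (+-suc _ _))
  RenameOne-#all-new n (rename-lamBang r) = RenameOne-#all-new n r
  RenameOne-#all-new n (rename-lamPat p r) = RenameOne-#all-new n r

  RenameOnes-#alls-new : ∀ {x x' Ms Ms₁} → x ≢ x' → RenameOnes x x' Ms Ms₁ → #alls (free x') Ms₁ ≡ suc (#alls (free x') Ms)
  RenameOnes-#alls-new n (rename-head r) = cong (_+ _) (RenameOne-#all-new n r)
  RenameOnes-#alls-new {x' = x'} n (rename-tail {M = M} r) = trans (cong (#all (free x') M +_) (RenameOnes-#alls-new n r)) (+-suc _ _)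

mutual
  RenameOne-contrRen : ∀ {x x' M M₁} → RenameOne x x' M M₁ → renameF (contrRen x x' x) M₁ ≡ renameF (contrRen x x' x) M
  RenameOne-contrRen {x} {x'} rename-fvar = cong fvar (trans (contrRen-merged x x' x x' (inj₂ refl)) (sym (contrRen-merged x x' x x (inj₁ refl))))
  RenameOne-contrRen (rename-bang r) = cong bang (RenameOne-contrRen r)
  RenameOne-contrRen (rename-new r) = cong new (RenameOne-contrRen r)
  RenameOne-contrRen (rename-appˡ r) = cong (λ z → app z _) (RenameOne-contrRen r)
  RenameOne-contrRen (rename-appʳ r) = cong (app _) (RenameOne-contrRen r)
  RenameOne-contrRen (rename-tup₁ r) = cong (λ z → tup z _ _) (RenameOne-contrRen r)
  RenameOne-contrRen (rename-tup₂ r) = cong (λ z → tup _ z _) (RenameOne-contrRen r)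
  RenameOne-contrRen (rename-tupₙ r) = cong (tup _ _) (RenameOnes-contrRen r)
  RenameOne-contrRen (rename-lamBang r) = cong lamBang (RenameOne-contrRen r)
  RenameOne-contrRen (rename-lamPat p r) = cong (lamPat p) (RenameOne-contrRen r)

  RenameOnes-contrRen : ∀ {x x' Ms Ms₁} → RenameOnes x x' Ms Ms₁ → renameFs (contrRen x x' x) Ms₁ ≡ renameFs (contrRen x x' x) Ms
  RenameOnes-contrRen (rename-head r) = cong (_∷ _) (RenameOne-contrRen r)
  RenameOnes-contrRen (rename-tail r) = cong (_ ∷_) (RenameOnes-contrRen r)

maxℕ : List ℕ → ℕ
maxℕ [] = 0
maxℕ (a ∷ l) = a ⊔ maxℕ l

≤maxℕ : ∀ {a} l → a ∈ l → a ≤ maxℕ l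
≤maxℕ (b ∷ l) (here refl) = m≤m⊔n b (maxℕ l)
≤maxℕ (b ∷ l) (there p) = ≤-trans (≤maxℕ l p) (m≤n⊔m b (maxℕ l))

fresh : List ℕ → ℕ
fresh l = suc (maxℕ l)

fresh∉ : ∀ l → ¬ (fresh l ∈ l)
fresh∉ l p = <-irrefl refl (≤maxℕ l p)

<fresh : ∀ l {a} → a ∈ l → a < fresh l
<fresh l p = s≤s (≤maxℕ l p)

range : ℕ → ℕ → List ℕ
range f zero = []
range f (suc k) = f ∷ range (suc f) k

range-length : ∀ f k → length (range f k) ≡ k
range-length f zero = refl
range-length f (suc k) = cong suc (range-length (suc f) k)

range-≥ : ∀ f k {a} → a ∈ range f k → f ≤ a
range-≥ f (suc k) (here refl) = ≤-refl
range-≥ f (suc k) (there p) = ≤-trans (n≤1+n f) (range-≥ (suc f) k p)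

range-Unique : ∀ f k → Unique (range f k)
range-Unique f zero = []
range-Unique f (suc k) = AllM.tabulate (λ p e → <-irrefl e (range-≥ (suc f) k p)) ∷ range-Unique (suc f) k

distFrom1 : ℕ → ℕ
distFrom1 zero = 1
distFrom1 (suc a) = a

-- The items that no syntax-directed rule can consume have positive cost: patterns, and !x unless
-- x occurs exactly once (distFrom1 a = |a - 1|).
cost : Profile → Item → ℕ
cost P (lin x) = 0
cost P (tupP x y xs) = 1
cost P (bangI x) = distFrom1 (pAll P (free x))
cost P (qv r) = 0

μ : Profile → Env → ℕ
μ P [] = 0
μ P (it ∷ Γ) = cost P it + μ P Γ

μ-++ : ∀ P Γ Δ → μ P (Γ ++ Δ) ≡ μ P Γ + μ P Δ
μ-++ P [] Δ = refl
μ-++ P (it ∷ Γ) Δ rewrite μ-++ P Γ Δ = sym (+-assoc (cost P it) (μ P Γ) (μ P Δ))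

μ≡0⇒cost≡0 : ∀ P Γ → μ P Γ ≡ 0 → All (λ it → cost P it ≡ 0) Γ
μ≡0⇒cost≡0 P [] e = []
μ≡0⇒cost≡0 P (it ∷ Γ) e = m+n≡0⇒m≡0 (cost P it) e ∷ μ≡0⇒cost≡0 P Γ (m+n≡0⇒n≡0 (cost P it) e)

positive-cost-item : ∀ P Γ → 0 < μ P Γ → Σ Env λ pre → Σ Item λ it → Σ Env λ post → Γ ≡ pre ++ it ∷ post × 0 < cost P it
positive-cost-item P (it ∷ Γ) p with +-pos⁻ (cost P it) _ p
... | inj₁ q = [] , it , Γ , refl , q
... | inj₂ q with positive-cost-item P Γ q
... | pre , it' , post , refl , c = it ∷ pre , it' , post , refl , c

μ-cong : ∀ P P' Γ → (∀ {x} → x ∈ cvars Γ → pAll P (free x) ≡ pAll P' (free x)) → μ P Γ ≡ μ P' Γ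
μ-cong P P' [] h = refl
μ-cong P P' (lin x ∷ Γ) h = μ-cong P P' Γ (λ p → h (there p))
μ-cong P P' (tupP x y xs ∷ Γ) h = cong suc (μ-cong P P' Γ (λ p → h (MP.∈-++⁺ʳ (x ∷ y ∷ xs) p)))
μ-cong P P' (bangI x ∷ Γ) h = cong₂ _+_ (cong distFrom1 (h (here refl))) (μ-cong P P' Γ (λ p → h (there p)))
μ-cong P P' (qv r ∷ Γ) h = μ-cong P P' Γ h

GoesLeft : Profile → Item → Set
GoesLeft P (lin x) = x ∈ pFree P
GoesLeft P (tupP x y xs) = ⊥
GoesLeft P (bangI x) = x ∈ pFree P
GoesLeft P (qv r) = r ∈ pQbits P

goesLeft? : ∀ P it → Dec (GoesLeft P it)
goesLeft? P (lin x) = x ∈? pFree P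
goesLeft? P (tupP x y xs) = no (λ ())
goesLeft? P (bangI x) = x ∈? pFree P
goesLeft? P (qv r) = r ∈? pQbits P

filter-partition-↭ : ∀ {R : Item → Set} (R? : ∀ it → Dec (R it)) Γ → Γ ↭ filter R? Γ ++ filter (λ it → ¬? (R? it)) Γ
filter-partition-↭ R? [] = Perm.refl
filter-partition-↭ R? (it ∷ Γ) with R? it
... | yes r = prep it (filter-partition-↭ R? Γ)
... | no r = Perm.trans (prep it (filter-partition-↭ R? Γ)) (↭-sym (PP.shift it (filter R? Γ) _))

All-filter : ∀ {R B : Item → Set} (R? : ∀ it → Dec (R it)) Γ → All (λ it → R it → B it) Γ → All B (filter R? Γ)
All-filter R? Γ hs = AllM.zipWith (λ (h , r) → h r) (AllP.filter⁺ R? hs , AllP.all-filter R? Γ)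

∈-concatMap-filter : ∀ (g : Item → List ℕ) {R : Item → Set} (R? : ∀ it → Dec (R it)) Γ {x} → x ∈ concat (map g Γ) →
      All (λ it → x ∈ g it → R it) Γ → x ∈ concat (map g (filter R? Γ))
∈-concatMap-filter g R? (it ∷ Γ) p (h ∷ hs) with MP.∈-++⁻ (g it) p | R? it
... | inj₁ q | yes r = MP.∈-++⁺ˡ q
... | inj₁ q | no r = ⊥-elim (r (h q))
... | inj₂ q | yes r = MP.∈-++⁺ʳ (g it) (∈-concatMap-filter g R? Γ q hs)
... | inj₂ q | no r = ∈-concatMap-filter g R? Γ q hs

+≡1-split : ∀ a b → a + b ≡ 1 → 0 < a → a ≡ 1 × b ≡ 0
+≡1-split (suc zero) zero e p = refl , refl
+≡1-split (suc zero) (suc b) () p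
+≡1-split (suc (suc a)) b () p

+≡1⇒¬both-pos : ∀ a b → a + b ≡ 1 → 0 < a → 0 < b → ⊥
+≡1⇒¬both-pos a b e p q with +≡1-split a b e p
... | _ , refl with q
... | ()

distFrom1≡0⇒≡1 : ∀ a → distFrom1 a ≡ 0 → a ≡ 1
distFrom1≡0⇒≡1 (suc zero) e = refl

SplitFacts : Profile → Profile → Item → Set
SplitFacts P Q it = (GoesLeft P it → ItemOK P it × cost P it ≡ 0) × (¬ GoesLeft P it → ItemOK Q it × cost Q it ≡ 0) ×
  (∀ {x} → x ∈ cnames it → x ∈ pFree P → GoesLeft P it) × (∀ {x} → x ∈ cnames it → x ∈ pFree Q → ¬ GoesLeft P it) ×
  (∀ {r} → r ∈ qnames it → r ∈ pQbits P → GoesLeft P it) × (∀ {r} → r ∈ qnames it → r ∈ pQbits Q → ¬ GoesLeft P it)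

split-lin : ∀ P Q → Coherent P → Coherent Q → ∀ x → ItemOK (P ⊕ Q) (lin x) → SplitFacts P Q (lin x)
split-lin P Q cP@(p1 , _) (q1 , _) x (eN , eB) =
  f1 , f2 , (λ { (here refl) r → r }) , (λ { (here refl) r s → +≡1⇒¬both-pos (pAll P (free x)) (pAll Q (free x)) tot (p1 s) (q1 r) }) , (λ ()) , (λ ())
  where
  bP : pBang P (free x) ≡ 0
  bP = m+n≡0⇒m≡0 (pBang P (free x)) eB
  bQ : pBang Q (free x) ≡ 0
  bQ = m+n≡0⇒n≡0 (pBang P (free x)) eB
  tot : pAll P (free x) + pAll Q (free x) ≡ 1
  tot = trans (sym (pAll-⊕ P Q (free x))) (cong₂ _+_ eN eB)
  f1 : GoesLeft P (lin x) → ItemOK P (lin x) × cost P (lin x) ≡ 0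
  f1 r with +≡1-split (pLin P (free x)) _ eN (subst (0 <_) (trans (cong (pLin P (free x) +_) bP) (+-identityʳ _)) (p1 r))
  ... | a , _ = (a , bP) , refl
  f2 : ¬ GoesLeft P (lin x) → ItemOK Q (lin x) × cost Q (lin x) ≡ 0
  f2 r with absentFree P cP r
  ... | z1 , _ = (trans (sym (cong (_+ pLin Q (free x)) z1)) eN , bQ) , refl

split-bang : ∀ P Q → Coherent P → Coherent Q → ∀ x → cost (P ⊕ Q) (bangI x) ≡ 0 → SplitFacts P Q (bangI x)
split-bang P Q cP@(p1 , _) (q1 , _) x c =
  f1 , f2 , (λ { (here refl) r → r }) , (λ { (here refl) r s → +≡1⇒¬both-pos (pAll P (free x)) (pAll Q (free x)) tot (p1 s) (q1 r) }) , (λ ()) , (λ ())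
  where
  tot : pAll P (free x) + pAll Q (free x) ≡ 1
  tot = trans (sym (pAll-⊕ P Q (free x))) (distFrom1≡0⇒≡1 _ c)
  f1 : GoesLeft P (bangI x) → ItemOK P (bangI x) × cost P (bangI x) ≡ 0
  f1 r with +≡1-split (pAll P (free x)) _ tot (p1 r)
  ... | a , _ = tt , cong distFrom1 a
  f2 : ¬ GoesLeft P (bangI x) → ItemOK Q (bangI x) × cost Q (bangI x) ≡ 0
  f2 r with absentFree P cP r
  ... | z1 , z2 = tt , cong distFrom1 (trans (sym (cong (_+ pAll Q (free x)) (cong₂ _+_ z1 z2))) tot)

split-qbit : ∀ P Q → Coherent P → Coherent Q → ∀ x → ItemOK (P ⊕ Q) (qv x) → SplitFacts P Q (qv x)
split-qbit P Q cP@(_ , _ , p3 , _) (_ , _ , q3 , _) x (eN , eB) =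
  f1 , f2 , (λ ()) , (λ ()) , (λ { (here refl) r → r }) , (λ { (here refl) r s → +≡1⇒¬both-pos (pAll P (qbit x)) (pAll Q (qbit x)) tot (p3 s) (q3 r) })
  where
  bP : pBang P (qbit x) ≡ 0
  bP = m+n≡0⇒m≡0 (pBang P (qbit x)) eB
  bQ : pBang Q (qbit x) ≡ 0
  bQ = m+n≡0⇒n≡0 (pBang P (qbit x)) eB
  tot : pAll P (qbit x) + pAll Q (qbit x) ≡ 1
  tot = trans (sym (pAll-⊕ P Q (qbit x))) (cong₂ _+_ eN eB)
  f1 : GoesLeft P (qv x) → ItemOK P (qv x) × cost P (qv x) ≡ 0
  f1 r with +≡1-split (pLin P (qbit x)) _ eN (subst (0 <_) (trans (cong (pLin P (qbit x) +_) bP) (+-identityʳ _)) (p3 r))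
  ... | a , _ = (a , bP) , refl
  f2 : ¬ GoesLeft P (qv x) → ItemOK Q (qv x) × cost Q (qv x) ≡ 0
  f2 r with absentQbit P cP r
  ... | z1 , _ = (trans (sym (cong (_+ pLin Q (qbit x)) z1)) eN , bQ) , refl

split-item : ∀ P Q → Coherent P → Coherent Q → ∀ it → ItemOK (P ⊕ Q) it → cost (P ⊕ Q) it ≡ 0 → SplitFacts P Q it
split-item P Q cP cQ (lin x) ok _ = split-lin P Q cP cQ x ok
split-item P Q cP cQ (tupP x y xs) ok ()
split-item P Q cP cQ (bangI x) _ c = split-bang P Q cP cQ x c
split-item P Q cP cQ (qv x) ok _ = split-qbit P Q cP cQ x ok

Fits-split : ∀ Γ P Q → Fits Γ (P ⊕ Q) → Coherent P → Coherent Q → All (λ it → cost (P ⊕ Q) it ≡ 0) Γ →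
   Σ Env λ Γ₁ → Σ Env λ Γ₂ → Γ ↭ Γ₁ ++ Γ₂ × (Fits Γ₁ P × All (λ it → cost P it ≡ 0) Γ₁) × (Fits Γ₂ Q × All (λ it → cost Q it ≡ 0) Γ₂)
Fits-split Γ P Q (e , f , q , ls) cP cQ cs =
  Γ₁ , Γ₂ , pm ,
  ((proj₁ ee , fv1 , qv1 , AllM.map proj₁ a1) , AllM.map proj₂ a1) ,
  ((proj₂ ee , fv2 , qv2 , AllM.map proj₁ a2) , AllM.map proj₂ a2)
  where
  Γ₁ Γ₂ : Env
  Γ₁ = filter (goesLeft? P) Γ
  Γ₂ = filter (λ it → ¬? (goesLeft? P it)) Γ
  pm : Γ ↭ Γ₁ ++ Γ₂
  pm = filter-partition-↭ (goesLeft? P) Γ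
  ee : IsEnv Γ₁ × IsEnv Γ₂
  ee = IsEnv-++⁻ Γ₁ Γ₂ (IsEnv-↭ pm e)
  an : All (SplitFacts P Q) Γ
  an = AllM.zipWith (λ {it} (l , c) → split-item P Q cP cQ it l c) (ls , cs)
  a1 : All (λ it → ItemOK P it × cost P it ≡ 0) Γ₁
  a1 = All-filter (goesLeft? P) Γ (AllM.map proj₁ an)
  a2 : All (λ it → ItemOK Q it × cost Q it ≡ 0) Γ₂
  a2 = All-filter (λ it → ¬? (goesLeft? P it)) Γ (AllM.map (λ fs → proj₁ (proj₂ fs)) an)
  fv1 : ∀ {x} → x ∈ pFree P → x ∈ cvars Γ₁
  fv1 {x} p = ∈-concatMap-filter cnames (goesLeft? P) Γ (f (MP.∈-++⁺ˡ p)) (AllM.map (λ fs xin → proj₁ (proj₂ (proj₂ fs)) xin p) an)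
  fv2 : ∀ {x} → x ∈ pFree Q → x ∈ cvars Γ₂
  fv2 {x} p = ∈-concatMap-filter cnames (λ it → ¬? (goesLeft? P it)) Γ (f (MP.∈-++⁺ʳ (pFree P) p)) (AllM.map (λ fs xin → proj₁ (proj₂ (proj₂ (proj₂ fs))) xin p) an)
  qv1 : ∀ {x} → x ∈ pQbits P → x ∈ qvars Γ₁
  qv1 {x} p = ∈-concatMap-filter qnames (goesLeft? P) Γ (q (MP.∈-++⁺ˡ p)) (AllM.map (λ fs xin → proj₁ (proj₂ (proj₂ (proj₂ (proj₂ fs)))) xin p) an)
  qv2 : ∀ {x} → x ∈ pQbits Q → x ∈ qvars Γ₂
  qv2 {x} p = ∈-concatMap-filter qnames (λ it → ¬? (goesLeft? P it)) Γ (q (MP.∈-++⁺ʳ (pQbits P) p)) (AllM.map (λ fs xin → proj₂ (proj₂ (proj₂ (proj₂ (proj₂ fs)))) xin p) an)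

All-from-lookupℕ : ∀ {P : ℕ → Set} zs → (∀ j → j < length zs → P (lookupℕ zs j)) → All P zs
All-from-lookupℕ [] h = []
All-from-lookupℕ (z ∷ zs) h = h 0 (s≤s z≤n) ∷ All-from-lookupℕ zs (λ j p → h (suc j) (s≤s p))

All-WellBound-fvars : ∀ c zs → All (WellBound c) (map fvar zs)
All-WellBound-fvars c [] = []
All-WellBound-fvars c (z ∷ zs) = tt ∷ All-WellBound-fvars c zs

Fits-lamPat⁻ : ∀ Γ p A → Fits Γ (profileOf (lamPat p A)) → Fits Γ (profileOf A)
Fits-lamPat⁻ Γ p A (e , f , q , l) = e , f , q , All-ItemOK-transport (profileOf (lamPat p A)) (profileOf A) Γ l (λ _ → refl , refl) (λ _ → refl , refl)

Fits-lamBang⁻ : ∀ Γ A → Fits Γ (profileOf (lamBang A)) → Fits Γ (profileOf A)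
Fits-lamBang⁻ Γ A (e , f , q , l) = e , f , q , All-ItemOK-transport (profileOf (lamBang A)) (profileOf A) Γ l (λ _ → refl , refl) (λ _ → refl , refl)

lookupT-fvars : ∀ zs j (d : Term) → lookupT (map fvar zs) j d ≡ d ⊎ ∃ λ y → lookupT (map fvar zs) j d ≡ fvar y
lookupT-fvars [] j d = inj₁ refl
lookupT-fvars (z ∷ zs) zero d = inj₂ (z , refl)
lookupT-fvars (z ∷ zs) (suc j) d = lookupT-fvars zs j d

mutual
  size-open : ∀ d zs A → size (substB d (map fvar zs) A) ≡ size A
  size-open d zs (fvar x) = refl
  size-open d zs (bvar i j) with i <ᵇ d
  ... | true = refl
  ... | false with i ≡ᵇ d
  ... | false = refl
  ... | true with lookupT-fvars zs j (bvar i j)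
  ... | inj₁ e rewrite e with i <ᵇ 0
  ... | true = refl
  ... | false = refl
  size-open d zs (bvar i j) | false | true | inj₂ (y , e) rewrite e = refl
  size-open d zs (qvar x) = refl
  size-open d zs (bang A) = cong suc (size-open d zs A)
  size-open d zs czero = refl
  size-open d zs cone = refl
  size-open d zs (cU x) = refl
  size-open d zs (new A) = cong suc (size-open d zs A)
  size-open d zs (app A B) = cong suc (cong₂ _+_ (size-open d zs A) (size-open d zs B))
  size-open d zs (tup A B As) = cong suc (cong₂ _+_ (size-open d zs A) (cong₂ _+_ (size-open d zs B) (sizes-open d zs As)))
  size-open d zs (lamBang A) = cong suc (size-open (suc d) zs A)
  size-open d zs (lamPat p A) = cong suc (size-open (suc d) zs A)

  sizes-open : ∀ d zs As → sizes (substBs d (map fvar zs) As) ≡ sizes As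
  sizes-open d zs [] = refl
  sizes-open d zs (A ∷ As) = cong₂ _+_ (size-open d zs A) (sizes-open d zs As)

zero-cost-empty : ∀ P Γ → All (ItemOK P) Γ → All (λ it → cost P it ≡ 0) Γ → (∀ x → pAll P (free x) ≡ 0) → (∀ r → pLin P (qbit r) ≡ 0) → Γ ≡ []
zero-cost-empty P [] _ _ _ _ = refl
zero-cost-empty P (lin x ∷ Γ) ((e1 , e2) ∷ _) _ hA hQ with trans (sym e1) (m+n≡0⇒m≡0 (pLin P (free x)) (hA x))
... | ()
zero-cost-empty P (tupP x y xs ∷ Γ) _ (() ∷ _) hA hQ
zero-cost-empty P (bangI x ∷ Γ) _ (c ∷ _) hA hQ with trans (sym (cong distFrom1 (hA x))) c
... | ()
zero-cost-empty P (qv r ∷ Γ) ((e1 , e2) ∷ _) _ hA hQ with trans (sym e1) (hQ r)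
... | ()

fvar-item : ∀ y it → ItemOK (profileOf (fvar y)) it → cost (profileOf (fvar y)) it ≡ 0 → it ≡ lin y ⊎ it ≡ bangI y
fvar-item y (lin w) (e1 , e2) c = inj₁ (cong lin (δ-pos {w} {y} (subst (0 <_) (sym e1) (s≤s z≤n))))
fvar-item y (tupP x z xs) l ()
fvar-item y (bangI w) l c = inj₂ (cong bangI (δ-pos {w} {y} (subst (0 <_) (sym (trans (sym (+-identityʳ _)) (distFrom1≡0⇒≡1 _ c))) (s≤s z≤n))))
fvar-item y (qv r) (() , e2) c

fvar-env : ∀ y Γ → Fits Γ (profileOf (fvar y)) → All (λ it → cost (profileOf (fvar y)) it ≡ 0) Γ → Γ ≡ lin y ∷ [] ⊎ Γ ≡ bangI y ∷ []
fvar-env y [] (e , f , q , l) cs with f (here refl)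
... | ()
fvar-env y (it ∷ []) (e , f , q , (l ∷ [])) (c ∷ []) with fvar-item y it l c
... | inj₁ refl = inj₁ refl
... | inj₂ refl = inj₂ refl
fvar-env y (it ∷ it₂ ∷ Γ) (e , f , q , (l ∷ l₂ ∷ _)) (c ∷ c₂ ∷ _) with fvar-item y it l c | fvar-item y it₂ l₂ c₂
... | inj₁ refl | inj₁ refl = ⊥-elim (Unique[x∷xs]⇒x∉xs (proj₁ e) (here refl))
... | inj₁ refl | inj₂ refl = ⊥-elim (Unique[x∷xs]⇒x∉xs (proj₁ e) (here refl))
... | inj₂ refl | inj₁ refl = ⊥-elim (Unique[x∷xs]⇒x∉xs (proj₁ e) (here refl))
... | inj₂ refl | inj₂ refl = ⊥-elim (Unique[x∷xs]⇒x∉xs (proj₁ e) (here refl))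

qvar-item : ∀ r it → ItemOK (profileOf (qvar r)) it → cost (profileOf (qvar r)) it ≡ 0 → it ≡ qv r
qvar-item r (lin w) (() , e2) c
qvar-item r (tupP x z xs) l ()
qvar-item r (bangI w) l ()
qvar-item r (qv s) (e1 , e2) c = cong qv (δ-pos {s} {r} (subst (0 <_) (sym e1) (s≤s z≤n)))

qvar-env : ∀ r Γ → Fits Γ (profileOf (qvar r)) → All (λ it → cost (profileOf (qvar r)) it ≡ 0) Γ → Γ ≡ qv r ∷ []
qvar-env r [] (e , f , q , l) cs with q (here refl)
... | ()
qvar-env r (it ∷ []) (e , f , q , (l ∷ [])) (c ∷ []) with qvar-item r it l c
... | refl = refl
qvar-env r (it ∷ it₂ ∷ Γ) (e , f , q , (l ∷ l₂ ∷ _)) (c ∷ c₂ ∷ _) with qvar-item r it l c | qvar-item r it₂ l₂ c₂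
... | refl | refl = ⊥-elim (Unique[x∷xs]⇒x∉xs (proj₂ e) (here refl))

bang-item : ∀ A it → ItemOK (profileOf (bang A)) it → cost (profileOf (bang A)) it ≡ 0 → IsBang it
bang-item A (lin w) (() , e2) c
bang-item A (tupP x z xs) l ()
bang-item A (bangI w) l c = w , refl
bang-item A (qv s) (() , e2) c

ItemOK-lins⁺ : ∀ P zs → All (LinearIn P) zs → All (ItemOK P) (map lin zs)
ItemOK-lins⁺ P [] [] = []
ItemOK-lins⁺ P (z ∷ zs) (l ∷ ls) = l ∷ ItemOK-lins⁺ P zs ls

μ-lins : ∀ P zs Γ → μ P (map lin zs ++ Γ) ≡ μ P Γ
μ-lins P [] Γ = refl
μ-lins P (z ∷ zs) Γ = μ-lins P zs Γ

m+n<o⇒m<o : ∀ m {n o} → m + n < o → m < o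
m+n<o⇒m<o m {n} p = ≤-<-trans (m≤m+n m n) p

m+n<o⇒n<o : ∀ m {n o} → m + n < o → n < o
m+n<o⇒n<o m {n} p = ≤-<-trans (m≤n+m n m) p

cost-bangI : ∀ M {x c} → #all (free x) M ≡ c → cost (profileOf M) (bangI x) ≡ distFrom1 c
cost-bangI M {x} e = cong distFrom1 (trans (#lin+#bang≡#all (free x) M) e)

fresh-≤⇒≢ : ∀ l {z u} → fresh l ≤ z → u ∈ l → z ≢ u
fresh-≤⇒≢ l p q refl = <-irrefl refl (<-≤-trans (<fresh l q) p)

module _ {Γ M M₁ x x'} (r : RenameOne x x' M M₁) (x≢x' : x ≢ x') (x'∉Γ : ¬ x' ∈ cvars Γ) (x'∉M : ¬ x' ∈ fv M) where

  private
    same : SameShape M M₁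
    same = RenameOne⇒SameShape r

    occ-other : ∀ m {w} → x ∉ cvars Γ → w ∈ cvars Γ → occ m (free w) M₁ ≡ occ m (free w) M
    occ-other m {w} x∉Γ w∈Γ = RenameOne-occ-other r m w (λ { refl → x∉Γ w∈Γ }) (λ { refl → x'∉Γ w∈Γ })

  ⊨-split-occurrence : (bangI x ∷ Γ) ⊨ M → (bangI x ∷ bangI x' ∷ Γ) ⊨ M₁
  ⊨-split-occurrence (((u₁ , u₂) , f , q , _ ∷ ls) , w) =
    ((AllP.¬Any⇒All¬ _ (λ { (here e) → x≢x' e ; (there s) → x∉Γ s }) ∷ AllP.¬Any⇒All¬ _ x'∉Γ ∷ Unique-tail u₁ , u₂) , fv₁ ,
     (λ s → q (subst (_ ∈_) (sym (SameShape-qvs same)) s)) ,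
     tt ∷ tt ∷ All-ItemOK-transport (profileOf M) (profileOf M₁) Γ ls (λ s → occ-other linear x∉Γ s , occ-other banged x∉Γ s)
                 (λ {s} _ → sym (SameShape-occ same linear (qbit s) tt) , sym (SameShape-occ same banged (qbit s) tt))) ,
    SameShape-WellBound same [] w
    where
    x∉Γ : x ∉ cvars Γ
    x∉Γ = Unique[x∷xs]⇒x∉xs u₁
    fv₁ : ∀ {v} → v ∈ fv M₁ → v ∈ x ∷ x' ∷ cvars Γ
    fv₁ {v} s with v ≟ x' | v ≟ x
    ... | yes e | _ = there (here e)
    ... | no _ | yes e = here e
    ... | no v≢x' | no v≢x with f (occurs⇒fv M (subst (0 <_) (RenameOne-occ-other r total v v≢x v≢x') (fv⇒occurs M₁ s)))
    ... | here e = ⊥-elim (v≢x e)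
    ... | there v∈Γ = there (there v∈Γ)

  μ-split-occurrence : ∀ {a} → x ∉ cvars Γ → #all (free x) M ≡ suc (suc a) →
                       μ (profileOf M₁) (bangI x ∷ bangI x' ∷ Γ) ≡ a + μ (profileOf M) Γ
  μ-split-occurrence {a} x∉Γ x-twice =
    cong₂ _+_ (cong distFrom1 (trans (#lin+#bang≡#all (free x) M₁) (suc-injective (trans (sym (RenameOne-#all-old x≢x' r)) x-twice))))
              (cong₂ _+_ (cong distFrom1 (trans (#lin+#bang≡#all (free x') M₁) (trans (RenameOne-#all-new x≢x' r) (cong suc (∉fv⇒#all≡0 M x'∉M)))))
                         (μ-cong (profileOf M₁) (profileOf M) Γ (λ s → cong₂ _+_ (occ-other linear x∉Γ s) (occ-other banged x∉Γ s))))

  contract-split-occurrence : renameF (contrRen x x' x) M₁ ≡ M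
  contract-split-occurrence = trans (RenameOne-contrRen r) (renameF-id (contrRen x x' x) M fixes)
    where
    fixes : ∀ v → v ∈ fv M → contrRen x x' x v ≡ v
    fixes v s with v ≟ x
    ... | yes e = trans (contrRen-merged x x' x v (inj₁ e)) (sym e)
    ... | no n = contrRen-other x x' x v n (λ { refl → x'∉M s })

Complete< : ℕ → Set
Complete< n = ∀ {Γ M} → size M < n → Γ ⊨ M → Γ ⊢ M

ZeroCost : Term → Env → Set
ZeroCost M Γ = All (λ it → cost (profileOf M) it ≡ 0) Γ

fresh-range : ∀ l k → Unique (range (fresh l) k) × All (λ z → ¬ z ∈ l) (range (fresh l) k)
fresh-range l k = range-Unique (fresh l) k , AllM.tabulate (λ z∈ z∈l → fresh-≤⇒≢ l (range-≥ (fresh l) k z∈) z∈l refl)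

LinearBinder-open : ∀ zs A → Confined 0 (length zs) A → Unique zs → All (λ z → ¬ z ∈ fv A) zs → LinearBinder (length zs) A →
  All (LinearIn (profileOf (open0 (map fvar zs) A))) zs
LinearBinder-open zs A v u a l = All-from-lookupℕ zs (λ j j<n →
  trans (occ-open-fresh linear zs A j v u a j<n) (proj₁ (l j j<n)) ,
  trans (occ-open-fresh banged zs A j v u a j<n) (proj₂ (l j j<n)))

⊨-open : ∀ {Γ A} it → qnames it ≡ [] → Unique (cnames it) → All (λ z → ¬ z ∈ cvars Γ ++ fv A) (cnames it) →
  Fits Γ (profileOf A) → WellBound (length (cnames it) ∷ []) A →
  (Confined 0 (length (cnames it)) A → ItemOK (profileOf (open0 (map fvar (cnames it)) A)) it) →
  (it ∷ Γ) ⊨ open0 (map fvar (cnames it)) A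
⊨-open {Γ} {A} it noq uz fresh ((u₁ , u₂) , f , q , ls) w item-ok =
  ((UniqueP.++⁺ uz u₁ (λ (z∈ , z∈Γ) → AllM.lookup fresh z∈ (MP.∈-++⁺ˡ z∈Γ)) , subst (λ l → Unique (l ++ qvars Γ)) (sym noq) u₂) ,
   fv' , (λ p → subst (λ l → _ ∈ l ++ qvars Γ) (sym noq) (qv' p)) ,
   item-ok v ∷ All-ItemOK-transport (profileOf A) (profileOf A') Γ ls hf hq) ,
  WellBound-substB [] [] (map fvar zs) A (subst (λ n → WellBound (n ∷ []) A) (sym (LP.length-map fvar zs)) w) (All-WellBound-fvars [] zs)
  where
  zs : List ℕ
  zs = cnames it
  A' : Term
  A' = open0 (map fvar zs) A
  v : Confined 0 (length zs) A
  v = WellBound⇒Confined [] (length zs) [] A w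
  fresh∉Γ : ∀ {x} → x ∈ cvars Γ → ¬ x ∈ zs
  fresh∉Γ x∈Γ x∈zs = AllM.lookup fresh x∈zs (MP.∈-++⁺ˡ x∈Γ)
  fv' : ∀ {x} → x ∈ fv A' → x ∈ zs ++ cvars Γ
  fv' {x} p with x ∈? zs
  ... | yes x∈zs = MP.∈-++⁺ˡ x∈zs
  ... | no x∉zs = MP.∈-++⁺ʳ zs (f (occurs⇒fv A (subst (0 <_) (occ-open-other total zs A x v x∉zs) (fv⇒occurs A' p))))
  qv' : ∀ {r} → r ∈ qvs A' → r ∈ qvars Γ
  qv' {r} p = q (occurs⇒qvs A (subst (0 <_) (occ-open-qbit total zs A r v) (qvs⇒occurs A' p)))
  hf : ∀ {x} → x ∈ cvars Γ → SameAt (profileOf A) (profileOf A') (free x)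
  hf {x} p = occ-open-other linear zs A x v (fresh∉Γ p) , occ-open-other banged zs A x v (fresh∉Γ p)
  hq : ∀ {r} → r ∈ qvars Γ → SameAt (profileOf A) (profileOf A') (qbit r)
  hq {r} p = occ-open-qbit linear zs A r v , occ-open-qbit banged zs A r v

fresh-∉ : ∀ {Γ A z} → ¬ z ∈ cvars Γ ++ fv A → ¬ z ∈ fv A
fresh-∉ {Γ} {A} z∉ z∈A = z∉ (MP.∈-++⁺ʳ (cvars Γ) z∈A)

module _ {n} (ih : Complete< n) where

  ⊨⇒⊢-bang : ∀ {Γ A} → size (bang A) < suc n → Γ ⊨ bang A → ZeroCost (bang A) Γ → Γ ⊢ bang A
  ⊨⇒⊢-bang {Γ} {A} p ((e , f , q , l) , w) zero-cost =
    prom bangs (ih (≤-pred p) ((e , f , q , All-IsBang⇒ItemOK (profileOf A) Γ bangs) , w))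
    where
    bangs : All IsBang Γ
    bangs = AllM.zipWith (λ {it} (ok , c) → bang-item A it ok c) (l , zero-cost)

  ⊨⇒⊢-lamBang : ∀ {Γ A} → size (lamBang A) < suc n → Γ ⊨ lamBang A → Γ ⊢ lamBang A
  ⊨⇒⊢-lamBang {Γ} {A} p (c , w) with fresh-range (cvars Γ ++ fv A) 1
  ... | u , z∉ ∷ [] = lam-! (fresh-∉ {Γ} {A} z∉) (ih (subst (_< n) (sym (size-open 0 zs A)) (≤-pred p))
                        (⊨-open {Γ} {A} (bangI z) refl u (z∉ ∷ []) (Fits-lamBang⁻ Γ A c) w (λ _ → tt)))
    where
    z : ℕ
    z = fresh (cvars Γ ++ fv A)
    zs : List ℕ
    zs = z ∷ []

  ⊨⇒⊢-lam-x : ∀ {Γ A} → size (lamPat pv A) < suc n → Γ ⊨ lamPat pv A → Γ ⊢ lamPat pv A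
  ⊨⇒⊢-lam-x {Γ} {A} p (c , w , l) with fresh-range (cvars Γ ++ fv A) 1
  ... | u , z∉ ∷ [] = lam-x (fresh-∉ {Γ} {A} z∉) (ih (subst (_< n) (sym (size-open 0 zs A)) (≤-pred p))
                        (⊨-open {Γ} {A} (lin z) refl u (z∉ ∷ []) (Fits-lamPat⁻ Γ pv A c) w
                          (λ v → AllM.head (LinearBinder-open zs A v u (fresh-∉ {Γ} {A} z∉ ∷ []) l))))
    where
    z : ℕ
    z = fresh (cvars Γ ++ fv A)
    zs : List ℕ
    zs = z ∷ []

  ⊨⇒⊢-lam-tup : ∀ {Γ A k} → size (lamPat (ptup k) A) < suc n → Γ ⊨ lamPat (ptup k) A → Γ ⊢ lamPat (ptup k) A
  ⊨⇒⊢-lam-tup {Γ} {A} {k} p (c , w , l) with fresh-range (cvars Γ ++ fv A) (suc (suc k))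
  ... | u , zs∉ =
    subst (λ k' → Γ ⊢ lamPat (ptup k') A) (range-length (suc (suc z)) k)
      (lam-tup zs∉A (ih (subst (_< n) (sym (size-open 0 zs A)) (≤-pred p))
        (⊨-open {Γ} {A} (tupP z (suc z) (range (suc (suc z)) k)) refl u zs∉ (Fits-lamPat⁻ Γ (ptup k) A c) w'
          (λ v → LinearBinder-open zs A v u zs∉A (subst (λ a → LinearBinder a A) (sym width≡) l)))))
    where
    z : ℕ
    z = fresh (cvars Γ ++ fv A)
    zs : List ℕ
    zs = range z (suc (suc k))
    width≡ : length zs ≡ suc (suc k)
    width≡ = range-length z (suc (suc k))
    w' : WellBound (length zs ∷ []) A
    w' = subst (λ a → WellBound (a ∷ []) A) (sym width≡) w
    zs∉A : All (λ z → ¬ z ∈ fv A) zs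
    zs∉A = AllM.map (fresh-∉ {Γ} {A}) zs∉

  ⊨⇒⊢-app : ∀ {Γ A B} → size (app A B) < suc n → Γ ⊨ app A B → ZeroCost (app A B) Γ → Γ ⊢ app A B
  ⊨⇒⊢-app {Γ} {A} {B} p (c , wA , wB) zero-cost
    with Γ₁ , Γ₂ , Γ↭ , (c₁ , _) , (c₂ , _) ← Fits-split Γ (profileOf A) (profileOf B) c (profileOf-coherent A) (profileOf-coherent B) zero-cost
    = exch (appR (ih (m+n<o⇒m<o (size A) (≤-pred p)) (c₁ , wA)) (ih (m+n<o⇒n<o (size A) (≤-pred p)) (c₂ , wB))
                 (IsEnv-↭ Γ↭ (proj₁ c)))
           (↭-sym Γ↭)

  ⊨⇒⊢-list : ∀ Γ As → sizes As < n → Fits Γ (profilesOf As) → WellBounds [] As → All (λ it → cost (profilesOf As) it ≡ 0) Γ →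
    Σ (List Env) λ Γs → Pointwise _⊢_ Γs As × Γ ↭ concat Γs
  ⊨⇒⊢-list Γ [] p c w zero-cost rewrite zero-cost-empty (profilesOf []) Γ (proj₂ (proj₂ (proj₂ c))) zero-cost (λ x → refl) (λ r → refl) =
    [] , [] , ↭-refl
  ⊨⇒⊢-list Γ (A ∷ As) p c (wA , wAs) zero-cost
    with Γ₁ , Γ₂ , Γ↭ , (c₁ , _) , (c₂ , zero-cost₂) ← Fits-split Γ (profileOf A) (profilesOf As) c (profileOf-coherent A) (profilesOf-coherent As) zero-cost
    with Γs , ⊢As , Γ₂↭ ← ⊨⇒⊢-list Γ₂ As (m+n<o⇒n<o (size A) p) c₂ wAs zero-cost₂
    = Γ₁ ∷ Γs , ih (m+n<o⇒m<o (size A) p) (c₁ , wA) ∷ ⊢As , Perm.trans Γ↭ (PP.++⁺ˡ Γ₁ Γ₂↭)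

  ⊨⇒⊢-tup : ∀ {Γ A B As} → size (tup A B As) < suc n → Γ ⊨ tup A B As → ZeroCost (tup A B As) Γ → Γ ⊢ tup A B As
  ⊨⇒⊢-tup {Γ} {A} {B} {As} p (c , wA , wB , wAs) zero-cost
    with Γ₁ , Γ₂₃ , Γ↭ , (c₁ , _) , (c₂₃ , zero-cost₂₃) ←
           Fits-split Γ (profileOf A) (profileOf B ⊕ profilesOf As) c (profileOf-coherent A)
             (⊕-coherent (profileOf B) (profilesOf As) (profileOf-coherent B) (profilesOf-coherent As)) zero-cost
    with Γ₂ , Γ₃ , Γ₂₃↭ , (c₂ , _) , (c₃ , zero-cost₃) ←
           Fits-split Γ₂₃ (profileOf B) (profilesOf As) c₂₃ (profileOf-coherent B) (profilesOf-coherent As) zero-cost₂₃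
    with Γs , ⊢As , Γ₃↭ ← ⊨⇒⊢-list Γ₃ As (m+n<o⇒n<o (size B) (m+n<o⇒n<o (size A) (≤-pred p))) c₃ wAs zero-cost₃
    = exch (tupR (ih (m+n<o⇒m<o (size A) (≤-pred p)) (c₁ , wA)) (ih (m+n<o⇒m<o (size B) (m+n<o⇒n<o (size A) (≤-pred p))) (c₂ , wB)) ⊢As
                 (IsEnv-↭ Γ↭' (proj₁ c)))
           (↭-sym Γ↭')
    where
    Γ↭' : Γ ↭ Γ₁ ++ Γ₂ ++ concat Γs
    Γ↭' = Perm.trans Γ↭ (PP.++⁺ˡ Γ₁ (Perm.trans Γ₂₃↭ (PP.++⁺ˡ Γ₂ Γ₃↭)))

  ⊨⇒⊢-syntactic : ∀ {Γ M} → size M < suc n → Γ ⊨ M → ZeroCost M Γ → Γ ⊢ M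
  ⊨⇒⊢-syntactic {Γ} {fvar y} p (c , w) zero-cost with fvar-env y Γ c zero-cost
  ... | inj₁ refl = ax-c y
  ... | inj₂ refl = der (ax-c y)
  ⊨⇒⊢-syntactic {M = bvar i j} p (c , ())
  ⊨⇒⊢-syntactic {Γ} {qvar r} p (c , w) zero-cost with refl ← qvar-env r Γ c zero-cost = ax-q r
  ⊨⇒⊢-syntactic {M = bang A} p ⊨M zero-cost = ⊨⇒⊢-bang p ⊨M zero-cost
  ⊨⇒⊢-syntactic {Γ} {czero} p ((_ , _ , _ , ok) , _) zero-cost
    with refl ← zero-cost-empty (profileOf czero) Γ ok zero-cost (λ x → refl) (λ r → refl) = ax-0
  ⊨⇒⊢-syntactic {Γ} {cone} p ((_ , _ , _ , ok) , _) zero-cost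
    with refl ← zero-cost-empty (profileOf cone) Γ ok zero-cost (λ x → refl) (λ r → refl) = ax-1
  ⊨⇒⊢-syntactic {Γ} {cU i} p ((_ , _ , _ , ok) , _) zero-cost
    with refl ← zero-cost-empty (profileOf (cU i)) Γ ok zero-cost (λ x → refl) (λ r → refl) = ax-U i
  ⊨⇒⊢-syntactic {M = new A} p (c , w) zero-cost = newR (ih (≤-pred p) (c , w))
  ⊨⇒⊢-syntactic {M = app A B} p ⊨M zero-cost = ⊨⇒⊢-app p ⊨M zero-cost
  ⊨⇒⊢-syntactic {M = tup A B As} p ⊨M zero-cost = ⊨⇒⊢-tup p ⊨M zero-cost
  ⊨⇒⊢-syntactic {M = lamBang A} p ⊨M zero-cost = ⊨⇒⊢-lamBang p ⊨M
  ⊨⇒⊢-syntactic {M = lamPat pv A} p ⊨M zero-cost = ⊨⇒⊢-lam-x p ⊨M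
  ⊨⇒⊢-syntactic {M = lamPat (ptup k) A} p ⊨M zero-cost = ⊨⇒⊢-lam-tup p ⊨M

Bounded : ℕ → ℕ → Set
Bounded n k = ∀ {Γ M} → size M < suc n → μ (profileOf M) Γ < k → Γ ⊨ M → Γ ⊢ M

module _ {n k} (ih : Bounded n k) where

  ⊨⇒⊢-pattern : ∀ {Γ M x y xs} → size M < suc n → 1 + μ (profileOf M) Γ ≤ k → (tupP x y xs ∷ Γ) ⊨ M → (tupP x y xs ∷ Γ) ⊢ M
  ⊨⇒⊢-pattern {Γ} {M} {x} {y} {xs} p budget (((u₁ , u₂) , f , q , l ∷ ls) , w) =
    pat (ih {map lin zs ++ Γ} {M} p (subst (_< k) (sym (μ-lins (profileOf M) zs Γ)) budget)
      (((subst Unique (sym (cvars-lins zs Γ)) u₁ , subst Unique (sym (qvars-lins zs Γ)) u₂) ,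
        (λ {v} r → subst (v ∈_) (sym (cvars-lins zs Γ)) (f r)) , (λ {v} r → subst (v ∈_) (sym (qvars-lins zs Γ)) (q r)) ,
        AllP.++⁺ (ItemOK-lins⁺ (profileOf M) zs l) ls) , w))
    where
    zs : List ℕ
    zs = x ∷ y ∷ xs

  ⊨⇒⊢-weaken : ∀ {Γ M x} → size M < suc n → 1 + μ (profileOf M) Γ ≤ k → #all (free x) M ≡ 0 → (bangI x ∷ Γ) ⊨ M → (bangI x ∷ Γ) ⊢ M
  ⊨⇒⊢-weaken {Γ} {M} {x} p budget x-absent (((u₁ , u₂) , f , q , _ ∷ ls) , w) =
    weak (ih {Γ} {M} p budget (((Unique-tail u₁ , u₂) , fv⊆Γ , q , ls) , w)) (u₁ , u₂)
    where
    fv⊆Γ : ∀ {v} → v ∈ fv M → v ∈ cvars Γ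
    fv⊆Γ v∈M with f v∈M
    ... | here refl with () ← subst (0 <_) x-absent (fv⇒occurs M v∈M)
    ... | there v∈Γ = v∈Γ

  ⊨⇒⊢-contract : ∀ {Γ M x a} → size M < suc n → suc a + μ (profileOf M) Γ ≤ k → #all (free x) M ≡ suc (suc a) →
                 (bangI x ∷ Γ) ⊨ M → (bangI x ∷ Γ) ⊢ M
  ⊨⇒⊢-contract {Γ} {M} {x} {a} p budget x-twice ⊨M@(((u₁ , _) , _) , _) =
    subst ((bangI x ∷ Γ) ⊢_) (contract-split-occurrence {Γ} r x≢x' x'∉Γ x'∉M)
      (contr (ih {bangI x ∷ bangI x' ∷ Γ} {M₁} (subst (_< suc n) (SameShape-size (RenameOne⇒SameShape r)) p)
                 (subst (_< k) (sym (μ-split-occurrence {Γ} r x≢x' x'∉Γ x'∉M (Unique[x∷xs]⇒x∉xs u₁) x-twice)) budget)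
                 (⊨-split-occurrence {Γ} r x≢x' x'∉Γ x'∉M ⊨M))
             (u₁ , proj₂ (proj₁ (_⊨_.fits ⊨M))))
    where
    used : List ℕ
    used = cvars (bangI x ∷ Γ) ++ fv M
    x' : ℕ
    x' = fresh used
    x≢x' : x ≢ x'
    x≢x' e = fresh∉ used (subst (_∈ used) e (here refl))
    x'∉Γ : ¬ x' ∈ cvars Γ
    x'∉Γ s = fresh∉ used (MP.∈-++⁺ˡ (there s))
    x'∉M : ¬ x' ∈ fv M
    x'∉M s = fresh∉ used (MP.∈-++⁺ʳ (cvars (bangI x ∷ Γ)) s)
    M₁ : Term
    M₁ = proj₁ (RenameOne-exists x x' M (subst (0 <_) (sym x-twice) (s≤s z≤n)))
    r : RenameOne x x' M M₁
    r = proj₂ (RenameOne-exists x x' M (subst (0 <_) (sym x-twice) (s≤s z≤n)))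

  ⊨⇒⊢-item : ∀ it Γ M → size M < suc n → cost (profileOf M) it + μ (profileOf M) Γ ≤ k → 0 < cost (profileOf M) it →
             (it ∷ Γ) ⊨ M → (it ∷ Γ) ⊢ M
  ⊨⇒⊢-item (lin x) Γ M p budget () ⊨M
  ⊨⇒⊢-item (qv r) Γ M p budget () ⊨M
  ⊨⇒⊢-item (tupP x y xs) Γ M p budget _ ⊨M = ⊨⇒⊢-pattern p budget ⊨M
  ⊨⇒⊢-item (bangI x) Γ M p budget positive ⊨M with #all (free x) M in x-count
  ... | zero = ⊨⇒⊢-weaken p (subst (λ c → c + μ (profileOf M) Γ ≤ k) (cost-bangI M x-count) budget) x-count ⊨M
  ... | suc zero with () ← subst (0 <_) (cost-bangI M x-count) positive
  ... | suc (suc a) = ⊨⇒⊢-contract p (subst (λ c → c + μ (profileOf M) Γ ≤ k) (cost-bangI M x-count) budget) x-count ⊨M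

⊨⇒⊢-bounded : ∀ {n} → Complete< n → ∀ k → Bounded n k
⊨⇒⊢-bounded ih (suc k) {Γ} {M} p μ<k ⊨M with μ (profileOf M) Γ in μ≡
... | zero = ⊨⇒⊢-syntactic ih p ⊨M (μ≡0⇒cost≡0 (profileOf M) Γ μ≡)
... | suc _ with pre , it , post , refl , positive ← positive-cost-item (profileOf M) Γ (subst (0 <_) (sym μ≡) (s≤s z≤n)) =
  exch (⊨⇒⊢-item (⊨⇒⊢-bounded ih k) it (pre ++ post) M p budget positive (⊨-↭ (PP.shift it pre post) ⊨M))
       (↭-sym (PP.shift it pre post))
  where
  P : Profile
  P = profileOf M
  budget : cost P it + μ P (pre ++ post) ≤ k
  budget = subst (_≤ k) (trans (sym μ≡) (trans (μ-++ P pre (it ∷ post))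
             (trans (x∙yz≈y∙xz (μ P pre) (cost P it) (μ P post)) (cong (cost P it +_) (sym (μ-++ P pre post)))))) (≤-pred μ<k)

⊨⇒⊢-below : ∀ n → Complete< n
⊨⇒⊢-below (suc n) {Γ} {M} p ⊨M = ⊨⇒⊢-bounded (⊨⇒⊢-below n) (suc (μ (profileOf M) Γ)) p ≤-refl ⊨M

⊨⇒⊢ : ∀ {Γ M} → Γ ⊨ M → Γ ⊢ M
⊨⇒⊢ = ⊨⇒⊢-below _ ≤-refl


filter-∉-++ : ∀ L QV → All (λ r → ¬ r ∈ QV) L → filter (_∉? QV) (L ++ QV) ≡ L
filter-∉-++ L QV L∉QV = begin
  filter (_∉? QV) (L ++ QV)                  ≡⟨ LP.filter-++ (_∉? QV) L QV ⟩
  filter (_∉? QV) L ++ filter (_∉? QV) QV   ≡⟨ cong₂ _++_ (LP.filter-all (_∉? QV) L∉QV) (LP.filter-none (_∉? QV) (AllM.tabulate λ r∈ r∉ → r∉ r∈)) ⟩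
  L ++ []                                    ≡⟨ ++-identityʳ L ⟩
  L                                          ∎
  where open ≡-Reasoning

mainTheorem2 : (D : QData) (Γ : Env) (M : Term) → Γ ⊢ M →
    (Q : State D) (QV : List ℕ) → All (_∈ QV) (qvs M) →
    (Q' : State D) (QV' : List ℕ) (M' : Term) →
    Star (_⟶_ D) ⟦ Q , QV , M ⟧ ⟦ Q' , QV' , M' ⟧ →
    (Γ ++ map qv (filter (_∉? QV) QV')) ⊢ M'
mainTheorem2 D Γ M ⊢M Q QV M⊆QV Q' QV' M' steps
  with L , refl , L∉QV , ⊨M' ← ⊨-steps D steps (⊢⇒⊨ ⊢M) (λ r∈Γ → AllM.lookup M⊆QV (qvars⊆qvs (⊢⇒⊨ ⊢M) r∈Γ))
  rewrite filter-∉-++ L QV L∉QV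
  = ⊨⇒⊢ (⊨-↭ (PP.++-comm (map qv L) Γ) ⊨M')
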